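{- For each ordered pair $(b,c)\in\{(1,3),(2,3),(2,6),(3,3),(3,4),(3,9)\}$, every nonnegative integer $n$ can be written as $n=p_5(x)+b\,p_5(y)+c\,p_5(z)$ for some integers $x,y,z\in\mathbb{Z}$, where $p_5(t)=\frac{3t^2-t}{2}$.
   Context: For an integer $m\geq 3$ and $x\in\mathbb{Z}$, $p_m(x)=(m-2)\frac{x(x-1)}{2}+x$; values $p_m(x)$ with $x\in\mathbb{Z}$ are called generalized $m$-gonal numbers. In particular $p_5(x)=\frac{3x^2-x}{2}$. A sum $a p_i+b p_j+c p_k$ (with $a,b,c$ positive integers) is called universal over $\mathbb{Z}$ if every $n\in\{0,1,2,\dots\}$ equals $a p_i(x)+b p_j(y)+c p_k(z)$ for some $x,y,z\in\mathbb{Z}$. -}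

module Defs where

open import Data.Nat using (ℕ)
open import Data.Integer using (ℤ; +_; _+_; _*_; _-_)
open import Data.Integer.DivMod using (_/ℕ_)

-- Generalized m-gonal number: p_m(x) = (m-2) * x(x-1)/2 + x, for x ∈ ℤ.
-- x(x-1) is always even, so the division by 2 is exact.
p : ℕ → ℤ → ℤ
p m x = ((+ m) - + 2) * ((x * (x - + 1)) /ℕ 2) + x

p₅ : ℤ → ℤ
p₅ = p 5

{-# OPTIONS --safe #-}

-- Completing squares, n = p₅(x) + b p₅(y) + c p₅(z) says that 24n + 1 + b + c = X² + bY² + cZ²
-- with X, Y, Z prime to 6.  Integral identities reduce the six cases to the representation of
-- certain N by x² + y² + z², x² + y² + 3z² or x² + 3y² + 3z².  Such an N is a binary minor of the
-- form itself, so it suffices to border a binary form mx² + 2bxy + cy² of determinant N (or 3N) to a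
-- positive ternary form of determinant 1 or 3: Selling reduction leaves only the desired class
-- (and, for determinant 3, one more, which is excluded modulo 3).  The bordering needs an m in a
-- prescribed residue class, up to squares, modulo which -N is a square.  Instead of Dirichlet's
-- theorem on primes, consider f(n) = Σ_{d∣n} χ(d) with χ = (-N/·), which vanishes unless the primes
-- of odd exponent in n split.  By the hyperbola method the sums of f over n ≤ Y², n ≡ a, for two
-- classes a with χ(a) = 1 differ by at most 3Y, while for a = 1 the sum exceeds 3Y, because f ≥ 1
-- on the values of x² + Ny².  That χ is a character is quadratic reciprocity, proved for Jacobi
-- symbols by Gauss's lemma and Eisenstein's lattice points.

module Submission where

open import Defs using (p₅)
open import Data.Nat as ℕ using (ℕ; zero; suc; z≤n; s≤s; NonZero)
import Data.Nat.Properties as ℕ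
import Data.Nat.DivMod as ℕ
import Data.Nat.Divisibility as ℕ
open import Data.Nat.Divisibility using (divides; divides-refl)
import Data.Nat.Coprimality as Coprime
open import Data.Nat.GCD using (module Bézout)
open import Data.Nat.Induction using (<-wellFounded)
import Data.Nat.ListAction as ℕ
open import Data.Nat.Primality using (Prime; ¬prime[1]; prime⇒irreducible; euclidsLemma; prime⇒nonZero; prime⇒nonTrivial)
open import Data.Nat.Primality.Factorisation using (factorise; PrimeFactorisation)
open import Data.Nat.Tactic.RingSolver using () renaming (solve-∀ to solveℕ)
open import Data.Integer using (ℤ; +_; -[1+_]; _+_; _*_; _-_; -_; ∣_∣; _⊖_; _≤_; _<_; -≤+; +≤+; +<+; _◃_; sign)
import Data.Integer.Properties as ℤ
import Data.Integer.Divisibility.Signed as Signed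
open import Data.Integer.DivMod using (_/ℕ_; _%ℕ_; n%ℕd<d; a≡a%ℕn+[a/ℕn]*n)
open import Data.Integer.Tactic.RingSolver using (solve-∀)
open import Data.Bool using (Bool; true; false; T; if_then_else_)
open import Data.Empty using (⊥; ⊥-elim)
open import Data.Fin as Fin using (Fin; toℕ; fromℕ<)
open import Data.Fin.Patterns using (0F; 1F; 2F; 3F; 4F; 5F)
open import Data.Fin.Permutation using (Permutation; permutation)
import Data.Fin.Properties as Fin
open import Data.List using ([]; _∷_)
import Data.List.Relation.Unary.All as All
open import Data.Product using (∃-syntax; _×_; _,_; proj₁; proj₂)
open import Data.Sign as Sign using (Sign)
import Data.Sign.Properties as Sign
open import Data.Sum as ⊎ using (_⊎_; inj₁; inj₂)
open import Data.Unit using (tt)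
open import Data.Vec using (Vec; []; _∷_; replicate; zipWith; map)
import Data.Vec.Properties as Vec
open import Function using (_∘_)
open import Induction.WellFounded using (Acc; acc)
open import Relation.Nullary using (Dec; ¬_; ¬?; yes; no; contradiction)
open import Relation.Nullary.Decidable using (_→-dec_; _⊎-dec_; _×-dec_; toWitness)
open import Relation.Binary.PropositionalEquality hiding (J)
import Algebra.Properties.CommutativeMonoid.Sum as Sum

-- Congruences and centred residues

-- The bordered form has Gram matrix with rows (m, b, 0), (b, c, s), (0, s, t) and determinant tN -
-- ms². It sees m only through ms²; this is why m is wanted merely up to squares and primes can be
-- avoided. For each family of N a class a, such as 2N - 1 or 4N - 3, is chosen so that tN - a is
-- the wanted determinant for a constant t, while (-N/a) can be evaluated at sight by scaling -N to
-- -1 or -3 modulo a. This a is composite in general, so reciprocity has to hold for Jacobi symbols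
-- from the start. Comparing classes replaces the nonvanishing of L(1, χ): the error 3Y is only
-- linear in Y, so it is enough to exhibit slightly more than 3Y norms below Y², a fixed number of
-- them between successive squares from the class of 1. In the return to pentagonal numbers the
-- delicate point is that no variable may be divisible by 2 or 3; this is restored by
-- multiplications in ℤ[√-3], by a rotation with denominator 3, and by descents through the factors
-- 4 and 9 inside a residue class.

infix 4 _≈_[_]

-- The multiplier is kept as data: ring identities supply it directly, and the multipliers found by
-- `class-root` later become entries of the bordered ternary forms.
record _≈_[_] (x y n : ℤ) : Set where
  constructor step
  field
    multiple : ℤ
    shift    : x ≡ y + multiple * n

≈-reflexive : ∀ {x y n} → x ≡ y → x ≈ y [ n ]
≈-reflexive {x} {y} {n} refl = step (+ 0) (lem x n)
  where
  lem : ∀ x n → x ≡ x + + 0 * n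
  lem = solve-∀

≈-refl : ∀ {x n} → x ≈ x [ n ]
≈-refl = ≈-reflexive refl

≈-sym : ∀ {x y n} → x ≈ y [ n ] → y ≈ x [ n ]
≈-sym {x} {y} {n} (step k refl) = step (- k) (lem y k n)
  where
  lem : ∀ y k n → y ≡ y + k * n + - k * n
  lem = solve-∀

≈-trans : ∀ {x y z n} → x ≈ y [ n ] → y ≈ z [ n ] → x ≈ z [ n ]
≈-trans {z = z} {n} (step k refl) (step l refl) = step (l + k) (lem z k l n)
  where
  lem : ∀ z k l n → z + l * n + k * n ≡ z + (l + k) * n
  lem = solve-∀

≈-+ : ∀ {x y z w n} → x ≈ y [ n ] → z ≈ w [ n ] → x + z ≈ y + w [ n ]
≈-+ {y = y} {w = w} {n} (step k refl) (step l refl) = step (k + l) (lem y w k l n)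
  where
  lem : ∀ y w k l n → (y + k * n) + (w + l * n) ≡ y + w + (k + l) * n
  lem = solve-∀

≈-* : ∀ {x y z w n} → x ≈ y [ n ] → z ≈ w [ n ] → x * z ≈ y * w [ n ]
≈-* {y = y} {w = w} {n} (step k refl) (step l refl) = step (k * w + y * l + k * l * n) (lem y w k l n)
  where
  lem : ∀ y w k l n → (y + k * n) * (w + l * n) ≡ y * w + (k * w + y * l + k * l * n) * n
  lem = solve-∀

≈-*ˡ : ∀ {y z n} x → y ≈ z [ n ] → x * y ≈ x * z [ n ]
≈-*ˡ x = ≈-* (≈-refl {x})

≈-*ʳ : ∀ {x y n} z → x ≈ y [ n ] → x * z ≈ y * z [ n ]
≈-*ʳ z p = ≈-* p (≈-refl {z})

≈-neg : ∀ {x y n} → x ≈ y [ n ] → - x ≈ - y [ n ]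
≈-neg {y = y} {n} (step k refl) = step (- k) (lem y k n)
  where
  lem : ∀ y k n → - (y + k * n) ≡ - y + - k * n
  lem = solve-∀

∣k*n∣<n⇒k≡0 : ∀ k n → ∣ k * + n ∣ ℕ.< n → k ≡ + 0
∣k*n∣<n⇒k≡0 k n lt = ℤ.∣i∣≡0⇒i≡0 (small ∣ k ∣ (subst (ℕ._< n) (ℤ.abs-* k (+ n)) lt))
  where
  small : ∀ j → j ℕ.* n ℕ.< n → j ≡ 0
  small zero    _  = refl
  small (suc j) lt = contradiction (ℕ.m≤m+n n (j ℕ.* n)) (ℕ.<⇒≱ lt)

≈0⇒≡0 : ∀ {x n} → ∣ x ∣ ℕ.< n → x ≈ + 0 [ + n ] → x ≡ + 0
≈0⇒≡0 {x} {n} lt (step k refl) = trans (ℤ.+-identityˡ _) (cong (_* + n) k≡0)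
  where
  k≡0 = ∣k*n∣<n⇒k≡0 k n (subst (ℕ._< n) (cong ∣_∣ (ℤ.+-identityˡ (k * + n))) lt)

-- An odd modulus is carried by its half `h`, which is also the size of the half-system in Gauss's
-- lemma and the exponent in Euler's criterion.
odd : ℕ → ℕ
odd h = suc (2 ℕ.* h)

∃centred : ∀ h x → ∃[ r ] ∣ r ∣ ℕ.≤ h × x ≈ r [ + odd h ]
∃centred h x with x %ℕ odd h ℕ.≤? h
... | yes r≤h = + (x %ℕ odd h) , r≤h , step (x /ℕ odd h) (a≡a%ℕn+[a/ℕn]*n x (odd h))
... | no r≰h = r ⊖ n , small , step (q + + 1) eq
  where
  n = odd h
  r = x %ℕ n
  q = x /ℕ n
  small : ∣ r ⊖ n ∣ ℕ.≤ h
  small = begin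
    ∣ r ⊖ n ∣         ≡⟨ ℤ.∣⊖∣-≤ (ℕ.<⇒≤ (n%ℕd<d x n)) ⟩
    n ℕ.∸ r           ≤⟨ ℕ.∸-monoʳ-≤ n (ℕ.≰⇒> r≰h) ⟩
    2 ℕ.* h ℕ.∸ h     ≡⟨ ℕ.m+n∸m≡n h (h ℕ.+ 0) ⟩
    h ℕ.+ 0           ≡⟨ ℕ.+-identityʳ h ⟩
    h                 ∎
    where open ℕ.≤-Reasoning
  lem : ∀ r q n → r + q * n ≡ (r - n) + (q + + 1) * n
  lem = solve-∀
  eq : x ≡ (r ⊖ n) + (q + + 1) * + n
  eq = trans (a≡a%ℕn+[a/ℕn]*n x n) (trans (lem (+ r) q (+ n)) (cong (_+ (q + + 1) * + n) (ℤ.m-n≡m⊖n r n)))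

abstract
  centred : ∀ h x → ∃[ r ] ∣ r ∣ ℕ.≤ h × x ≈ r [ + odd h ]
  centred = ∃centred

-- The difference is at most 2h in absolute value, which is less than the modulus.
centred-unique : ∀ {h r s} → ∣ r ∣ ℕ.≤ h → ∣ s ∣ ℕ.≤ h → r ≈ s [ + odd h ] → r ≡ s
centred-unique {h} {r} {s} r≤ s≤ (step k eq) = trans eq (trans (cong (λ t → s + t * + odd h) k≡0) (lem s (+ odd h)))
  where
  lem : ∀ s n → s + + 0 * n ≡ s
  lem = solve-∀
  lem₂ : ∀ s t → t ≡ s + t - s
  lem₂ = solve-∀
  bound : ∣ k * + odd h ∣ ℕ.< odd h
  bound = begin-strict
    ∣ k * + odd h ∣              ≡⟨ cong ∣_∣ (trans (lem₂ s _) (cong (_- s) (sym eq))) ⟩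
    ∣ r - s ∣                    ≤⟨ ℤ.∣i-j∣≤∣i∣+∣j∣ r s ⟩
    ∣ r ∣ ℕ.+ ∣ s ∣              ≤⟨ ℕ.+-mono-≤ r≤ s≤ ⟩
    h ℕ.+ h                      ≡⟨ cong (h ℕ.+_) (sym (ℕ.+-identityʳ h)) ⟩
    2 ℕ.* h                      <⟨ ℕ.n<1+n _ ⟩
    odd h                        ∎
    where open ℕ.≤-Reasoning
  k≡0 = ∣k*n∣<n⇒k≡0 k (odd h) bound

-- The Jacobi symbol

module Π = Sum Sign.*-commutativeMonoid

σ : Sign → ℤ
σ s = s ◃ 1

σ*σ : ∀ s x → σ s * (σ s * x) ≡ x
σ*σ Sign.+ x = lem x
  where
  lem : ∀ x → + 1 * (+ 1 * x) ≡ x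
  lem = solve-∀
σ*σ Sign.- x = lem x
  where
  lem : ∀ x → - + 1 * (- + 1 * x) ≡ x
  lem = solve-∀

sign-abs : ∀ r → r ≡ σ (sign r) * + ∣ r ∣
sign-abs (+ n)    = sym (ℤ.*-identityˡ (+ n))
sign-abs -[1+ n ] = cong -[1+_] (sym (ℕ.+-identityʳ n))

sign-σσ : ∀ s t k → sign (σ s * (σ t * + suc k)) ≡ s Sign.* t
sign-σσ Sign.+ Sign.+ k = refl
sign-σσ Sign.+ Sign.- k = refl
sign-σσ Sign.- Sign.+ k = refl
sign-σσ Sign.- Sign.- k = refl

∣σ*∣ : ∀ s x → ∣ σ s * x ∣ ≡ ∣ x ∣
∣σ*∣ s x = trans (ℤ.abs-* (σ s) x) (trans (cong (ℕ._* ∣ x ∣) (ℤ.abs-◃ s 1)) (ℕ.*-identityˡ ∣ x ∣))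

-- Coprimality in Bézout form. It makes sense for every integral modulus and is symmetric in modulus
-- and argument (`Unit-swap`), as reciprocity requires.
record Unit (n a : ℤ) : Set where
  constructor unit
  field
    inverse : ℤ
    product : a * inverse ≈ + 1 [ n ]
open Unit

Unit-* : ∀ {n a b} → Unit n a → Unit n b → Unit n (a * b)
Unit-* {n} {a} {b} (unit a′ p) (unit b′ q) = unit (a′ * b′) (≈-trans (≈-reflexive (lem a b a′ b′)) (≈-* p q))
  where
  lem : ∀ a b a′ b′ → a * b * (a′ * b′) ≡ (a * a′) * (b * b′)
  lem = solve-∀

Unit-cong : ∀ {n a b} → a ≈ b [ n ] → Unit n a → Unit n b
Unit-cong p (unit a′ q) = unit a′ (≈-trans (≈-*ʳ a′ (≈-sym p)) q)

residue : ℕ → ℤ → ℤ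
residue h x = proj₁ (centred h x)

residue-small : ∀ h x → ∣ residue h x ∣ ℕ.≤ h
residue-small h x = proj₁ (proj₂ (centred h x))

residue-≈ : ∀ h x → x ≈ residue h x [ + odd h ]
residue-≈ h x = proj₂ (proj₂ (centred h x))

residue-unique : ∀ {h x r} → ∣ r ∣ ℕ.≤ h → x ≈ r [ + odd h ] → residue h x ≡ r
residue-unique {h} {x} r≤ p = centred-unique (residue-small h x) r≤ (≈-trans (≈-sym (residue-≈ h x)) p)

residue-cong : ∀ {h x y} → x ≈ y [ + odd h ] → residue h x ≡ residue h y
residue-cong {h} {x} {y} p = residue-unique (residue-small h y) (≈-trans p (residue-≈ h y))

num : ∀ {h} → Fin h → ℤ
num i = + suc (toℕ i)

num≤ : ∀ {h} (i : Fin h) → ∣ num i ∣ ℕ.≤ h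
num≤ = Fin.toℕ<n

h<odd : ∀ h → h ℕ.< odd h
h<odd h = s≤s (ℕ.m≤m+n h (h ℕ.+ 0))

-- Schering's extension of Gauss's lemma to composite odd moduli, taken as the
-- definition of the Jacobi symbol (a / 2h+1) for a coprime to 2h+1.
J : ℕ → ℤ → Sign
J h a = Π.sum {h} (λ i → sign (residue h (a * num i)))

J-cong : ∀ {h a b} → a ≈ b [ + odd h ] → J h a ≡ J h b
J-cong {h} p = Π.sum-cong-≗ {h} (λ i → cong sign (residue-cong {h} (≈-*ʳ (num i) p)))

module _ {h : ℕ} {a : ℤ} (u : Unit (+ odd h) a) where

  residue≢0 : ∀ (i : Fin h) → residue h (a * num i) ≢ + 0
  residue≢0 i eq with inverse u | product u
  ... | b | ab≈1 with ≈0⇒≡0 (ℕ.≤-<-trans (num≤ i) (h<odd h))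
      (≈-trans (≈-trans k≈ (≈-*ˡ b (≈-trans (residue-≈ h _) (≈-reflexive eq)))) (≈-reflexive (ℤ.*-zeroʳ b)))
    where
    lem : ∀ a b k → (a * b) * k ≡ b * (a * k)
    lem = solve-∀
    k≈ : num i ≈ b * (a * num i) [ + odd h ]
    k≈ = ≈-trans (≈-reflexive (sym (ℤ.*-identityˡ (num i))))
        (≈-trans (≈-*ʳ (num i) (≈-sym ab≈1)) (≈-reflexive (lem a b (num i))))
  ... | ()

  position : ∀ (i : Fin h) → ∃[ j ] ∣ residue h (a * num i) ∣ ≡ suc (toℕ {h} j)
  position i with ∣ residue h (a * num i) ∣ in eq | residue-small h (a * num i)
  ... | zero  | _ = contradiction (ℤ.∣i∣≡0⇒i≡0 eq) (residue≢0 i)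
  ... | suc k | k<h = fromℕ< k<h , cong suc (sym (Fin.toℕ-fromℕ< k<h))

  -- Multiplication by a unit permutes the half-system 1, ..., h up to sign: `π` is the permutation
  -- and `ε` the sign.
  π : Fin h → Fin h
  π i = proj₁ (position i)

  ε : Fin h → Sign
  ε i = sign (residue h (a * num i))

  residue-form : ∀ i → residue h (a * num i) ≡ σ (ε i) * num (π i)
  residue-form i = trans (sign-abs _) (cong (λ k → σ (ε i) * + k) (proj₂ (position i)))

  π-≈ : ∀ i → a * num i ≈ σ (ε i) * num (π i) [ + odd h ]
  π-≈ i = ≈-trans (residue-≈ h _) (≈-reflexive (residue-form i))

π∘π : ∀ {h a b} (u : Unit (+ odd h) a) (v : Unit (+ odd h) b) → b * a ≈ + 1 [ + odd h ] → ∀ i → π v (π u i) ≡ i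
π∘π {h} {a} {b} u v ba i = Fin.toℕ-injective
    (ℕ.suc-injective (trans (sym (proj₂ (position v (π u i)))) (trans (cong ∣_∣ eq) (∣σ*∣ (ε u i) (num i)))))
  where
  s = σ (ε u i)
  lem : ∀ a b s k → b * (s * (a * k)) ≡ s * ((b * a) * k)
  lem = solve-∀
  chain : b * num (π u i) ≈ s * num i [ + odd h ]
  chain = ≈-trans (≈-*ˡ b (≈-trans (≈-reflexive (sym (σ*σ (ε u i) _))) (≈-*ˡ s (≈-sym (π-≈ u i)))))
          (≈-trans (≈-reflexive (lem a b s (num i)))
          (≈-*ˡ s (≈-trans (≈-*ʳ (num i) ba) (≈-reflexive (ℤ.*-identityˡ (num i))))))
  eq : residue h (b * num (π u i)) ≡ s * num i
  eq = residue-unique (subst (ℕ._≤ h) (sym (∣σ*∣ (ε u i) (num i))) (num≤ i)) chain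

Unit-inverse : ∀ {n a} (u : Unit n a) → Unit n (inverse u)
Unit-inverse {n} {a} (unit b p) = unit a (≈-trans (≈-reflexive (ℤ.*-comm b a)) p)

perm : ∀ {h a} → Unit (+ odd h) a → Permutation h h
perm {h} {a} u@(unit b p) = permutation (π {h} u) (π {h} v) (π∘π {h} v u p) (π∘π {h} u v (product v))
  where v = Unit-inverse u

-- Multiplication by b followed by a composes two signed permutations. The signs of a then occur in
-- the order permuted by b, which leaves their product unchanged. Primality of the modulus does not
-- enter.
J-* : ∀ {h a b} → Unit (+ odd h) a → Unit (+ odd h) b → J h (a * b) ≡ J h a Sign.* J h b
J-* {h} {a} {b} u v = begin
  J h (a * b)                                    ≡⟨ Π.sum-cong-≗ {h} pointwise ⟩
  Π.sum {h} (λ i → ε {h} v i Sign.* ε {h} u (π v i))         ≡⟨ Π.∑-distrib-+ {h} (ε v) (ε u ∘ π v) ⟩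
  J h b Sign.* Π.sum {h} (ε u ∘ π v)                 ≡⟨
      cong (J h b Sign.*_) (sym (Π.sum-permute (ε u) (perm {h} v))) ⟩
  J h b Sign.* J h a                             ≡⟨ Sign.*-comm (J h b) (J h a) ⟩
  J h a Sign.* J h b                             ∎
  where
  open ≡-Reasoning
  lem : ∀ a b k → a * b * k ≡ a * (b * k)
  lem = solve-∀
  lem₂ : ∀ a s k → a * (s * k) ≡ s * (a * k)
  lem₂ = solve-∀
  pointwise : ∀ i → sign (residue h (a * b * num i)) ≡ ε v i Sign.* ε u (π v i)
  pointwise i = trans (cong sign (residue-unique small chain)) (sign-σσ s t (toℕ k))
    where
    s = ε v i
    t = ε u (π v i)
    k = π u (π v i)
    small : ∣ σ s * (σ t * num k) ∣ ℕ.≤ h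
    small = subst (ℕ._≤ h) (sym (trans (∣σ*∣ s _) (∣σ*∣ t _))) (num≤ k)
    chain : a * b * num i ≈ σ s * (σ t * num k) [ + odd h ]
    chain = ≈-trans (≈-reflexive (lem a b (num i))) (≈-trans (≈-*ˡ a (π-≈ v i))
            (≈-trans (≈-reflexive (lem₂ a (σ s) (num (π v i)))) (≈-*ˡ (σ s) (π-≈ u (π v i)))))

Unit-1 : ∀ {n} → Unit n (+ 1)
Unit-1 = unit (+ 1) ≈-refl

J-□ : ∀ {h a} → Unit (+ odd h) a → J h (a * a) ≡ Sign.+
J-□ {h} {a} u = trans (J-* {h} u u) (Sign.s*s≡+ (J h a))

J-1 : ∀ h → J h (+ 1) ≡ Sign.+
J-1 h = J-□ {h} {+ 1} Unit-1

-- Square roots modulo an odd prime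

module Πℤ = Sum ℤ.*-1-commutativeMonoid

coprime⇒Unit : ∀ {n k} → Coprime.Coprime n k → Unit (+ n) (+ k)
coprime⇒Unit {n} {k} c with Coprime.coprime-Bézout c
... | Bézout.+- x y eq = unit (- + y) (step (- + x) (lem (+ x) (+ y) (+ n) (+ k) (cast eq)))
  where
  cast : 1 ℕ.+ y ℕ.* k ≡ x ℕ.* n → + 1 + + y * + k ≡ + x * + n
  cast e = trans (cong (λ t → + 1 + t) (sym (ℤ.pos-* y k))) (trans (cong +_ e) (ℤ.pos-* x n))
  lem : ∀ x y n k → + 1 + y * k ≡ x * n → k * - y ≡ + 1 + - x * n
  lem x y n k e = trans (lem₁ y k) (trans (cong (λ t → + 1 - t) e) (lem₂ x n))
    where
    lem₁ : ∀ y k → k * - y ≡ + 1 - (+ 1 + y * k)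
    lem₁ = solve-∀
    lem₂ : ∀ x n → + 1 - x * n ≡ + 1 + - x * n
    lem₂ = solve-∀
... | Bézout.-+ x y eq = unit (+ y) (step (+ x) (trans (ℤ.*-comm (+ k) (+ y)) (sym (cast eq))))
  where
  cast : 1 ℕ.+ x ℕ.* n ≡ y ℕ.* k → + 1 + + x * + n ≡ + y * + k
  cast e = trans (cong (λ t → + 1 + t) (sym (ℤ.pos-* x n))) (trans (cong +_ e) (ℤ.pos-* y k))

Unit-cancelˡ : ∀ {n} c {x y} → Unit n c → c * x ≈ c * y [ n ] → x ≈ y [ n ]
Unit-cancelˡ {n} c {x} {y} (unit d cd) p = ≈-trans (≈-sym (undo x)) (≈-trans (≈-*ˡ d p) (undo y))
  where
  lem : ∀ c d x → d * (c * x) ≡ (c * d) * x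
  lem = solve-∀
  undo : ∀ x → d * (c * x) ≈ x [ n ]
  undo x = ≈-trans (≈-reflexive (lem c d x)) (≈-trans (≈-*ʳ x cd) (≈-reflexive (ℤ.*-identityˡ x)))

Unit-σ : ∀ {n} s → Unit n (σ s)
Unit-σ s = unit (σ s) (≈-reflexive (trans (cong (σ s *_) (sym (ℤ.*-identityʳ (σ s)))) (σ*σ s (+ 1))))

-- Coefficients of a monic polynomial, in increasing order, without the leading 1.
eval : ∀ {d} → Vec ℤ d → ℤ → ℤ
eval []       x = + 1
eval (c ∷ cs) x = c + x * eval cs x

-- Synthetic division by x - r.
quotient : ∀ {d} → Vec ℤ (suc d) → ℤ → Vec ℤ d
quotient (c ∷ [])      r = []
quotient (c ∷ d ∷ cs) r = eval (d ∷ cs) r ∷ quotient (d ∷ cs) r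

eval-quotient : ∀ {d} (cs : Vec ℤ (suc d)) r x → eval cs x ≡ eval cs r + (x - r) * eval (quotient cs r) x
eval-quotient (c ∷ [])     r x = lem c r x
  where
  lem : ∀ c r x → c + x * + 1 ≡ c + r * + 1 + (x - r) * + 1
  lem = solve-∀
eval-quotient (c ∷ d ∷ cs) r x = trans (cong (λ t → c + x * t) (eval-quotient (d ∷ cs) r x))
    (lem c r x (eval (d ∷ cs) r) _)
  where
  lem : ∀ c r x E Q → c + x * (E + (x - r) * Q) ≡ c + r * E + (x - r) * (E + x * Q)
  lem = solve-∀

module OddPrime (h : ℕ) (pr : Prime (odd h)) where

  p = odd h

  Unit-small : ∀ {k} → 0 ℕ.< k → k ℕ.< p → Unit (+ p) (+ k)
  Unit-small {suc k} _ k<p = coprime⇒Unit (Coprime.prime⇒coprime pr k<p)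

  zero-or-Unit : ∀ x → x ≈ + 0 [ + p ] ⊎ Unit (+ p) x
  zero-or-Unit x with residue h x in eq | residue-small h x | residue-≈ h x
  ... | + zero    | _ | x≈ = inj₁ x≈
  ... | + suc k   | k<h | x≈ = inj₂ (Unit-cong (≈-sym x≈) (Unit-small (s≤s z≤n) (ℕ.≤-<-trans k<h (h<odd h))))
  ... | -[1+ k ] | k<h | x≈ = inj₂ (Unit-cong (≈-trans (≈-reflexive (ℤ.-1*i≡-i (+ suc k))) (≈-sym x≈))
                                (Unit-* (Unit-σ Sign.-) (Unit-small (s≤s z≤n) (ℕ.≤-<-trans k<h (h<odd h)))))

  1≉0 : ¬ + 1 ≈ + 0 [ + p ]
  1≉0 e with ≈0⇒≡0 (ℕ.≤∧≢⇒< (s≤s z≤n) (λ 1≡p → ¬prime[1] (subst Prime (sym 1≡p) pr))) e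
  ... | ()

  -- Lagrange's bound by induction on the degree. Distinctness is stated as invertibility of the
  -- differences, so that the linear factor of the first root can be cancelled at all the others,
  -- which thus become roots of the quotient.
  too-many-roots : ∀ {d} (cs : Vec ℤ d) (r : Fin (suc d) → ℤ) →
                   (∀ i j → i ≢ j → Unit (+ p) (r i - r j)) → ¬ (∀ i → eval cs (r i) ≈ + 0 [ + p ])
  too-many-roots []          r distinct roots = 1≉0 (roots Fin.zero)
  too-many-roots cs@(_ ∷ _) r distinct roots =
    too-many-roots (quotient cs (r Fin.zero)) (r ∘ Fin.suc) (λ i j i≢j →
        distinct (Fin.suc i) (Fin.suc j) (i≢j ∘ Fin.suc-injective)) λ i →
      Unit-cancelˡ (r (Fin.suc i) - r Fin.zero) (distinct (Fin.suc i) Fin.zero λ ())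
        (≈-trans (≈-trans (≈-reflexive (lem _ _ _ (eval-quotient cs (r Fin.zero) (r (Fin.suc i)))))
                          (≈-+ (roots (Fin.suc i)) (≈-neg (roots Fin.zero))))
                 (≈-reflexive (sym (ℤ.*-zeroʳ (r (Fin.suc i) - r Fin.zero)))))
    where
    lem : ∀ a b c → a ≡ b + c → c ≡ a + - b
    lem _ b c refl = lem′ b c
      where
      lem′ : ∀ b c → c ≡ b + c + - b
      lem′ = solve-∀

_^ℤ_ : ℤ → ℕ → ℤ
x ^ℤ zero  = + 1
x ^ℤ suc n = x * x ^ℤ n

∏-scale : ∀ a n (f : Fin n → ℤ) → Πℤ.sum (λ i → a * f i) ≡ a ^ℤ n * Πℤ.sum f
∏-scale a zero    f = refl
∏-scale a (suc n) f = trans (cong (a * f Fin.zero *_) (∏-scale a n (f ∘ Fin.suc))) (lem a (f Fin.zero) (a ^ℤ n) _)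
  where
  lem : ∀ a x y z → a * x * (y * z) ≡ a * y * (x * z)
  lem = solve-∀

∏-cong-≈ : ∀ {m} n {f g : Fin n → ℤ} → (∀ i → f i ≈ g i [ m ]) → Πℤ.sum f ≈ Πℤ.sum g [ m ]
∏-cong-≈ zero    p = ≈-refl
∏-cong-≈ (suc n) p = ≈-* (p Fin.zero) (∏-cong-≈ n (p ∘ Fin.suc))

σ-* : ∀ s t → σ (s Sign.* t) ≡ σ s * σ t
σ-* s t = ℤ.◃-distrib-* s t 1 1

∏-σ : ∀ n (f : Fin n → Sign) → Πℤ.sum (σ ∘ f) ≡ σ (Π.sum f)
∏-σ zero    f = refl
∏-σ (suc n) f = trans (cong (σ (f Fin.zero) *_) (∏-σ n (f ∘ Fin.suc))) (sym (σ-* (f Fin.zero) _))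

∏-Unit : ∀ {m} n {f : Fin n → ℤ} → (∀ i → Unit m (f i)) → Unit m (Πℤ.sum f)
∏-Unit zero    u = Unit-1
∏-Unit (suc n) u = Unit-* (u Fin.zero) (∏-Unit n (u ∘ Fin.suc))

search : ∀ {n} {P Q : Fin n → Set} → (∀ i → P i ⊎ Q i) → (∃[ i ] P i) ⊎ (∀ i → Q i)
search {zero}  d = inj₂ λ ()
search {suc n} d with d Fin.zero | search (d ∘ Fin.suc)
... | inj₁ p | _            = inj₁ (Fin.zero , p)
... | inj₂ q | inj₁ (i , p) = inj₁ (Fin.suc i , p)
... | inj₂ q | inj₂ qs      = inj₂ λ { Fin.zero → q ; (Fin.suc i) → qs i }

module Legendre (h : ℕ) (pr : Prime (odd h)) where

  open OddPrime h pr

  num-Unit : ∀ (i : Fin h) → Unit (+ p) (num i)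
  num-Unit i = Unit-small (s≤s z≤n) (ℕ.≤-<-trans (num≤ i) (h<odd h))

  -- Both sides arise from the product of a·1, ..., a·h, computed once directly and once after
  -- reduction to the half-system; the common factor h! is a unit.
  gauss : ∀ {a} → Unit (+ p) a → a ^ℤ h ≈ σ (J h a) [ + p ]
  gauss {a} u = Unit-cancelˡ P (∏-Unit h num-Unit)
      (≈-trans (≈-reflexive left) (≈-trans (∏-cong-≈ h (π-≈ {h} u)) (≈-reflexive right)))
    where
    P = Πℤ.sum {h} num
    left : P * a ^ℤ h ≡ Πℤ.sum {h} (λ i → a * num i)
    left = trans (ℤ.*-comm P _) (sym (∏-scale a h num))
    right : Πℤ.sum {h} (λ i → σ (ε {h} u i) * num (π {h} u i)) ≡ P * σ (J h a)
    right = trans (Πℤ.∑-distrib-+ {h} (σ ∘ ε {h} u) (num ∘ π {h} u))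
            (trans (cong₂ _*_ (∏-σ h (ε {h} u)) (sym (Πℤ.sum-permute num (perm {h} u)))) (ℤ.*-comm (σ (J h a)) P))

  -- The polynomial x^(d+1) - 1, its leading coefficient being implicit.
  ^-1 : ∀ d → Vec ℤ (suc d)
  ^-1 d = - + 1 ∷ replicate d (+ 0)

  eval-^ : ∀ d x → eval (replicate d (+ 0)) x ≡ x ^ℤ d
  eval-^ zero    x = refl
  eval-^ (suc d) x = trans (ℤ.+-identityˡ _) (cong (x *_) (eval-^ d x))

  -- The squares of 1, ..., h are h distinct roots of x^h - 1. By `gauss` a nonsquare with symbol +
  -- would be one more root than the degree allows.
  sqrt : ∀ {a} → Unit (+ p) a → J h a ≡ Sign.+ → ∃[ b ] b * b ≈ a [ + p ]
  sqrt {a} u Ja with search (λ i → zero-or-Unit (a - num {h} i * num i))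
  ... | inj₁ (i , e) = num i , ≈-sym
      (≈-trans (≈-reflexive (lem a (num i * num i))) (≈-trans (≈-+ e ≈-refl) (≈-reflexive (ℤ.+-identityˡ _))))
    where
    lem : ∀ a b → a ≡ a - b + b
    lem = solve-∀
  ... | inj₂ nonroot = ⊥-elim (impossible h refl)
    where
    root : Fin (suc h) → ℤ
    root Fin.zero    = a
    root (Fin.suc i) = num i * num i

    power : ∀ i → root i ^ℤ h ≈ + 1 [ + p ]
    power Fin.zero    = ≈-trans (gauss u) (≈-reflexive (cong σ Ja))
    power (Fin.suc i) = ≈-trans (gauss (Unit-* (num-Unit i) (num-Unit i)))
        (≈-reflexive (cong σ (J-□ {h} (num-Unit i))))

    difference : ∀ i j → i ≢ j → Unit (+ p) (num {h} i * num i - num j * num j)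
    difference i j i≢j = subst (Unit (+ p)) (lem (num i) (num j)) (Unit-* minus (Unit-small (s≤s z≤n) i+j<p))
      where
      lem : ∀ x y → (x - y) * (x + y) ≡ x * x - y * y
      lem = solve-∀
      i+j<p : suc (toℕ i) ℕ.+ suc (toℕ j) ℕ.< p
      i+j<p = s≤s (ℕ.≤-trans (ℕ.+-mono-≤ (num≤ i) (num≤ j)) (ℕ.≤-reflexive (cong (h ℕ.+_) (sym (ℕ.+-identityʳ h)))))
      minus : Unit (+ p) (num i - num j)
      minus with zero-or-Unit (num i - num j)
      ... | inj₂ v = v
      ... | inj₁ e = contradiction (Fin.toℕ-injective (ℕ.suc-injective (ℤ.+-injective
                       (ℤ.i-j≡0⇒i≡j (num i) (num j) (≈0⇒≡0 (ℕ.≤-<-trans (ℤ.∣i-j∣≤∣i∣+∣j∣ (num i) (num j)) i+j<p)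
                           e))))) i≢j

    distinct : ∀ i j → i ≢ j → Unit (+ p) (root i - root j)
    distinct Fin.zero    Fin.zero    i≢j = contradiction refl i≢j
    distinct Fin.zero    (Fin.suc j) i≢j = nonroot j
    distinct (Fin.suc i) Fin.zero    i≢j =
        subst (Unit (+ p)) (lem a (num i * num i)) (Unit-* (Unit-σ Sign.-) (nonroot i))
      where
      lem : ∀ a b → - + 1 * (a - b) ≡ b - a
      lem = solve-∀
    distinct (Fin.suc i) (Fin.suc j) i≢j = difference i j (i≢j ∘ cong Fin.suc)

    impossible : ∀ d → h ≡ d → ⊥
    impossible zero    h≡0 = ¬prime[1] (subst (Prime ∘ odd) h≡0 pr)
    impossible (suc d) refl = too-many-roots (^-1 d) root distinct λ i →
      ≈-trans (≈-+ (≈-refl {x = - + 1}) (≈-trans (≈-*ˡ (root i) (≈-reflexive (eval-^ d (root i)))) (power i)))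
          ≈-refl

-- Quadratic reciprocity

module Σℕ = Sum ℕ.+-0-commutativeMonoid

sgn : ℕ → Sign
sgn zero    = Sign.+
sgn (suc n) = Sign.- Sign.* sgn n

sgn-+ : ∀ m n → sgn (m ℕ.+ n) ≡ sgn m Sign.* sgn n
sgn-+ zero    n = refl
sgn-+ (suc m) n = trans (cong (Sign.- Sign.*_) (sgn-+ m n)) (sym (Sign.*-assoc Sign.- (sgn m) (sgn n)))

sgn-2* : ∀ n → sgn (2 ℕ.* n) ≡ Sign.+
sgn-2* n = trans (cong (λ t → sgn (n ℕ.+ t)) (ℕ.+-identityʳ n)) (trans (sgn-+ n n) (Sign.s*s≡+ (sgn n)))

sgn-+2* : ∀ m n → sgn (m ℕ.+ 2 ℕ.* n) ≡ sgn m
sgn-+2* m n = trans (sgn-+ m (2 ℕ.* n)) (trans (cong (sgn m Sign.*_) (sgn-2* n)) (Sign.*-identityʳ (sgn m)))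

parity : ∀ n → ∃[ c ] (n ≡ 2 ℕ.* c ⊎ n ≡ odd c)
parity zero = 0 , inj₁ refl
parity (suc n) with parity n
... | c , inj₁ refl = c , inj₂ refl
... | c , inj₂ refl = suc c , inj₁ (lem c)
  where
  lem : ∀ c → suc (suc (2 ℕ.* c)) ≡ 2 ℕ.* suc c
  lem = solveℕ

Π-sgn : ∀ n (f : Fin n → ℕ) → Π.sum (sgn ∘ f) ≡ sgn (Σℕ.sum f)
Π-sgn zero    f = refl
Π-sgn (suc n) f = trans (cong (sgn (f Fin.zero) Sign.*_) (Π-sgn n (f ∘ Fin.suc))) (sym (sgn-+ (f Fin.zero) _))

module _ (g h : ℕ) where

  private
    m = odd g
    n = odd h

  floor : ℕ → ℕ
  floor k = (m ℕ.* k) ℕ./ n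

  double : ∀ k → + 2 * (+ suc (g ℕ.+ h) * + k) ≡ + ((m ℕ.* k) ℕ.% n) + + n * + (floor k ℕ.+ k)
  double k = begin
    + 2 * (+ suc (g ℕ.+ h) * + k)      ≡⟨ cong (+ 2 *_) (sym (ℤ.pos-* (suc (g ℕ.+ h)) k)) ⟩
    + 2 * + (suc (g ℕ.+ h) ℕ.* k)      ≡⟨ sym (ℤ.pos-* 2 (suc (g ℕ.+ h) ℕ.* k)) ⟩
    + (2 ℕ.* (suc (g ℕ.+ h) ℕ.* k))    ≡⟨ cong +_ (lem₁ g h k) ⟩
    + (m ℕ.* k ℕ.+ n ℕ.* k)            ≡⟨ cong (λ t → + (t ℕ.+ n ℕ.* k)) (ℕ.m≡m%n+[m/n]*n (m ℕ.* k) n) ⟩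
    + (r ℕ.+ floor k ℕ.* n ℕ.+ n ℕ.* k) ≡⟨ cong +_ (lem₂ r (floor k) n k) ⟩
    + (r ℕ.+ n ℕ.* (floor k ℕ.+ k))    ≡⟨ cong (λ t → + r + t) (ℤ.pos-* n (floor k ℕ.+ k)) ⟩
    + r + + n * + (floor k ℕ.+ k)      ∎
    where
    open ≡-Reasoning
    r = (m ℕ.* k) ℕ.% n
    lem₁ : ∀ g h k → 2 ℕ.* (suc (g ℕ.+ h) ℕ.* k) ≡ suc (2 ℕ.* g) ℕ.* k ℕ.+ suc (2 ℕ.* h) ℕ.* k
    lem₁ = solveℕ
    lem₂ : ∀ r e n k → r ℕ.+ e ℕ.* n ℕ.+ n ℕ.* k ≡ r ℕ.+ n ℕ.* (e ℕ.+ k)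
    lem₂ = solveℕ

  -- Writing mk = r + n⌊mk/n⌋, the number (m+n)k is r modulo 2n if ⌊mk/n⌋ + k is even
  -- and r + n otherwise, so its half lies in the left or right half of [0, n).
  sign-half : ∀ k → sign (residue h (+ suc (g ℕ.+ h) * + k)) ≡ sgn (floor k ℕ.+ k)
  sign-half k with parity (floor k ℕ.+ k)
  ... | c , inj₁ even = trans (cong sign (proj₂ small)) (sym (trans (cong sgn even) (sgn-2* c)))
    where
    x = + suc (g ℕ.+ h) * + k
    r = (m ℕ.* k) ℕ.% n
    lem : ∀ x n c r → + 2 * x ≡ r + n * (+ 2 * c) → + 2 * (x - c * n) ≡ r
    lem x n c r e = trans (lem₁ x n c) (trans (cong (_- + 2 * (c * n)) e) (lem₂ r n c))
      where
      lem₁ : ∀ x n c → + 2 * (x - c * n) ≡ + 2 * x - + 2 * (c * n)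
      lem₁ = solve-∀
      lem₂ : ∀ r n c → r + n * (+ 2 * c) - + 2 * (c * n) ≡ r
      lem₂ = solve-∀
    y≡ : + 2 * (x - + c * + n) ≡ + r
    y≡ = lem x (+ n) (+ c) (+ r) (trans (double k)
        (cong (λ t → + r + + n * t) (trans (cong +_ even) (ℤ.pos-* 2 c))))
    back : ∀ x t → x ≡ (x - t) + t
    back = solve-∀
    from : ∀ y → + 2 * y ≡ + r → y ≡ x - + c * + n → ∃[ z ] residue h x ≡ + z
    from (+ z) e y≡ = z , residue-unique z≤h
        (step (+ c) (trans (back x (+ c * + n)) (cong (_+ + c * + n) (sym y≡))))
      where
      z≤h : z ℕ.≤ h
      z≤h = ℕ.*-cancelˡ-≤ 2 (ℕ.≤-pred (subst (ℕ._< n) (sym (ℤ.+-injective (trans (ℤ.pos-* 2 z) e)))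
          (ℕ.m%n<n (m ℕ.* k) n)))
    small : ∃[ z ] residue h x ≡ + z
    small = from (x - + c * + n) y≡ refl
  ... | c , inj₂ isOdd = trans (cong sign (proj₂ small))
      (sym (trans (cong sgn isOdd) (cong (Sign.- Sign.*_) (sgn-2* c))))
    where
    x = + suc (g ℕ.+ h) * + k
    r = (m ℕ.* k) ℕ.% n
    lem : ∀ x n c r → + 2 * x ≡ r + n * (+ 1 + + 2 * c) → + 2 * ((c + + 1) * n - x) ≡ n - r
    lem x n c r e = trans (lem₁ x n c) (trans (cong (λ t → + 2 * ((c + + 1) * n) - t) e) (lem₂ r n c))
      where
      lem₁ : ∀ x n c → + 2 * ((c + + 1) * n - x) ≡ + 2 * ((c + + 1) * n) - + 2 * x
      lem₁ = solve-∀
      lem₂ : ∀ r n c → + 2 * ((c + + 1) * n) - (r + n * (+ 1 + + 2 * c)) ≡ n - r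
      lem₂ = solve-∀
    r<n : r ℕ.< n
    r<n = ℕ.m%n<n (m ℕ.* k) n
    y≡ : + 2 * ((+ c + + 1) * + n - x) ≡ + (n ℕ.∸ r)
    y≡ = trans (lem x (+ n) (+ c) (+ r)
        (trans (double k) (cong (λ t → + r + + n * t)
        (trans (cong +_ isOdd) (cong (λ t → + 1 + t) (ℤ.pos-* 2 c))))))
           (trans (ℤ.m-n≡m⊖n n r) (ℤ.⊖-≥ (ℕ.<⇒≤ r<n)))
    back : ∀ x t → x ≡ - (t - x) + t
    back = solve-∀
    from : ∀ y → + 2 * y ≡ + (n ℕ.∸ r) → y ≡ (+ c + + 1) * + n - x → ∃[ z ] residue h x ≡ -[1+ z ]
    from (+ zero) e _ = contradiction (ℤ.+-injective e) (ℕ.<⇒≢ (ℕ.m<n⇒0<n∸m r<n))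
    from (+ suc z) e y≡ = z , residue-unique z<h
        (step (+ c + + 1) (trans (back x ((+ c + + 1) * + n)) (cong (λ t → - t + (+ c + + 1) * + n) (sym y≡))))
      where
      2z≤ : 2 ℕ.* suc z ℕ.≤ n
      2z≤ = subst (ℕ._≤ n) (sym (ℤ.+-injective (trans (ℤ.pos-* 2 (suc z)) e))) (ℕ.m∸n≤m n r)
      z<h : suc z ℕ.≤ h
      z<h with suc z ℕ.≤? h
      ... | yes le = le
      ... | no nle = contradiction (ℕ.≤-trans (ℕ.≤-trans (ℕ.≤-reflexive (eq h)) (ℕ.*-monoʳ-≤ 2 (ℕ.≰⇒> nle))) 2z≤)
          (ℕ.<⇒≱ ℕ.≤-refl)
        where
        eq : ∀ h → suc (suc (2 ℕ.* h)) ≡ 2 ℕ.* suc h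
        eq = solveℕ
    small : ∃[ z ] residue h x ≡ -[1+ z ]
    small = from ((+ c + + 1) * + n - x) y≡ refl

  floors : ℕ
  floors = Σℕ.sum {h} (λ i → floor (suc (toℕ i)))

-- The triangular number h(h + 1)/2, that is (n² - 1)/8 for n = `odd h`.
sucs : ℕ → ℕ
sucs h = Σℕ.sum {h} (λ i → suc (toℕ i))

-- The argument is half of `odd g` + `odd h`, hence represents `odd g`/2 modulo `odd h`. Halving is
-- what turns the sign of a centred residue into a parity of floor plus index.
J-half : ∀ g h → J h (+ suc (g ℕ.+ h)) ≡ sgn (floors g h) Sign.* sgn (sucs h)
J-half g h = trans (Π.sum-cong-≗ {h} (λ i → sign-half g h (suc (toℕ i))))
             (trans (Π-sgn h _) (trans (cong sgn (Σℕ.∑-distrib-+ {h} _ _)) (sgn-+ (floors g h) (sucs h))))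

Σℕ-zero : ∀ n {f : Fin n → ℕ} → (∀ i → f i ≡ 0) → Σℕ.sum f ≡ 0
Σℕ-zero zero    z = refl
Σℕ-zero (suc n) z = cong₂ ℕ._+_ (z Fin.zero) (Σℕ-zero n (z ∘ Fin.suc))

floors-0 : ∀ h → floors 0 h ≡ 0
floors-0 h = Σℕ-zero h λ i → ℕ.m<n⇒m/n≡0
    (ℕ.≤-<-trans (ℕ.≤-reflexive (ℕ.*-identityˡ _)) (ℕ.≤-<-trans (num≤ i) (h<odd h)))

2*[1+h] : ∀ h → + 2 * + suc h ≡ + 1 + + 1 * + odd h
2*[1+h] h = trans (sym (ℤ.pos-* 2 (suc h)))
    (trans (cong +_ (lem h)) (cong (λ t → + 1 + t) (sym (ℤ.*-identityˡ (+ odd h)))))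
  where
  lem : ∀ h → 2 ℕ.* suc h ≡ 1 ℕ.+ suc (2 ℕ.* h)
  lem = solveℕ

half-of-1 : ∀ h → + 2 * + suc h ≈ + 1 [ + odd h ]
half-of-1 h = step (+ 1) (2*[1+h] h)

Unit-2 : ∀ h → Unit (+ odd h) (+ 2)
Unit-2 h = unit (+ suc h) (half-of-1 h)

Unit-half : ∀ h → Unit (+ odd h) (+ suc h)
Unit-half h = Unit-inverse (Unit-2 h)

s≡ : ∀ {s t} → s Sign.* t ≡ Sign.+ → s ≡ t
s≡ {Sign.+} {Sign.+} _ = refl
s≡ {Sign.-} {Sign.-} _ = refl

-- The case g = 0 of `J-half`: all floors vanish, and the argument h + 1 is the inverse of 2, so it
-- has the same symbol as 2.
J-2 : ∀ h → J h (+ 2) ≡ sgn (sucs h)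
J-2 h = trans (s≡ (trans (sym (J-* {h} (Unit-2 h) (Unit-half h))) (trans (J-cong {h} (half-of-1 h)) (J-1 h))))
        (trans (J-half 0 h) (cong (λ t → sgn t Sign.* sgn (sucs h)) (floors-0 h)))

-- Doubling the argument of `J-half` gives back `odd g`; the symbol of 2 cancels the triangular
-- factor and leaves Eisenstein's exponent.
J-floors : ∀ g h → Unit (+ odd h) (+ odd g) → J h (+ odd g) ≡ sgn (floors g h)
J-floors g h u = begin
  J h (+ odd g)                                                        ≡⟨ J-cong {h} (≈-sym mod) ⟩
  J h (+ 2 * + suc (g ℕ.+ h))                                          ≡⟨ J-* {h} (Unit-2 h) half ⟩
  J h (+ 2) Sign.* J h (+ suc (g ℕ.+ h))                               ≡⟨ cong₂ Sign._*_ (J-2 h) (J-half g h) ⟩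
  sgn (sucs h) Sign.* (sgn (floors g h) Sign.* sgn (sucs h))           ≡⟨ cancel (sgn (sucs h)) (sgn (floors g h)) ⟩
  sgn (floors g h)                                                     ∎
  where
  open ≡-Reasoning
  cancel : ∀ s t → s Sign.* (t Sign.* s) ≡ t
  cancel Sign.+ Sign.+ = refl
  cancel Sign.+ Sign.- = refl
  cancel Sign.- Sign.+ = refl
  cancel Sign.- Sign.- = refl
  lem : ∀ g h → 2 ℕ.* suc (g ℕ.+ h) ≡ suc (2 ℕ.* g) ℕ.+ suc (2 ℕ.* h)
  lem = solveℕ
  mod : + 2 * + suc (g ℕ.+ h) ≈ + odd g [ + odd h ]
  mod = step (+ 1) (trans (sym (ℤ.pos-* 2 (suc (g ℕ.+ h))))
      (trans (cong +_ (lem g h)) (cong (λ t → + odd g + t) (sym (ℤ.*-identityˡ (+ odd h))))))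
  half : Unit (+ odd h) (+ suc (g ℕ.+ h))
  half = Unit-cong (≈-trans (≈-*ˡ (+ suc h) (≈-sym mod))
      (≈-trans (≈-reflexive (lem₂ (+ suc h) (+ 2) (+ suc (g ℕ.+ h))))
      (≈-trans (≈-*ʳ (+ suc (g ℕ.+ h)) (half-of-1 h)) (≈-reflexive (ℤ.*-identityˡ (+ suc (g ℕ.+ h)))))))
           (Unit-* (Unit-half h) u)
    where
    lem₂ : ∀ x y z → x * (y * z) ≡ y * x * z
    lem₂ = solve-∀

𝟙 : Bool → ℕ
𝟙 b = if b then 1 else 0

count-< : ∀ g q → q ℕ.≤ g → Σℕ.sum {g} (λ j → 𝟙 (toℕ j ℕ.<ᵇ q)) ≡ q
count-< g       zero    _         = Σℕ-zero g λ _ → refl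
count-< (suc g) (suc q) (s≤s q≤g) = cong suc (count-< g q q≤g)

<ᵇ-cong : ∀ a b c d → (a ℕ.< b → c ℕ.< d) → (c ℕ.< d → a ℕ.< b) → (a ℕ.<ᵇ b) ≡ (c ℕ.<ᵇ d)
<ᵇ-cong a b c d to from with a ℕ.<ᵇ b in p | c ℕ.<ᵇ d in q
... | true  | true  = refl
... | false | false = refl
... | true  | false = ⊥-elim (subst T q (ℕ.<⇒<ᵇ (to (ℕ.<ᵇ⇒< a b (subst T (sym p) _)))))
... | false | true  = ⊥-elim (subst T p (ℕ.<⇒<ᵇ (from (ℕ.<ᵇ⇒< c d (subst T (sym q) _)))))

-- The quotient counts the lattice points below a line in one column. No multiple of n equals x, so
-- strict inequalities may be counted, and the two sides of the diagonal become symmetric.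
floor-count : ∀ g n .{{_ : NonZero n}} x → x ℕ.< n ℕ.* suc g → (∀ j → n ℕ.* suc j ≢ x) →
              x ℕ./ n ≡ Σℕ.sum {g} (λ j → 𝟙 (n ℕ.* suc (toℕ j) ℕ.<ᵇ x))
floor-count g n x x< ≢x = trans
    (sym (count-< g (x ℕ./ n) (ℕ.≤-pred (ℕ.m<n*o⇒m/o<n (subst (x ℕ.<_) (ℕ.*-comm n (suc g)) x<)))))
  (Σℕ.sum-cong-≗ {g} λ j → cong 𝟙 (<ᵇ-cong (toℕ j) (x ℕ./ n) (n ℕ.* suc (toℕ j)) x (to (toℕ j)) (from (toℕ j))))
  where
  to : ∀ j → j ℕ.< x ℕ./ n → n ℕ.* suc j ℕ.< x
  to j j< = ℕ.≤∧≢⇒< (ℕ.≤-trans (ℕ.≤-trans (ℕ.*-monoʳ-≤ n j<) (ℕ.≤-reflexive (ℕ.*-comm n (x ℕ./ n))))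
      (ℕ.m/n*n≤m x n)) (≢x j)
  from : ∀ j → n ℕ.* suc j ℕ.< x → j ℕ.< x ℕ./ n
  from j lt = ℕ.≤-trans (ℕ.≤-reflexive (sym (trans (cong (ℕ._/ n) (ℕ.*-comm n (suc j))) (ℕ.m*n/n≡m (suc j) n))))
      (ℕ./-monoˡ-≤ n (ℕ.<⇒≤ lt))

-- No lattice point lies on the diagonal: cancelling the unit a, the modulus would divide a number
-- between 1 and h.
multiple≢ : ∀ {h a} → Unit (+ odd h) (+ a) → ∀ (i : Fin h) j → odd h ℕ.* suc j ≢ a ℕ.* suc (toℕ i)
multiple≢ {h} {a} u i j eq with ≈0⇒≡0 (ℕ.≤-<-trans (num≤ i) (h<odd h)) (Unit-cancelˡ (+ a) u (step (+ suc j) cast))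
  where
  cast : + a * num i ≡ + a * + 0 + + suc j * + odd h
  cast = trans (sym (ℤ.pos-* a (suc (toℕ i)))) (trans (cong +_ (trans (sym eq) (ℕ.*-comm (odd h) (suc j))))
      (trans (ℤ.pos-* (suc j) (odd h))
      (trans (sym (ℤ.+-identityˡ _)) (cong (_+ + suc j * + odd h) (sym (ℤ.*-zeroʳ (+ a)))))))
... | ()

floors-count : ∀ g h → Unit (+ odd h) (+ odd g) →
               floors g h ≡ Σℕ.sum {h} (λ i → Σℕ.sum {g} (λ j →
                   𝟙 (odd h ℕ.* suc (toℕ j) ℕ.<ᵇ odd g ℕ.* suc (toℕ i))))
floors-count g h u = Σℕ.sum-cong-≗ {h} λ i → floor-count g (odd h) (odd g ℕ.* suc (toℕ i)) (bound i) (multiple≢ u i)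
  where
  bound : ∀ i → odd g ℕ.* suc (toℕ i) ℕ.< odd h ℕ.* suc g
  bound i = ℕ.≤-<-trans (ℕ.*-monoʳ-≤ (odd g) (num≤ i)) (ℕ.≤-trans (ℕ.m≤m+n _ (g ℕ.+ h)) (ℕ.≤-reflexive (lem g h)))
    where
    lem : ∀ g h → suc (suc (2 ℕ.* g) ℕ.* h) ℕ.+ (g ℕ.+ h) ≡ suc (2 ℕ.* h) ℕ.* suc g
    lem = solveℕ

𝟙-<> : ∀ a b → a ≢ b → 𝟙 (a ℕ.<ᵇ b) ℕ.+ 𝟙 (b ℕ.<ᵇ a) ≡ 1
𝟙-<> zero    zero    a≢b = contradiction refl a≢b
𝟙-<> zero    (suc b) _   = refl
𝟙-<> (suc a) zero    _   = refl
𝟙-<> (suc a) (suc b) a≢b = 𝟙-<> a b (a≢b ∘ cong suc)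

Σℕ-const : ∀ n {f : Fin n → ℕ} c → (∀ i → f i ≡ c) → Σℕ.sum f ≡ n ℕ.* c
Σℕ-const zero    c e = refl
Σℕ-const (suc n) c e = cong₂ ℕ._+_ (e Fin.zero) (Σℕ-const n c (e ∘ Fin.suc))

Unit-swap : ∀ {m n} → Unit m n → Unit n m
Unit-swap {m} {n} (unit b (step k e)) = unit (- k) (step (- b) (lem m n b k e))
  where
  lem : ∀ m n b k → n * b ≡ + 1 + k * m → m * - k ≡ + 1 + - b * n
  lem m n b k e = trans (lem₁ m k) (trans (cong (λ t → + 1 - t) (sym e)) (lem₂ n b))
    where
    lem₁ : ∀ m k → m * - k ≡ + 1 - (+ 1 + k * m)
    lem₁ = solve-∀
    lem₂ : ∀ n b → + 1 - n * b ≡ + 1 + - b * n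
    lem₂ = solve-∀

-- Each point of the h × g rectangle lies strictly on exactly one side of the diagonal.
floors-floors : ∀ g h → Unit (+ odd h) (+ odd g) → floors g h ℕ.+ floors h g ≡ h ℕ.* g
floors-floors g h u = begin
  floors g h ℕ.+ floors h g                                          ≡⟨
      cong₂ ℕ._+_ (floors-count g h u) (trans (floors-count h g (Unit-swap u)) (Σℕ.∑-comm {g} {h} _)) ⟩
  Σℕ.sum {h} (λ i → Σℕ.sum {g} (below i)) ℕ.+ Σℕ.sum {h} (λ i → Σℕ.sum {g} (above i)) ≡⟨
      sym (Σℕ.∑-distrib-+ {h} _ _) ⟩
  Σℕ.sum {h} (λ i → Σℕ.sum {g} (below i) ℕ.+ Σℕ.sum {g} (above i))    ≡⟨ Σℕ-const h g row ⟩
  h ℕ.* g                                                            ∎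
  where
  open ≡-Reasoning
  below above : Fin h → Fin g → ℕ
  below i j = 𝟙 (odd h ℕ.* suc (toℕ j) ℕ.<ᵇ odd g ℕ.* suc (toℕ i))
  above i j = 𝟙 (odd g ℕ.* suc (toℕ i) ℕ.<ᵇ odd h ℕ.* suc (toℕ j))
  row : ∀ i → Σℕ.sum {g} (below i) ℕ.+ Σℕ.sum {g} (above i) ≡ g
  row i = trans (sym (Σℕ.∑-distrib-+ {g} _ _)) (trans (Σℕ-const g 1 (λ j → 𝟙-<> _ _ (multiple≢ u i (toℕ j))))
      (ℕ.*-identityʳ g))

reciprocity : ∀ g h → Unit (+ odd h) (+ odd g) → J h (+ odd g) ≡ J g (+ odd h) Sign.* sgn (h ℕ.* g)
reciprocity g h u = sym (begin
  J g (+ odd h) Sign.* sgn (h ℕ.* g)                        ≡⟨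
      cong₂ Sign._*_ (J-floors h g (Unit-swap u)) (cong sgn (sym (floors-floors g h u))) ⟩
  sgn (floors h g) Sign.* sgn (floors g h ℕ.+ floors h g)   ≡⟨
      cong (sgn (floors h g) Sign.*_) (sgn-+ (floors g h) (floors h g)) ⟩
  sgn (floors h g) Sign.* (sgn (floors g h) Sign.* sgn (floors h g)) ≡⟨ cancel (sgn (floors h g)) _ ⟩
  sgn (floors g h)                                          ≡⟨ sym (J-floors g h u) ⟩
  J h (+ odd g)                                             ∎)
  where
  open ≡-Reasoning
  cancel : ∀ s t → s Sign.* (t Sign.* s) ≡ t
  cancel Sign.+ Sign.+ = refl
  cancel Sign.+ Sign.- = refl
  cancel Sign.- Sign.+ = refl
  cancel Sign.- Sign.- = refl

J-neg1 : ∀ h → J h (- + 1) ≡ sgn h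
J-neg1 h = trans (Π.sum-cong-≗ {h} (λ i →
    cong sign (residue-unique (subst (ℕ._≤ h) (sym (∣σ*∣ Sign.- (num i))) (num≤ i)) ≈-refl))) (all-minus h)
  where
  all-minus : ∀ n → Π.sum {n} (λ i → sign (- + 1 * num i)) ≡ sgn n
  all-minus zero    = refl
  all-minus (suc n) = cong (Sign.- Sign.*_) (trans (Π.sum-cong-≗ {n} (λ _ → refl)) (all-minus n))

infixl 7 _⊙_

-- Multiplication of odd numbers transported to their halves.
_⊙_ : ℕ → ℕ → ℕ
h ⊙ g = 2 ℕ.* (h ℕ.* g) ℕ.+ (h ℕ.+ g)

odd-⊙ : ∀ h g → odd (h ⊙ g) ≡ odd h ℕ.* odd g
odd-⊙ = lem
  where
  lem : ∀ h g → suc (2 ℕ.* (2 ℕ.* (h ℕ.* g) ℕ.+ (h ℕ.+ g))) ≡ suc (2 ℕ.* h) ℕ.* suc (2 ℕ.* g)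
  lem = solveℕ

+odd-⊙ : ∀ h g → + odd (h ⊙ g) ≡ + odd h * + odd g
+odd-⊙ h g = trans (cong +_ (odd-⊙ h g)) (ℤ.pos-* (odd h) (odd g))

Σℕ-last : ∀ n (f : ℕ → ℕ) → Σℕ.sum {suc n} (f ∘ toℕ) ≡ Σℕ.sum {n} (f ∘ toℕ) ℕ.+ f n
Σℕ-last zero    f = ℕ.+-identityʳ (f 0)
Σℕ-last (suc n) f = trans (cong (f 0 ℕ.+_) (Σℕ-last n (f ∘ suc))) (sym (ℕ.+-assoc (f 0) _ (f (suc n))))

odd² : ∀ h → odd h ℕ.* odd h ≡ 1 ℕ.+ 8 ℕ.* sucs h
odd² zero    = refl
odd² (suc h) = trans (lem₁ h) (trans (cong (ℕ._+ 8 ℕ.* suc h) (odd² h))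
    (trans (lem₂ (sucs h) h) (cong (λ t → 1 ℕ.+ 8 ℕ.* t) (sym (Σℕ-last h suc)))))
  where
  lem₁ : ∀ h → suc (2 ℕ.* suc h) ℕ.* suc (2 ℕ.* suc h) ≡ suc (2 ℕ.* h) ℕ.* suc (2 ℕ.* h) ℕ.+ 8 ℕ.* suc h
  lem₁ = solveℕ
  lem₂ : ∀ s h → 1 ℕ.+ 8 ℕ.* s ℕ.+ 8 ℕ.* suc h ≡ 1 ℕ.+ 8 ℕ.* (s ℕ.+ suc h)
  lem₂ = solveℕ

sucs-unique : ∀ h s → odd h ℕ.* odd h ≡ 1 ℕ.+ 8 ℕ.* s → sucs h ≡ s
sucs-unique h s e = ℕ.*-cancelˡ-≡ (sucs h) s 8 (ℕ.suc-injective (trans (sym (odd² h)) e))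

-- Writing odd squares as 1 + 8a and 1 + 8b, their product is 1 + 8(a + b) modulo 16.
sgn-sucs-⊙ : ∀ h g → sgn (sucs (h ⊙ g)) ≡ sgn (sucs h) Sign.* sgn (sucs g)
sgn-sucs-⊙ h g = trans (cong sgn (sucs-unique (h ⊙ g) (a ℕ.+ b ℕ.+ 2 ℕ.* (4 ℕ.* (a ℕ.* b))) square))
    (trans (sgn-+2* (a ℕ.+ b) (4 ℕ.* (a ℕ.* b))) (sgn-+ a b))
  where
  a = sucs h
  b = sucs g
  swap : ∀ x y → (x ℕ.* y) ℕ.* (x ℕ.* y) ≡ (x ℕ.* x) ℕ.* (y ℕ.* y)
  swap = solveℕ
  lem : ∀ a b → (1 ℕ.+ 8 ℕ.* a) ℕ.* (1 ℕ.+ 8 ℕ.* b) ≡ 1 ℕ.+ 8 ℕ.* (a ℕ.+ b ℕ.+ 2 ℕ.* (4 ℕ.* (a ℕ.* b)))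
  lem = solveℕ
  square : odd (h ⊙ g) ℕ.* odd (h ⊙ g) ≡ 1 ℕ.+ 8 ℕ.* (a ℕ.+ b ℕ.+ 2 ℕ.* (4 ℕ.* (a ℕ.* b)))
  square = trans (cong₂ ℕ._*_ (odd-⊙ h g) (odd-⊙ h g))
      (trans (swap (odd h) (odd g)) (trans (cong₂ ℕ._*_ (odd² h) (odd² g)) (lem a b)))

-- Adding 8j to an odd number n changes n² by 16(nj + 4j²), hence (n² - 1)/8 by an even number.
sgn-sucs-periodic : ∀ h j → sgn (sucs (h ℕ.+ 4 ℕ.* j)) ≡ sgn (sucs h)
sgn-sucs-periodic h j = trans (cong sgn (sucs-unique (h ℕ.+ 4 ℕ.* j) (a ℕ.+ 2 ℕ.* (odd h ℕ.* j ℕ.+ 4 ℕ.* (j ℕ.* j)))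
    square)) (sgn-+2* a (odd h ℕ.* j ℕ.+ 4 ℕ.* (j ℕ.* j)))
  where
  a = sucs h
  lem₁ : ∀ h j → suc (2 ℕ.* (h ℕ.+ 4 ℕ.* j)) ℕ.* suc (2 ℕ.* (h ℕ.+ 4 ℕ.* j)) ≡
      suc (2 ℕ.* h) ℕ.* suc (2 ℕ.* h) ℕ.+ (16 ℕ.* (suc (2 ℕ.* h) ℕ.* j) ℕ.+ 64 ℕ.* (j ℕ.* j))
  lem₁ = solveℕ
  lem₂ : ∀ a n j → 1 ℕ.+ 8 ℕ.* a ℕ.+ (16 ℕ.* (n ℕ.* j) ℕ.+ 64 ℕ.* (j ℕ.* j)) ≡
      1 ℕ.+ 8 ℕ.* (a ℕ.+ 2 ℕ.* (n ℕ.* j ℕ.+ 4 ℕ.* (j ℕ.* j)))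
  lem₂ = solveℕ
  square : odd (h ℕ.+ 4 ℕ.* j) ℕ.* odd (h ℕ.+ 4 ℕ.* j) ≡ 1 ℕ.+ 8 ℕ.* (a ℕ.+ 2 ℕ.* (odd h ℕ.* j ℕ.+ 4 ℕ.* (j ℕ.* j)))
  square = trans (lem₁ h j) (trans (cong (ℕ._+ (16 ℕ.* (odd h ℕ.* j) ℕ.+ 64 ℕ.* (j ℕ.* j))) (odd² h))
      (lem₂ a (odd h) j))

-- Here the numerator D is fixed and the denominator `odd h` varies, which is the direction that
-- needs reciprocity. Shifting h by 4∣D∣ shifts `odd h` by 8∣D∣, a period that also serves for -1
-- and 2.
record Character (D : ℤ) : Set where
  field
    multiplicative : ∀ h g → Unit D (+ odd h) → Unit D (+ odd g) → J (h ⊙ g) D ≡ J h D Sign.* J g D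
    periodic       : ∀ h j → Unit D (+ odd h) → J (h ℕ.+ 4 ℕ.* (∣ D ∣ ℕ.* j)) D ≡ J h D
open Character

character-neg1 : Character (- + 1)
character-neg1 .multiplicative h g _ _ =
    trans (J-neg1 (h ⊙ g)) (trans (trans (cong sgn (ℕ.+-comm (2 ℕ.* (h ℕ.* g)) (h ℕ.+ g)))
    (sgn-+2* (h ℕ.+ g) (h ℕ.* g)))
  (trans (sgn-+ h g) (sym (cong₂ Sign._*_ (J-neg1 h) (J-neg1 g)))))
character-neg1 .periodic h j _ =
    trans (J-neg1 (h ℕ.+ 4 ℕ.* (1 ℕ.* j))) (trans (trans (cong (λ t → sgn (h ℕ.+ t)) (lem j)) (sgn-+2* h (2 ℕ.* j)))
    (sym (J-neg1 h)))
  where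
  lem : ∀ j → 4 ℕ.* (1 ℕ.* j) ≡ 2 ℕ.* (2 ℕ.* j)
  lem = solveℕ

character-2 : Character (+ 2)
character-2 .multiplicative h g _ _ =
    trans (J-2 (h ⊙ g)) (trans (sgn-sucs-⊙ h g) (sym (cong₂ Sign._*_ (J-2 h) (J-2 g))))
character-2 .periodic h j _ = trans (J-2 (h ℕ.+ 4 ℕ.* (2 ℕ.* j)))
    (trans (sgn-sucs-periodic h (2 ℕ.* j)) (sym (J-2 h)))

interchange : ∀ a b c d → (a Sign.* b) Sign.* (c Sign.* d) ≡ (a Sign.* c) Sign.* (b Sign.* d)
interchange Sign.+ b c d = trans (sym (Sign.*-assoc b c d))
    (trans (cong (Sign._* d) (Sign.*-comm b c)) (Sign.*-assoc c b d))
interchange Sign.- b c d = trans (sym (Sign.*-assoc (Sign.- Sign.* b) c d))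
    (trans (cong (Sign._* d) (trans (Sign.*-assoc Sign.- b c)
    (trans (cong (Sign.- Sign.*_) (Sign.*-comm b c)) (sym (Sign.*-assoc Sign.- c b)))))
    (Sign.*-assoc (Sign.- Sign.* c) b d))

-- Reciprocity moves the varying number into the numerator, where both properties are immediate. The
-- exponents hd are additive under `⊙` modulo 2 and unchanged modulo 2 by the shift.
character-odd : ∀ d → Character (+ odd d)
character-odd d .multiplicative h g u v = begin
  J (h ⊙ g) (+ odd d)                                                                ≡⟨
      reciprocity d (h ⊙ g) (Unit-swap uv) ⟩
  J d (+ odd (h ⊙ g)) Sign.* sgn ((h ⊙ g) ℕ.* d)                                      ≡⟨
      cong₂ Sign._*_ (trans (cong (J d) (+odd-⊙ h g)) (J-* {d} u v)) signs ⟩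
  (J d (+ odd h) Sign.* J d (+ odd g)) Sign.* (sgn (h ℕ.* d) Sign.* sgn (g ℕ.* d))    ≡⟨
      interchange (J d (+ odd h)) _ _ _ ⟩
  (J d (+ odd h) Sign.* sgn (h ℕ.* d)) Sign.* (J d (+ odd g) Sign.* sgn (g ℕ.* d))    ≡⟨
      sym (cong₂ Sign._*_ (reciprocity d h (Unit-swap u)) (reciprocity d g (Unit-swap v))) ⟩
  J h (+ odd d) Sign.* J g (+ odd d)                                                 ∎
  where
  open ≡-Reasoning
  uv : Unit (+ odd d) (+ odd (h ⊙ g))
  uv = subst (Unit (+ odd d)) (sym (+odd-⊙ h g)) (Unit-* u v)
  lem : ∀ h g d → (2 ℕ.* (h ℕ.* g) ℕ.+ (h ℕ.+ g)) ℕ.* d ≡ h ℕ.* d ℕ.+ g ℕ.* d ℕ.+ 2 ℕ.* (h ℕ.* g ℕ.* d)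
  lem = solveℕ
  signs : sgn ((h ⊙ g) ℕ.* d) ≡ sgn (h ℕ.* d) Sign.* sgn (g ℕ.* d)
  signs = trans (cong sgn (lem h g d))
      (trans (sgn-+2* (h ℕ.* d ℕ.+ g ℕ.* d) (h ℕ.* g ℕ.* d)) (sgn-+ (h ℕ.* d) (g ℕ.* d)))
character-odd d .periodic h j u = begin
  J h′ (+ odd d)                              ≡⟨ reciprocity d h′ (Unit-swap (Unit-cong (≈-sym h′≈h) u)) ⟩
  J d (+ odd h′) Sign.* sgn (h′ ℕ.* d)        ≡⟨
      cong₂ Sign._*_ (J-cong {d} h′≈h)
      (trans (cong sgn (lem h (odd d ℕ.* j) d)) (sgn-+2* (h ℕ.* d) (2 ℕ.* ((odd d ℕ.* j) ℕ.* d)))) ⟩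
  J d (+ odd h) Sign.* sgn (h ℕ.* d)          ≡⟨ sym (reciprocity d h (Unit-swap u)) ⟩
  J h (+ odd d)                               ∎
  where
  open ≡-Reasoning
  h′ = h ℕ.+ 4 ℕ.* (odd d ℕ.* j)
  lem : ∀ h m d → (h ℕ.+ 4 ℕ.* m) ℕ.* d ≡ h ℕ.* d ℕ.+ 2 ℕ.* (2 ℕ.* (m ℕ.* d))
  lem = solveℕ
  lem₂ : ∀ h n j → suc (2 ℕ.* (h ℕ.+ 4 ℕ.* (n ℕ.* j))) ≡ suc (2 ℕ.* h) ℕ.+ (8 ℕ.* j) ℕ.* n
  lem₂ = solveℕ
  h′≈h : + odd h′ ≈ + odd h [ + odd d ]
  h′≈h = step (+ (8 ℕ.* j)) (trans (cong +_ (lem₂ h (odd d) j))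
      (cong (λ t → + odd h + t) (ℤ.pos-* (8 ℕ.* j) (odd d))))

Unit-factorˡ : ∀ {a b x} → Unit (a * b) x → Unit a x
Unit-factorˡ {a} {b} (unit y (step k e)) = unit y (step (k * b) (trans e (cong (λ t → + 1 + t) (lem k a b))))
  where
  lem : ∀ k a b → k * (a * b) ≡ k * b * a
  lem = solve-∀

Unit-factorʳ : ∀ {a b x} → Unit (a * b) x → Unit b x
Unit-factorʳ {a} {b} {x} u = Unit-factorˡ (subst (λ m → Unit m x) (ℤ.*-comm a b) u)

character-* : ∀ {a b} → Character a → Character b → Character (a * b)
character-* {a} {b} A B .multiplicative h g u v = begin
  J (h ⊙ g) (a * b)                                                    ≡⟨
      J-* {h ⊙ g} (Unit-swap (Unit-factorˡ {a} {b} uv)) (Unit-swap (Unit-factorʳ {a} {b} uv)) ⟩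
  J (h ⊙ g) a Sign.* J (h ⊙ g) b                                       ≡⟨
      cong₂ Sign._*_ (multiplicative A h g (Unit-factorˡ {a} {b} u) (Unit-factorˡ {a} {b} v))
      (multiplicative B h g (Unit-factorʳ {a} {b} u) (Unit-factorʳ {a} {b} v)) ⟩
  (J h a Sign.* J g a) Sign.* (J h b Sign.* J g b)                     ≡⟨ interchange (J h a) _ _ _ ⟩
  (J h a Sign.* J h b) Sign.* (J g a Sign.* J g b)                     ≡⟨
      sym (cong₂ Sign._*_ (J-* {h} (Unit-swap (Unit-factorˡ {a} {b} u)) (Unit-swap (Unit-factorʳ {a} {b} u)))
      (J-* {g} (Unit-swap (Unit-factorˡ {a} {b} v)) (Unit-swap (Unit-factorʳ {a} {b} v)))) ⟩
  J h (a * b) Sign.* J g (a * b)                                       ∎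
  where
  open ≡-Reasoning
  uv : Unit (a * b) (+ odd (h ⊙ g))
  uv = subst (Unit (a * b)) (sym (+odd-⊙ h g)) (Unit-* u v)
character-* {a} {b} A B .periodic h j u = begin
  J h′ (a * b)             ≡⟨ J-* {h′} (Unit-swap (Unit-factorˡ {a} {b} u′)) (Unit-swap (Unit-factorʳ {a} {b} u′)) ⟩
  J h′ a Sign.* J h′ b     ≡⟨ cong₂ Sign._*_
      (trans (cong (λ t → J t a) h′ˡ) (periodic A h (∣ b ∣ ℕ.* j) (Unit-factorˡ {a} {b} u)))
      (trans (cong (λ t → J t b) h′ʳ) (periodic B h (∣ a ∣ ℕ.* j) (Unit-factorʳ {a} {b} u))) ⟩
  J h a Sign.* J h b       ≡⟨ sym (J-* {h} (Unit-swap (Unit-factorˡ {a} {b} u))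
      (Unit-swap (Unit-factorʳ {a} {b} u))) ⟩
  J h (a * b)              ∎
  where
  open ≡-Reasoning
  h′ = h ℕ.+ 4 ℕ.* (∣ a * b ∣ ℕ.* j)
  h′ˡ : h′ ≡ h ℕ.+ 4 ℕ.* (∣ a ∣ ℕ.* (∣ b ∣ ℕ.* j))
  h′ˡ = cong (λ t → h ℕ.+ 4 ℕ.* t) (trans (cong (ℕ._* j) (ℤ.abs-* a b)) (ℕ.*-assoc ∣ a ∣ ∣ b ∣ j))
  h′ʳ : h′ ≡ h ℕ.+ 4 ℕ.* (∣ b ∣ ℕ.* (∣ a ∣ ℕ.* j))
  h′ʳ = trans h′ˡ (cong (λ t → h ℕ.+ 4 ℕ.* t) (lem ∣ a ∣ ∣ b ∣ j))
    where
    lem : ∀ a b j → a ℕ.* (b ℕ.* j) ≡ b ℕ.* (a ℕ.* j)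
    lem = solveℕ
  multiple : ∀ s → ∃[ k ] + ∣ s ∣ ≡ k * s
  multiple (+ n)    = + 1 , sym (ℤ.*-identityˡ (+ n))
  multiple -[1+ n ] = - + 1 , sym (ℤ.-1*i≡-i -[1+ n ])
  u′ : Unit (a * b) (+ odd h′)
  u′ = Unit-cong (≈-sym (step (+ (8 ℕ.* j) * proj₁ (multiple (a * b))) eq)) u
    where
    lem : ∀ h c j → suc (2 ℕ.* (h ℕ.+ 4 ℕ.* (c ℕ.* j))) ≡ suc (2 ℕ.* h) ℕ.+ (8 ℕ.* j) ℕ.* c
    lem = solveℕ
    eq : + odd h′ ≡ + odd h + + (8 ℕ.* j) * proj₁ (multiple (a * b)) * (a * b)
    eq = trans (cong +_ (lem h ∣ a * b ∣ j)) (cong (λ t → + odd h + t) (trans (ℤ.pos-* (8 ℕ.* j) ∣ a * b ∣)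
           (trans (cong (+ (8 ℕ.* j) *_) (proj₂ (multiple (a * b))))
               (sym (ℤ.*-assoc (+ (8 ℕ.* j)) (proj₁ (multiple (a * b))) (a * b))))))

character-pos : ∀ n → 0 ℕ.< n → Character (+ n)
character-pos n = go n (<-wellFounded n)
  where
  go : ∀ n → Acc ℕ._<_ n → 0 ℕ.< n → Character (+ n)
  go n (acc rec) 0<n with parity n
  ... | d , inj₂ refl = character-odd d
  go n (acc rec) () | zero , inj₁ refl
  go n (acc rec) _ | suc c , inj₁ refl =
      subst Character (sym (ℤ.pos-* 2 (suc c)))
      (character-* character-2 (go (suc c) (rec (ℕ.m<m+n (suc c) (s≤s z≤n))) (s≤s z≤n)))

character : ∀ n → 0 ℕ.< n → Character (- + n)
character n 0<n = subst Character (ℤ.-1*i≡-i (+ n)) (character-* character-neg1 (character-pos n 0<n))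

-- Character sums over divisors and the hyperbola method

⟦_⟧ : {P : Set} → Dec P → ℤ
⟦ yes _ ⟧ = + 1
⟦ no _  ⟧ = + 0

⟦⟧-yes : {P : Set} (d : Dec P) → P → ⟦ d ⟧ ≡ + 1
⟦⟧-yes (yes _) p = refl
⟦⟧-yes (no ¬p) p = contradiction p ¬p

⟦⟧-no : {P : Set} (d : Dec P) → ¬ P → ⟦ d ⟧ ≡ + 0
⟦⟧-no (yes p) ¬p = contradiction p ¬p
⟦⟧-no (no _)  ¬p = refl

⟦⟧-cong : {P Q : Set} (d : Dec P) (e : Dec Q) → (P → Q) → (Q → P) → ⟦ d ⟧ ≡ ⟦ e ⟧
⟦⟧-cong (yes p) e f g = sym (⟦⟧-yes e (f p))
⟦⟧-cong (no ¬p) e f g = sym (⟦⟧-no e (¬p ∘ g))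

⟦⟧-*-cong : {P : Set} (d : Dec P) {x y : ℤ} → (P → x ≡ y) → ⟦ d ⟧ * x ≡ ⟦ d ⟧ * y
⟦⟧-*-cong (yes p) f = cong (+ 1 *_) (f p)
⟦⟧-*-cong (no _)  f = refl

-- The range is 1, ..., n, so the index 0 never appears as a divisor or cofactor.
∑ : ℕ → (ℕ → ℤ) → ℤ
∑ zero    f = + 0
∑ (suc n) f = ∑ n f + f (suc n)

∑-cong : ∀ n {f g} → (∀ i → 1 ℕ.≤ i → i ℕ.≤ n → f i ≡ g i) → ∑ n f ≡ ∑ n g
∑-cong zero    e = refl
∑-cong (suc n) e = cong₂ _+_ (∑-cong n λ i 1≤ i≤ → e i 1≤ (ℕ.m≤n⇒m≤1+n i≤)) (e (suc n) (s≤s z≤n) ℕ.≤-refl)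

∑-ext : ∀ n {f g} → (∀ i → f i ≡ g i) → ∑ n f ≡ ∑ n g
∑-ext n e = ∑-cong n λ i _ _ → e i

∑-zero : ∀ n {f} → (∀ i → 1 ℕ.≤ i → i ℕ.≤ n → f i ≡ + 0) → ∑ n f ≡ + 0
∑-zero zero    e = refl
∑-zero (suc n) e = cong₂ _+_ (∑-zero n λ i 1≤ i≤ → e i 1≤ (ℕ.m≤n⇒m≤1+n i≤)) (e (suc n) (s≤s z≤n) ℕ.≤-refl)

∑-+ : ∀ n f g → ∑ n (λ i → f i + g i) ≡ ∑ n f + ∑ n g
∑-+ zero    f g = refl
∑-+ (suc n) f g = trans (cong (_+ (f (suc n) + g (suc n))) (∑-+ n f g))
    (lem (∑ n f) (∑ n g) (f (suc n)) (g (suc n)))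
  where
  lem : ∀ a b c d → a + b + (c + d) ≡ a + c + (b + d)
  lem = solve-∀

∑-*ˡ : ∀ n c f → ∑ n (λ i → c * f i) ≡ c * ∑ n f
∑-*ˡ zero    c f = sym (ℤ.*-zeroʳ c)
∑-*ˡ (suc n) c f = trans (cong (_+ c * f (suc n)) (∑-*ˡ n c f)) (sym (ℤ.*-distribˡ-+ c (∑ n f) (f (suc n))))

∑-swap : ∀ m n (f : ℕ → ℕ → ℤ) → ∑ m (λ i → ∑ n (f i)) ≡ ∑ n (λ j → ∑ m (λ i → f i j))
∑-swap zero    n f = sym (∑-zero n λ _ _ _ → refl)
∑-swap (suc m) n f = trans (cong (_+ ∑ n (f (suc m))) (∑-swap m n f))
    (sym (∑-+ n (λ j → ∑ m (λ i → f i j)) (f (suc m))))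

∑-++ : ∀ m n f → ∑ (m ℕ.+ n) f ≡ ∑ m f + ∑ n (λ i → f (m ℕ.+ i))
∑-++ m zero    f = trans (cong (λ t → ∑ t f) (ℕ.+-identityʳ m)) (sym (ℤ.+-identityʳ (∑ m f)))
∑-++ m (suc n) f = trans (cong (λ t → ∑ t f) (ℕ.+-suc m n))
    (trans (cong₂ _+_ (∑-++ m n f) (cong f (sym (ℕ.+-suc m n)))) (ℤ.+-assoc (∑ m f) _ _))

∑-truncate : ∀ {m n} f → m ℕ.≤ n → (∀ i → m ℕ.< i → f i ≡ + 0) → ∑ n f ≡ ∑ m f
∑-truncate {m} {n} f m≤n e = trans (cong (λ t → ∑ t f) (sym (ℕ.m+[n∸m]≡n m≤n)))
  (trans (∑-++ m (n ℕ.∸ m) f) (trans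
      (cong (λ t → ∑ m f + t) (∑-zero (n ℕ.∸ m) λ i 1≤i _ → e (m ℕ.+ i) (ℕ.m<m+n m 1≤i))) (ℤ.+-identityʳ (∑ m f))))

∑-≤ : ∀ n {f g} → (∀ i → 1 ℕ.≤ i → i ℕ.≤ n → f i ≤ g i) → ∑ n f ≤ ∑ n g
∑-≤ zero    e = ℤ.≤-refl
∑-≤ (suc n) e = ℤ.+-mono-≤ (∑-≤ n λ i 1≤ i≤ → e i 1≤ (ℕ.m≤n⇒m≤1+n i≤)) (e (suc n) (s≤s z≤n) ℕ.≤-refl)

∑-const : ∀ n c → ∑ n (λ _ → c) ≡ + n * c
∑-const zero    c = refl
∑-const (suc n) c = trans (cong (_+ c) (∑-const n c)) (lem (+ n) c)
  where
  lem : ∀ n c → n * c + c ≡ (+ 1 + n) * c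
  lem = solve-∀

∑-δ : ∀ n m (f : ℕ → ℤ) → 1 ℕ.≤ m → ∑ n (λ i → ⟦ m ℕ.≟ i ⟧ * f i) ≡ ⟦ m ℕ.≤? n ⟧ * f m
∑-δ zero    (suc m) f _ = refl
∑-δ (suc n) m f 1≤m = trans (cong (_+ ⟦ m ℕ.≟ suc n ⟧ * f (suc n)) (∑-δ n m f 1≤m)) (last (m ℕ.≟ suc n))
  where
  last : (d : Dec (m ≡ suc n)) → ⟦ m ℕ.≤? n ⟧ * f m + ⟦ d ⟧ * f (suc n) ≡ ⟦ m ℕ.≤? suc n ⟧ * f m
  last (yes refl) = trans (cong₂ (λ s t → s * f m + t) (⟦⟧-no (suc n ℕ.≤? n) ℕ.1+n≰n) refl)
                    (trans (lem (f (suc n))) (cong (_* f m) (sym (⟦⟧-yes (suc n ℕ.≤? suc n) ℕ.≤-refl))))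
    where
    lem : ∀ x → + 0 * x + + 1 * x ≡ + 1 * x
    lem = solve-∀
  last (no ≢) = trans (lem (⟦ m ℕ.≤? n ⟧ * f m) (f (suc n)))
      (cong (_* f m) (⟦⟧-cong (m ℕ.≤? n) (m ℕ.≤? suc n) ℕ.m≤n⇒m≤1+n (λ m≤ → ℕ.≤-pred (ℕ.≤∧≢⇒< m≤ ≢))))
    where
    lem : ∀ x y → x + + 0 * y ≡ x
    lem = solve-∀

∑-positive : ∀ n f → + 0 < ∑ n f → ∃[ i ] 1 ℕ.≤ i × i ℕ.≤ n × + 0 < f i
∑-positive zero    f (+<+ ())
∑-positive (suc n) f 0< with + 0 ℤ.<? f (suc n)
... | yes p = suc n , s≤s z≤n , ℕ.≤-refl , p
... | no ¬p with ∑-positive n f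
    (ℤ.<-≤-trans 0< (ℤ.≤-trans (ℤ.+-monoʳ-≤ (∑ n f) (ℤ.≮⇒≥ ¬p)) (ℤ.≤-reflexive (ℤ.+-identityʳ (∑ n f)))))
... | i , 1≤ , i≤ , q = i , 1≤ , ℕ.m≤n⇒m≤1+n i≤ , q

module Hyperbola
  (q : ℕ) .{{_ : NonZero q}} (χ : ℕ → ℤ)
  (χ-cases : ∀ n → χ n ≡ + 0 ⊎ Unit (+ q) (+ n) × (χ n ≡ + 1 ⊎ χ n ≡ - + 1))
  (χ-*     : ∀ m n → χ (m ℕ.* n) ≡ χ m * χ n)
  (χ-mod   : ∀ m n → m ℕ.% q ≡ n ℕ.% q → χ m ≡ χ n)
  where

  -- Divisor and cofactor run over the same range, independent of n. This makes the sum symmetric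
  -- for the hyperbola argument and lets it be interchanged with the sum over n.
  divisorSum : ℕ → ℕ → ℤ
  divisorSum X n = ∑ X λ d → ∑ X λ e → ⟦ d ℕ.* e ℕ.≟ n ⟧ * χ d

  class : ℕ → ℕ → ℤ
  class a n = ⟦ n ℕ.% q ℕ.≟ a ℕ.% q ⟧

  classSum : ℕ → ℕ → ℤ
  classSum X a = ∑ X λ n → class a n * divisorSum X n

  solutions : ℕ → ℕ → ℕ → ℤ
  solutions a d Z = ∑ Z λ e → class a (d ℕ.* e)

  %⇒≈ : ∀ m n → m ℕ.% q ≡ n ℕ.% q → + m ≈ + n [ + q ]
  %⇒≈ m n e = ≈-trans (self m) (≈-trans (≈-reflexive (cong +_ e)) (≈-sym (self n)))
    where
    self : ∀ m → + m ≈ + (m ℕ.% q) [ + q ]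
    self m = step (+ (m ℕ./ q)) (trans (cong +_ (ℕ.m≡m%n+[m/n]*n m q))
        (cong (λ t → + (m ℕ.% q) + t) (ℤ.pos-* (m ℕ./ q) q)))

  ≈⇒≡ : ∀ {m n} → m ℕ.< q → n ℕ.< q → + m ≈ + n [ + q ] → m ≡ n
  ≈⇒≡ {m} {n} m<q n<q (step k e) =
      ℤ.+-injective (ℤ.i-j≡0⇒i≡j (+ m) (+ n) (≈0⇒≡0 small (step k (lem (+ m) (+ n) (k * + q) e))))
    where
    lem : ∀ m n t → m ≡ n + t → m - n ≡ + 0 + t
    lem _ n t refl = lem′ n t
      where
      lem′ : ∀ n t → n + t - n ≡ + 0 + t
      lem′ = solve-∀
    small : ∣ + m - + n ∣ ℕ.< q
    small = subst (ℕ._< q) (cong ∣_∣ (sym (ℤ.m-n≡m⊖n m n))) (ℕ.≤-<-trans (ℤ.∣m⊝n∣≤m⊔n m n) (ℕ.⊔-lub m<q n<q))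

  ≈⇒% : ∀ m n → + m ≈ + n [ + q ] → m ℕ.% q ≡ n ℕ.% q
  ≈⇒% m n e = ≈⇒≡ (ℕ.m%n<n m q) (ℕ.m%n<n n q) (≈-trans (≈-sym (self m)) (≈-trans e (self n)))
    where
    self : ∀ m → + m ≈ + (m ℕ.% q) [ + q ]
    self m = %⇒≈ m (m ℕ.% q) (sym (ℕ.m%n%n≡m%n m q))

  module _ (a d : ℕ) (u : Unit (+ q) (+ d)) where

    root : ∃[ e ] 1 ℕ.≤ e × e ℕ.≤ q × + (d ℕ.* e) ≈ + a [ + q ]
    root = fix (r %ℕ q) (n%ℕd<d r q) (step (r /ℕ q) (a≡a%ℕn+[a/ℕn]*n r q))
      where
      i = inverse u
      r = i * + a
      lem : ∀ d i a → d * (i * a) ≡ d * i * a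
      lem = solve-∀
      sol : ∀ e → r ≈ + e [ + q ] → + (d ℕ.* e) ≈ + a [ + q ]
      sol e p = ≈-trans (≈-reflexive (ℤ.pos-* d e))
          (≈-trans (≈-*ˡ (+ d) (≈-sym p)) (≈-trans (≈-reflexive (lem (+ d) i (+ a)))
                (≈-trans (≈-*ʳ (+ a) (product u)) (≈-reflexive (ℤ.*-identityˡ (+ a))))))
      fix : ∀ e → e ℕ.< q → r ≈ + e [ + q ] → ∃[ e ] 1 ℕ.≤ e × e ℕ.≤ q × + (d ℕ.* e) ≈ + a [ + q ]
      -- The residue 0 is represented by q, since sums run over 1, ..., q.
      fix zero    0<q p = q , 0<q , ℕ.≤-refl , sol q (≈-trans p (step (- + 1) (zero≡ (+ q))))
        where
        zero≡ : ∀ x → + 0 ≡ x + - + 1 * x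
        zero≡ = solve-∀
      fix (suc e) e<q p = suc e , s≤s z≤n , ℕ.<⇒≤ e<q , sol (suc e) p

    private
      e₀ = proj₁ root
      1≤e₀ = proj₁ (proj₂ root)
      e₀≤q = proj₁ (proj₂ (proj₂ root))
      root≈ = proj₂ (proj₂ (proj₂ root))

    class-δ : ∀ e → 1 ℕ.≤ e → e ℕ.≤ q → class a (d ℕ.* e) ≡ ⟦ e₀ ℕ.≟ e ⟧ * + 1
    class-δ e 1≤e e≤q = trans (⟦⟧-cong _ (e₀ ℕ.≟ e) to (λ { refl → ≈⇒% (d ℕ.* e) a root≈ }))
        (sym (ℤ.*-identityʳ ⟦ e₀ ℕ.≟ e ⟧))
      where
      pred< : ∀ {x} → 1 ℕ.≤ x → x ℕ.≤ q → ℕ.pred x ℕ.< q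
      pred< {suc x} _ le = le
      +pred : ∀ {x} → 1 ℕ.≤ x → + ℕ.pred x ≡ + x - + 1
      +pred {suc x} _ = refl
      to : (d ℕ.* e) ℕ.% q ≡ a ℕ.% q → e₀ ≡ e
      to eq = trans (sym (ℕ.suc-pred e₀ {{ℕ.>-nonZero 1≤e₀}}))
          (trans (cong suc preds) (ℕ.suc-pred e {{ℕ.>-nonZero 1≤e}}))
        where
        e≈ : + e₀ ≈ + e [ + q ]
        e≈ = Unit-cancelˡ (+ d) u (≈-trans (≈-reflexive (sym (ℤ.pos-* d e₀)))
            (≈-trans root≈ (≈-trans (≈-sym (%⇒≈ (d ℕ.* e) a eq)) (≈-reflexive (ℤ.pos-* d e)))))
        -- `≈⇒≡` compares numbers in [0, q), so the range 1, ..., q is lowered by one.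
        preds : ℕ.pred e₀ ≡ ℕ.pred e
        preds = ≈⇒≡ (pred< 1≤e₀ e₀≤q) (pred< 1≤e e≤q)
            (≈-trans (≈-reflexive (+pred 1≤e₀))
            (≈-trans (≈-+ e≈ (≈-refl {x = - + 1})) (≈-reflexive (sym (+pred 1≤e)))))

    solutions-small : ∀ Z → Z ℕ.≤ q → solutions a d Z ≡ ⟦ e₀ ℕ.≤? Z ⟧
    solutions-small Z Z≤q = trans (∑-cong Z λ e 1≤e e≤Z → class-δ e 1≤e (ℕ.≤-trans e≤Z Z≤q))
      (trans (∑-δ Z e₀ (λ _ → + 1) 1≤e₀) (ℤ.*-identityʳ _))

    solutions-period : ∀ Z → solutions a d (q ℕ.+ Z) ≡ + 1 + solutions a d Z
    solutions-period Z = trans (∑-++ q Z _)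
        (cong₂ _+_ (trans (solutions-small q ℕ.≤-refl) (⟦⟧-yes (e₀ ℕ.≤? q) e₀≤q)) (∑-ext Z shift))
      where
      lem : ∀ d q e → d ℕ.* (q ℕ.+ e) ≡ d ℕ.* e ℕ.+ d ℕ.* q
      lem = solveℕ
      shift : ∀ e → class a (d ℕ.* (q ℕ.+ e)) ≡ class a (d ℕ.* e)
      shift e = cong (λ t → ⟦ t ℕ.≟ a ℕ.% q ⟧) (trans (cong (ℕ._% q) (lem d q e)) (ℕ.[m+kn]%n≡m%n (d ℕ.* e) d q))

    solutions-bit : ∀ Z → Z ℕ.≤ q → solutions a d Z ≡ + 0 ⊎ solutions a d Z ≡ + 1
    solutions-bit Z Z≤q with e₀ ℕ.≤? Z | solutions-small Z Z≤q
    ... | yes _ | e = inj₂ e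
    ... | no _  | e = inj₁ e

  -- A full period contains exactly one solution for either class, so only the incomplete period can
  -- differ, and there each count is 0 or 1.
  solutions-close : ∀ a b d Z → Unit (+ q) (+ d) → ∣ solutions a d Z - solutions b d Z ∣ ℕ.≤ 1
  solutions-close a b d Z u = subst (λ z → ∣ solutions a d z - solutions b d z ∣ ℕ.≤ 1)
      (sym (trans (ℕ.m≡m%n+[m/n]*n Z q) (ℕ.+-comm (Z ℕ.% q) _))) (go (Z ℕ./ q))
    where
    r = Z ℕ.% q
    bits : ∀ x y → x ≡ + 0 ⊎ x ≡ + 1 → y ≡ + 0 ⊎ y ≡ + 1 → ∣ x - y ∣ ℕ.≤ 1
    bits _ _ (inj₁ refl) (inj₁ refl) = z≤n
    bits _ _ (inj₁ refl) (inj₂ refl) = s≤s z≤n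
    bits _ _ (inj₂ refl) (inj₁ refl) = s≤s z≤n
    bits _ _ (inj₂ refl) (inj₂ refl) = z≤n
    lem : ∀ x y → (+ 1 + x) - (+ 1 + y) ≡ x - y
    lem = solve-∀
    go : ∀ k → ∣ solutions a d (k ℕ.* q ℕ.+ r) - solutions b d (k ℕ.* q ℕ.+ r) ∣ ℕ.≤ 1
    go zero    = bits (solutions a d r) (solutions b d r) (solutions-bit a d u r (ℕ.<⇒≤ (ℕ.m%n<n Z q)))
        (solutions-bit b d u r (ℕ.<⇒≤ (ℕ.m%n<n Z q)))
    go (suc k) = subst (λ t → ∣ t ∣ ℕ.≤ 1)
        (sym (trans (cong₂ _-_ (period a) (period b))
        (lem (solutions a d (k ℕ.* q ℕ.+ r)) (solutions b d (k ℕ.* q ℕ.+ r))))) (go k)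
      where
      period : ∀ a → solutions a d (suc k ℕ.* q ℕ.+ r) ≡ + 1 + solutions a d (k ℕ.* q ℕ.+ r)
      period a = trans (cong (solutions a d) (ℕ.+-assoc q (k ℕ.* q) r)) (solutions-period a d u (k ℕ.* q ℕ.+ r))

  ∣χ∣≤1 : ∀ n → ∣ χ n ∣ ℕ.≤ 1
  ∣χ∣≤1 n with χ-cases n
  ... | inj₁ e = subst (λ t → ∣ t ∣ ℕ.≤ 1) (sym e) z≤n
  ... | inj₂ (_ , inj₁ e) = subst (λ t → ∣ t ∣ ℕ.≤ 1) (sym e) ℕ.≤-refl
  ... | inj₂ (_ , inj₂ e) = subst (λ t → ∣ t ∣ ℕ.≤ 1) (sym e) ℕ.≤-refl

  χ≡ : ∀ m n → χ (m ℕ.* n) ≡ + 1 → χ m ≡ χ n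
  χ≡ m n e = go (χ-cases m) (χ-cases n) (trans (sym (χ-* m n)) e)
    where
    go : _ → _ → χ m * χ n ≡ + 1 → χ m ≡ χ n
    go (inj₁ p) _ e with trans (sym e) (cong (_* χ n) p)
    ... | ()
    go (inj₂ _) (inj₁ p) e with trans (sym e) (trans (cong (χ m *_) p) (ℤ.*-zeroʳ (χ m)))
    ... | ()
    go (inj₂ (_ , inj₁ p)) (inj₂ (_ , inj₁ r)) e = trans p (sym r)
    go (inj₂ (_ , inj₂ p)) (inj₂ (_ , inj₂ r)) e = trans p (sym r)
    go (inj₂ (_ , inj₁ p)) (inj₂ (_ , inj₂ r)) e with trans (sym e) (cong₂ _*_ p r)
    ... | ()
    go (inj₂ (_ , inj₂ p)) (inj₂ (_ , inj₁ r)) e with trans (sym e) (cong₂ _*_ p r)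
    ... | ()

  module _ (Y : ℕ) (1≤Y : 1 ℕ.≤ Y) where

    private
      X = Y ℕ.* Y
      low : ℕ → ℤ
      low d = ⟦ d ℕ.≤? Y ⟧
      -- This is 2 for d ≤ Y < e, 0 for e ≤ Y < d, and 1 if d and e are on the same side of Y. Each
      -- solution with d > Y has been moved to its mirror image.
      weight : ℕ → ℕ → ℤ
      weight d e = low d + (+ 1 - low e)

      Y≤X : Y ℕ.≤ X
      Y≤X = ℕ.m≤m*n Y Y {{ℕ.>-nonZero 1≤Y}}

    -- Dirichlet's hyperbola: if χ n = 1, the divisors d > Y may be traded for their
    -- cofactors, which carry the same character value.
    divisorSum-fold : ∀ n → χ n ≡ + 1 →
      divisorSum X n ≡ ∑ X λ d → ∑ X λ e → ⟦ d ℕ.* e ℕ.≟ n ⟧ * (χ d * weight d e)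
    divisorSum-fold n χn = begin
      divisorSum X n
        ≡⟨ ∑-ext X (λ d → trans (∑-ext X λ e → split (⟦ d ℕ.* e ℕ.≟ n ⟧) (χ d) (low d)) (∑-+ X _ _)) ⟩
      ∑ X (λ d → ∑ X (λ e → ⟦ d ℕ.* e ℕ.≟ n ⟧ * (χ d * low d)) + ∑ X (λ e →
          ⟦ d ℕ.* e ℕ.≟ n ⟧ * (χ d * (+ 1 - low d))))
        ≡⟨ ∑-+ X _ _ ⟩
      A + ∑ X (λ d → ∑ X (λ e → ⟦ d ℕ.* e ℕ.≟ n ⟧ * (χ d * (+ 1 - low d))))
        ≡⟨ cong (λ t → A + t) (trans (∑-ext X (λ d → ∑-ext X (λ e → exchange d e))) (∑-swap X X _)) ⟩
      A + ∑ X (λ d → ∑ X (λ e → ⟦ d ℕ.* e ℕ.≟ n ⟧ * (χ d * (+ 1 - low e))))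
        ≡⟨ sym (∑-+ X _ _) ⟩
      ∑ X (λ d → ∑ X (λ e → ⟦ d ℕ.* e ℕ.≟ n ⟧ * (χ d * low d)) + ∑ X (λ e →
          ⟦ d ℕ.* e ℕ.≟ n ⟧ * (χ d * (+ 1 - low e))))
        ≡⟨ ∑-ext X (λ d → trans (sym (∑-+ X _ _)) (∑-ext X λ e →
            join (⟦ d ℕ.* e ℕ.≟ n ⟧) (χ d) (low d) (+ 1 - low e))) ⟩
      ∑ X (λ d → ∑ X λ e → ⟦ d ℕ.* e ℕ.≟ n ⟧ * (χ d * weight d e))
        ∎
      where
      open ≡-Reasoning
      A = ∑ X λ d → ∑ X λ e → ⟦ d ℕ.* e ℕ.≟ n ⟧ * (χ d * low d)
      split : ∀ i c l → i * c ≡ i * (c * l) + i * (c * (+ 1 - l))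
      split = solve-∀
      join : ∀ i c l m → i * (c * l) + i * (c * m) ≡ i * (c * (l + m))
      join = solve-∀
      exchange : ∀ d e → ⟦ d ℕ.* e ℕ.≟ n ⟧ * (χ d * (+ 1 - low d)) ≡ ⟦ e ℕ.* d ℕ.≟ n ⟧ * (χ e * (+ 1 - low d))
      exchange d e = trans (⟦⟧-*-cong (d ℕ.* e ℕ.≟ n) λ { refl → cong (_* (+ 1 - low d)) (χ≡ d e χn) })
        (cong (_* (χ e * (+ 1 - low d))) (⟦⟧-cong (d ℕ.* e ℕ.≟ n) (e ℕ.* d ℕ.≟ n) (trans (ℕ.*-comm e d))
            (trans (ℕ.*-comm d e))))

    inner : ℕ → ℕ → ℤ
    inner a d = ∑ X λ e → weight d e * (⟦ d ℕ.* e ℕ.≤? X ⟧ * class a (d ℕ.* e))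

    classSum-fold : ∀ a → χ a ≡ + 1 → classSum X a ≡ ∑ X (λ d → χ d * inner a d)
    classSum-fold a χa = begin
      classSum X a
        ≡⟨ ∑-ext X (λ n → trans (⟦⟧-*-cong (n ℕ.% q ℕ.≟ a ℕ.% q) λ eq → divisorSum-fold n (trans (χ-mod n a eq) χa))
            (push n)) ⟩
      ∑ X (λ n → ∑ X λ d → ∑ X λ e → term n d e)
        ≡⟨ ∑-swap X X _ ⟩
      ∑ X (λ d → ∑ X λ n → ∑ X λ e → term n d e)
        ≡⟨ ∑-cong X (λ d 1≤d _ → trans (∑-swap X X _)
            (trans (∑-cong X λ e 1≤e _ → collect d e 1≤d 1≤e) (∑-*ˡ X (χ d) _))) ⟩
      ∑ X (λ d → χ d * inner a d)
        ∎
      where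
      open ≡-Reasoning
      term : ℕ → ℕ → ℕ → ℤ
      term n d e = class a n * (⟦ d ℕ.* e ℕ.≟ n ⟧ * (χ d * weight d e))
      push : ∀ n → class a n * ∑ X (λ d → ∑ X λ e → ⟦ d ℕ.* e ℕ.≟ n ⟧ * (χ d * weight d e)) ≡
          ∑ X (λ d → ∑ X λ e → term n d e)
      push n = sym (trans (∑-ext X (λ d → ∑-*ˡ X (class a n) _)) (∑-*ˡ X (class a n) _))
      rearrange : ∀ c i x w → c * (i * (x * w)) ≡ (x * w) * (i * c)
      rearrange = solve-∀
      assoc : ∀ x w i c → (x * w) * (i * c) ≡ x * (w * (i * c))
      assoc = solve-∀
      collect : ∀ d e → 1 ℕ.≤ d → 1 ℕ.≤ e → ∑ X (λ n → term n d e) ≡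
          χ d * (weight d e * (⟦ d ℕ.* e ℕ.≤? X ⟧ * class a (d ℕ.* e)))
      collect d e 1≤d 1≤e = trans (∑-ext X λ n → rearrange (class a n) (⟦ d ℕ.* e ℕ.≟ n ⟧) (χ d) (weight d e))
        (trans (∑-*ˡ X (χ d * weight d e) _)
            (trans (cong (χ d * weight d e *_) (∑-δ X (d ℕ.* e) (class a) (ℕ.*-mono-≤ 1≤d 1≤e)))
            (assoc (χ d) (weight d e) ⟦ d ℕ.* e ℕ.≤? X ⟧ (class a (d ℕ.* e)))))

    -- Either e ≤ Y and the weight vanishes, or d e exceeds Y².
    inner-large : ∀ a d → Y ℕ.< d → inner a d ≡ + 0
    inner-large a d Y<d = ∑-zero X λ e _ _ → vanish e (e ℕ.≤? Y)
      where
      lem : ∀ x → (+ 0 + (+ 1 - + 1)) * x ≡ + 0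
      lem = solve-∀
      lem₂ : ∀ w x → w * (+ 0 * x) ≡ + 0
      lem₂ = solve-∀
      vanish : ∀ e → Dec (e ℕ.≤ Y) → weight d e * (⟦ d ℕ.* e ℕ.≤? X ⟧ * class a (d ℕ.* e)) ≡ + 0
      vanish e (yes e≤Y) = trans (cong₂ (λ s t → (s + (+ 1 - t)) * (⟦ d ℕ.* e ℕ.≤? X ⟧ * class a (d ℕ.* e)))
          (⟦⟧-no (d ℕ.≤? Y) (ℕ.<⇒≱ Y<d)) (⟦⟧-yes (e ℕ.≤? Y) e≤Y)) (lem (⟦ d ℕ.* e ℕ.≤? X ⟧ * class a (d ℕ.* e)))
      vanish e (no e≰Y) = trans (cong (λ s → weight d e * (s * class a (d ℕ.* e)))
          (⟦⟧-no (d ℕ.* e ℕ.≤? X) (ℕ.<⇒≱ (ℕ.*-mono-< Y<d (ℕ.≰⇒> e≰Y))))) (lem₂ (weight d e) (class a (d ℕ.* e)))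

    -- For d ≤ Y the weight is 2 - [e ≤ Y], and the condition d e ≤ Y² holds automatically when e ≤
    -- Y.
    inner-small : ∀ a d → .{{_ : NonZero d}} → d ℕ.≤ Y → inner a d ≡ + 2 * solutions a d (X ℕ./ d) - solutions a d Y
    inner-small a d d≤Y = begin
      inner a d
        ≡⟨ ∑-ext X (λ e → trans (cong (λ t → (t + (+ 1 - low e)) * (⟦ d ℕ.* e ℕ.≤? X ⟧ * c e))
            (⟦⟧-yes (d ℕ.≤? Y) d≤Y)) (trans (split (low e) (⟦ d ℕ.* e ℕ.≤? X ⟧) (c e))
            (cong (λ t → + 2 * (⟦ d ℕ.* e ℕ.≤? X ⟧ * c e) + - + 1 * t) (drop e)))) ⟩
      ∑ X (λ e → + 2 * (⟦ d ℕ.* e ℕ.≤? X ⟧ * c e) + - + 1 * (low e * c e))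
        ≡⟨ trans (∑-+ X _ _) (cong₂ _+_ (∑-*ˡ X (+ 2) _) (∑-*ˡ X (- + 1) _)) ⟩
      + 2 * ∑ X (λ e → ⟦ d ℕ.* e ℕ.≤? X ⟧ * c e) + - + 1 * ∑ X (λ e → low e * c e)
        ≡⟨ cong₂ (λ s t → + 2 * s + - + 1 * t)
             (trans (∑-ext X λ e → cong (_* c e) (⟦⟧-cong (d ℕ.* e ℕ.≤? X) (e ℕ.≤? X ℕ./ d) (to e) (from e)))
                 (cut (X ℕ./ d) (ℕ.m/n≤m X d)))
             (cut Y Y≤X) ⟩
      + 2 * solutions a d (X ℕ./ d) + - + 1 * solutions a d Y
        ≡⟨ cong (λ t → + 2 * solutions a d (X ℕ./ d) + t) (ℤ.-1*i≡-i (solutions a d Y)) ⟩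
      + 2 * solutions a d (X ℕ./ d) - solutions a d Y
        ∎
      where
      open ≡-Reasoning
      c : ℕ → ℤ
      c e = class a (d ℕ.* e)
      split : ∀ l i c → (+ 1 + (+ 1 - l)) * (i * c) ≡ + 2 * (i * c) + - + 1 * (l * (i * c))
      split = solve-∀
      drop : ∀ e → low e * (⟦ d ℕ.* e ℕ.≤? X ⟧ * c e) ≡ low e * c e
      drop e = ⟦⟧-*-cong (e ℕ.≤? Y) λ e≤Y → trans (cong (_* c e) (⟦⟧-yes (d ℕ.* e ℕ.≤? X) (ℕ.*-mono-≤ d≤Y e≤Y)))
          (ℤ.*-identityˡ (c e))
      cut : ∀ Z → Z ℕ.≤ X → ∑ X (λ e → ⟦ e ℕ.≤? Z ⟧ * c e) ≡ solutions a d Z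
      cut Z Z≤X = trans (∑-truncate _ Z≤X λ e Z<e →
          trans (cong (_* c e) (⟦⟧-no (e ℕ.≤? Z) (ℕ.<⇒≱ Z<e))) (ℤ.*-zeroˡ (c e)))
                        (∑-cong Z λ e _ e≤Z → trans (cong (_* c e) (⟦⟧-yes (e ℕ.≤? Z) e≤Z)) (ℤ.*-identityˡ (c e)))
      to : ∀ e → d ℕ.* e ℕ.≤ X → e ℕ.≤ X ℕ./ d
      to e le = ℕ.≤-trans (ℕ.≤-reflexive (sym (trans (cong (ℕ._/ d) (ℕ.*-comm d e)) (ℕ.m*n/n≡m e d))))
          (ℕ./-monoˡ-≤ d le)
      from : ∀ e → e ℕ.≤ X ℕ./ d → d ℕ.* e ℕ.≤ X
      from e le = ℕ.≤-trans (ℕ.*-monoʳ-≤ d le) (ℕ.≤-trans (ℕ.≤-reflexive (ℕ.*-comm d (X ℕ./ d))) (ℕ.m/n*n≤m X d))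

    -- The bound is 2·1 + 1: by `inner-small` two copies of one count and one copy of another enter,
    -- and each count varies by at most 1 between classes.
    inner-close : ∀ a b d → 1 ℕ.≤ d → d ℕ.≤ Y → χ d * (inner a d - inner b d) ≤ + 3
    inner-close a b d 1≤d d≤Y with χ-cases d
    ... | inj₁ χ≡0 = subst (_≤ + 3)
        (sym (trans (cong (_* (inner a d - inner b d)) χ≡0) (ℤ.*-zeroˡ (inner a d - inner b d)))) (+≤+ z≤n)
    ... | inj₂ (u , _) = bound _ (ℕ.≤-trans (ℕ.≤-reflexive (ℤ.abs-* (χ d) _)) (ℕ.*-mono-≤ (∣χ∣≤1 d) close))
      where
      instance _ = ℕ.>-nonZero 1≤d
      bound : ∀ x → ∣ x ∣ ℕ.≤ 3 → x ≤ + 3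
      bound (+ n)    le = +≤+ le
      bound -[1+ n ] le = -≤+
      s : ℕ → ℤ
      s Z = solutions a d Z - solutions b d Z
      lem : ∀ x y z w → (+ 2 * x - y) - (+ 2 * z - w) ≡ + 2 * (x - z) - (y - w)
      lem = solve-∀
      close : ∣ inner a d - inner b d ∣ ℕ.≤ 3
      close = subst (λ t → ∣ t ∣ ℕ.≤ 3)
          (sym (trans (cong₂ _-_ (inner-small a d d≤Y) (inner-small b d d≤Y))
          (lem (solutions a d (X ℕ./ d)) _ _ _)))
        (ℕ.≤-trans (ℤ.∣i-j∣≤∣i∣+∣j∣ (+ 2 * s (X ℕ./ d)) (s Y))
            (ℕ.+-mono-≤ (ℕ.≤-trans (ℕ.≤-reflexive (ℤ.abs-* (+ 2) (s (X ℕ./ d))))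
            (ℕ.*-monoʳ-≤ 2 (solutions-close a b d (X ℕ./ d) u))) (solutions-close a b d Y u)))

    classSum-close : ∀ a b → χ a ≡ + 1 → χ b ≡ + 1 → classSum X a ≤ classSum X b + + (3 ℕ.* Y)
    classSum-close a b χa χb = begin
      classSum X a                                               ≡⟨ formula a χa ⟩
      ∑ Y (λ d → χ d * inner a d)                                ≡⟨
          trans (∑-ext Y λ d → lem (χ d) (inner a d) (inner b d)) (∑-+ Y _ _) ⟩
      ∑ Y (λ d → χ d * inner b d) + ∑ Y (λ d → χ d * (inner a d - inner b d)) ≤⟨ ℤ.+-monoʳ-≤
          (∑ Y (λ d → χ d * inner b d)) (∑-≤ Y (inner-close a b)) ⟩
      ∑ Y (λ d → χ d * inner b d) + ∑ Y (λ _ → + 3)              ≡⟨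
          cong₂ _+_ (sym (formula b χb)) (trans (∑-const Y (+ 3))
          (trans (ℤ.*-comm (+ Y) (+ 3)) (sym (ℤ.pos-* 3 Y)))) ⟩
      classSum X b + + (3 ℕ.* Y)                                 ∎
      where
      open ℤ.≤-Reasoning
      lem : ∀ c x y → c * x ≡ c * y + c * (x - y)
      lem = solve-∀
      formula : ∀ a → χ a ≡ + 1 → classSum X a ≡ ∑ Y (λ d → χ d * inner a d)
      formula a χa = trans (classSum-fold a χa) (∑-truncate _ Y≤X λ d Y<d →
          trans (cong (χ d *_) (inner-large a d Y<d)) (ℤ.*-zeroʳ (χ d)))

-- Divisor sums along prime powers

prime∤⇒coprime : ∀ {p d} → Prime p → ¬ p ℕ.∣ d → Coprime.Coprime p d
prime∤⇒coprime pr p∤d (k∣p , k∣d) with prime⇒irreducible pr k∣p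
... | inj₁ k≡1  = k≡1
... | inj₂ refl = contradiction k∣d p∤d

prime-divisor : ∀ n → 2 ℕ.≤ n → ∃[ p ] Prime p × p ℕ.∣ n
prime-divisor n 2≤n = go (PrimeFactorisation.factors f) (PrimeFactorisation.isFactorisation f)
    (PrimeFactorisation.factorsPrime f)
  where
  f = factorise n {{ℕ.>-nonZero (ℕ.<⇒≤ 2≤n)}}
  go : ∀ ps → n ≡ ℕ.product ps → All.All Prime ps → ∃[ p ] Prime p × p ℕ.∣ n
  go []       e _           = contradiction 2≤n (ℕ.≤⇒≯ (ℕ.≤-reflexive e))
  go (p ∷ ps) e (pr All.∷ _) = p , pr , divides (ℕ.product ps) (trans e (ℕ.*-comm p (ℕ.product ps)))

valuation : ∀ {p} → Prime p → ∀ n → 1 ℕ.≤ n → ∃[ k ] ∃[ m ] n ≡ p ℕ.^ k ℕ.* m × ¬ p ℕ.∣ m × 1 ℕ.≤ m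
valuation {p} pr n 1≤n = go n (<-wellFounded n) 1≤n
  where
  instance _ = prime⇒nonZero pr
  go : ∀ n → Acc ℕ._<_ n → 1 ℕ.≤ n → ∃[ k ] ∃[ m ] n ≡ p ℕ.^ k ℕ.* m × ¬ p ℕ.∣ m × 1 ℕ.≤ m
  go n _ 1≤n with p ℕ.∣? n
  ... | no p∤n = 0 , n , sym (ℕ.*-identityˡ n) , p∤n , 1≤n
  go .(zero ℕ.* p) _ () | yes (divides-refl zero)
  go .(suc c ℕ.* p) (acc rec) _ | yes (divides-refl (suc c)) with go (suc c)
      (rec (ℕ.m<m*n (suc c) p (ℕ.nonTrivial⇒n>1 p {{prime⇒nonTrivial pr}}))) (s≤s z≤n)
  ... | k , m , e , p∤m , 1≤m = suc k , m , trans (ℕ.*-comm (suc c) p)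
      (trans (cong (p ℕ.*_) e) (sym (ℕ.*-assoc p (p ℕ.^ k) m))) , p∤m , 1≤m

∑-multiples : ∀ p .{{_ : NonZero p}} m (u : ℕ → ℤ) → ∑ (m ℕ.* p) (λ d → ⟦ p ℕ.∣? d ⟧ * u d) ≡
    ∑ m (λ d → u (d ℕ.* p))
∑-multiples p zero    u = refl
∑-multiples p (suc m) u = trans (cong (λ t → ∑ t (λ d → ⟦ p ℕ.∣? d ⟧ * u d)) (ℕ.+-comm p (m ℕ.* p)))
    (trans (∑-++ (m ℕ.* p) p (λ d → ⟦ p ℕ.∣? d ⟧ * u d)) (cong₂ _+_ (∑-multiples p m u) block))
  where
  1≤p = ℕ.>-nonZero⁻¹ p
  only : ∀ i → 1 ℕ.≤ i → i ℕ.≤ p → ⟦ p ℕ.∣? (m ℕ.* p ℕ.+ i) ⟧ ≡ ⟦ p ℕ.≟ i ⟧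
  only i 1≤i i≤p = ⟦⟧-cong (p ℕ.∣? (m ℕ.* p ℕ.+ i)) (p ℕ.≟ i)
    (λ p∣ → ℕ.≤-antisym (ℕ.∣⇒≤ {{ℕ.>-nonZero 1≤i}} (ℕ.∣m+n∣m⇒∣n p∣ (ℕ.n∣m*n m))) i≤p)
    (λ { refl → ℕ.∣m∣n⇒∣m+n (ℕ.n∣m*n m) ℕ.∣-refl })
  block : ∑ p (λ i → ⟦ p ℕ.∣? (m ℕ.* p ℕ.+ i) ⟧ * u (m ℕ.* p ℕ.+ i)) ≡ u (suc m ℕ.* p)
  block = trans (∑-cong p λ i 1≤i i≤p → cong (_* u (m ℕ.* p ℕ.+ i)) (only i 1≤i i≤p))
    (trans (∑-δ p p (λ i → u (m ℕ.* p ℕ.+ i)) 1≤p) (trans (cong (_* u (m ℕ.* p ℕ.+ p)) (⟦⟧-yes (p ℕ.≤? p) ℕ.≤-refl))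
        (trans (ℤ.*-identityˡ _) (cong u (ℕ.+-comm (m ℕ.* p) p)))))

module Divisors (χ : ℕ → ℤ) (χ-* : ∀ m n → χ (m ℕ.* n) ≡ χ m * χ n) where

  σχ : ℕ → ℤ
  σχ n = ∑ n λ d → ⟦ d ℕ.∣? n ⟧ * χ d

  private
    -- This part does not change when n is multiplied by p. It yields a recurrence in the exponent
    -- of p that takes the place of the multiplicativity of `σχ`.
    σχ′ : ℕ → ℕ → ℤ
    σχ′ p n = ∑ n λ d → ⟦ ¬? (p ℕ.∣? d) ⟧ * (⟦ d ℕ.∣? n ⟧ * χ d)

  complement : {P : Set} (d : Dec P) → + 1 ≡ ⟦ d ⟧ + ⟦ ¬? d ⟧
  complement (yes _) = refl
  complement (no _)  = refl

  σχ′-step : ∀ {p} → Prime p → ∀ m → 1 ℕ.≤ m → ∑ (p ℕ.* m) (λ d → ⟦ ¬? (p ℕ.∣? d) ⟧ * (⟦ d ℕ.∣? p ℕ.* m ⟧ * χ d)) ≡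
      σχ′ p m
  σχ′-step {p} pr m 1≤m = trans (∑-ext (p ℕ.* m) λ d → ⟦⟧-*-cong (¬? (p ℕ.∣? d)) λ p∤d → cong (_* χ d)
      (⟦⟧-cong (d ℕ.∣? p ℕ.* m) (d ℕ.∣? m) (Coprime.coprime-divisor (Coprime.sym (prime∤⇒coprime pr p∤d)))
          (ℕ.∣n⇒∣m*n p)))
    (∑-truncate _ (ℕ.m≤n*m m p {{prime⇒nonZero pr}}) λ d m<d →
        trans (cong (λ t → ⟦ ¬? (p ℕ.∣? d) ⟧ * (t * χ d))
        (⟦⟧-no (d ℕ.∣? m) (λ d∣m → ℕ.<⇒≱ m<d (ℕ.∣⇒≤ {{ℕ.>-nonZero 1≤m}} d∣m)))) (lem ⟦ ¬? (p ℕ.∣? d) ⟧ (χ d)))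
    where
    lem : ∀ a b → a * (+ 0 * b) ≡ + 0
    lem = solve-∀

  -- The divisors of pm divisible by p are p times the divisors of m; the others make up `σχ′`.
  σχ-step : ∀ {p} → Prime p → ∀ m → 1 ℕ.≤ m → σχ (p ℕ.* m) ≡ χ p * σχ m + σχ′ p m
  σχ-step {p} pr m 1≤m = trans (∑-ext (p ℕ.* m) λ d →
      trans (sym (ℤ.*-identityˡ (u d)))
      (trans (cong (_* u d) (complement (p ℕ.∣? d))) (ℤ.*-distribʳ-+ (u d) ⟦ p ℕ.∣? d ⟧ ⟦ ¬? (p ℕ.∣? d) ⟧)))
    (trans (∑-+ (p ℕ.* m) _ _) (cong₂ _+_ divisible (σχ′-step pr m 1≤m)))
    where
    instance _ = prime⇒nonZero pr
    u : ℕ → ℤ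
    u d = ⟦ d ℕ.∣? p ℕ.* m ⟧ * χ d
    lem : ∀ a b c → a * (b * c) ≡ c * (a * b)
    lem = solve-∀
    divisible : ∑ (p ℕ.* m) (λ d → ⟦ p ℕ.∣? d ⟧ * u d) ≡ χ p * σχ m
    divisible = trans (cong (λ t → ∑ t (λ d → ⟦ p ℕ.∣? d ⟧ * u d)) (ℕ.*-comm p m))
        (trans (∑-multiples p m u) (trans (∑-ext m λ d →
      trans (cong₂ _*_ (⟦⟧-cong (d ℕ.* p ℕ.∣? p ℕ.* m) (d ℕ.∣? m) (λ dp∣ →
          ℕ.*-cancelˡ-∣ p (subst (ℕ._∣ p ℕ.* m) (ℕ.*-comm d p) dp∣)) (λ d∣m →
          subst (ℕ._∣ p ℕ.* m) (ℕ.*-comm p d) (ℕ.*-monoʳ-∣ p d∣m))) (χ-* d p))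
        (lem ⟦ d ℕ.∣? m ⟧ (χ d) (χ p))) (∑-*ˡ m (χ p) _)))

  σχ′-coprime : ∀ {p} m → 1 ℕ.≤ m → ¬ p ℕ.∣ m → σχ′ p m ≡ σχ m
  σχ′-coprime {p} m 1≤m p∤m = ∑-ext m λ d →
      trans (swap (⟦ ¬? (p ℕ.∣? d) ⟧) ⟦ d ℕ.∣? m ⟧ (χ d)) (⟦⟧-*-cong (d ℕ.∣? m) λ d∣m →
      trans (cong (_* χ d) (⟦⟧-yes (¬? (p ℕ.∣? d)) (λ p∣d → p∤m (ℕ.∣-trans p∣d d∣m)))) (ℤ.*-identityˡ (χ d)))
    where
    swap : ∀ a b c → a * (b * c) ≡ b * (a * c)
    swap = solve-∀

  σχ′-power : ∀ {p} → Prime p → ∀ k m → 1 ℕ.≤ m → ¬ p ℕ.∣ m → σχ′ p (p ℕ.^ k ℕ.* m) ≡ σχ m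
  σχ′-power {p} pr zero    m 1≤m p∤m = trans (cong (σχ′ p) (ℕ.*-identityˡ m)) (σχ′-coprime m 1≤m p∤m)
  σχ′-power {p} pr (suc k) m 1≤m p∤m =
      trans (cong (σχ′ p) (ℕ.*-assoc p (p ℕ.^ k) m))
      (trans (σχ′-step pr (p ℕ.^ k ℕ.* m) (ℕ.*-mono-≤ (ℕ.>-nonZero⁻¹ (p ℕ.^ k) {{ℕ.m^n≢0 p k {{prime⇒nonZero pr}}}})
      1≤m)) (σχ′-power pr k m 1≤m p∤m))

  1≤pᵏm : ∀ {p} → Prime p → ∀ k {m} → 1 ℕ.≤ m → 1 ℕ.≤ p ℕ.^ k ℕ.* m
  1≤pᵏm {p} pr k 1≤m = ℕ.*-mono-≤ (ℕ.>-nonZero⁻¹ (p ℕ.^ k) {{ℕ.m^n≢0 p k {{prime⇒nonZero pr}}}}) 1≤m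

  σχ-power : ∀ {p} → Prime p → ∀ k m → 1 ℕ.≤ m → ¬ p ℕ.∣ m → σχ (p ℕ.^ suc k ℕ.* m) ≡
      χ p * σχ (p ℕ.^ k ℕ.* m) + σχ m
  σχ-power {p} pr k m 1≤m p∤m = trans (cong σχ (ℕ.*-assoc p (p ℕ.^ k) m))
      (trans (σχ-step pr (p ℕ.^ k ℕ.* m) (1≤pᵏm pr k 1≤m))
      (cong (λ t → χ p * σχ (p ℕ.^ k ℕ.* m) + t) (σχ′-power pr k m 1≤m p∤m)))

  -- Derivations of n as a square times primes of symbol 1; `Split⇒root` assembles a square root of
  -- -N along them.
  data Split : ℕ → Set where
    one    : Split 1
    split  : ∀ {p n} → Prime p → χ p ≡ + 1 → Split n → Split (p ℕ.* n)
    square : ∀ {p n} → Split n → Split (p ℕ.* (p ℕ.* n))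

  -- The cofactor c makes the property pass from p n to n.
  DividesNorm : ℕ → ℕ → Set
  DividesNorm N n = ∃[ x ] ∃[ y ] ∃[ c ] n ℕ.* c ≡ x ℕ.* x ℕ.+ N ℕ.* (y ℕ.* y) ×
      (∀ {r} → Prime r → r ℕ.∣ c → χ r ≡ + 1)

  module Dichotomy (q N : ℕ)
    (χ-cases : ∀ n → χ n ≡ + 0 ⊎ Unit (+ q) (+ n) × (χ n ≡ + 1 ⊎ χ n ≡ - + 1))
    (χ-unit : ∀ n → Unit (+ q) (+ n) → χ n ≢ + 0)
    (inert : ∀ {p x y} → Prime p → χ p ≡ - + 1 → p ℕ.∣ x ℕ.* x ℕ.+ N ℕ.* (y ℕ.* y) → p ℕ.∣ x × p ℕ.∣ y) where

    Norm = DividesNorm N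

    Norm-split : ∀ {p n} → Prime p → χ p ≡ + 1 → Norm (p ℕ.* n) → Norm n
    Norm-split {p} {n} pr χp (x , y , c , e , s) = x , y , p ℕ.* c , trans (lem n p c) e , λ rr r∣pc →
        from rr (euclidsLemma p c rr r∣pc)
      where
      lem : ∀ n p c → n ℕ.* (p ℕ.* c) ≡ p ℕ.* n ℕ.* c
      lem = solveℕ
      from : ∀ {r} → Prime r → r ℕ.∣ p ⊎ r ℕ.∣ c → χ r ≡ + 1
      from rr (inj₂ r∣c) = s rr r∣c
      from rr (inj₁ r∣p) with prime⇒irreducible pr r∣p
      ... | inj₁ refl = contradiction rr ¬prime[1]
      ... | inj₂ refl = χp

    inert-square : ∀ {p n} → Prime p → χ p ≡ - + 1 → Norm (p ℕ.* n) → ∃[ x ] ∃[ y ] ∃[ c ] n ℕ.* c ≡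
        p ℕ.* (x ℕ.* x ℕ.+ N ℕ.* (y ℕ.* y)) × (∀ {r} → Prime r → r ℕ.∣ c → χ r ≡ + 1)
    inert-square {p} {n} pr χp (x , y , c , e , s) with inert {p} {x} {y} pr χp
        (divides (n ℕ.* c) (trans (sym e) (lem p n c)))
      where
      lem : ∀ p n c → p ℕ.* n ℕ.* c ≡ n ℕ.* c ℕ.* p
      lem = solveℕ
    ... | divides x′ refl , divides y′ refl =
        x′ , y′ , c , ℕ.*-cancelˡ-≡ _ _ p {{prime⇒nonZero pr}}
        (trans (sym (ℕ.*-assoc p n c)) (trans e (lem p x′ y′ N))) , s
      where
      lem : ∀ p x y N → x ℕ.* p ℕ.* (x ℕ.* p) ℕ.+ N ℕ.* (y ℕ.* p ℕ.* (y ℕ.* p)) ≡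
          p ℕ.* (p ℕ.* (x ℕ.* x ℕ.+ N ℕ.* (y ℕ.* y)))
      lem = solveℕ

    split≢inert : ∀ {p} → χ p ≡ + 1 → χ p ≡ - + 1 → ⊥
    split≢inert a b with trans (sym a) b
    ... | ()

    Norm-inert : ∀ {p n} → Prime p → χ p ≡ - + 1 → Norm (p ℕ.* (p ℕ.* n)) → Norm n
    Norm-inert {p} {n} pr χp nm with inert-square pr χp nm
    ... | x , y , c , e , s = x , y , c , ℕ.*-cancelˡ-≡ _ _ p {{prime⇒nonZero pr}} (trans (sym (ℕ.*-assoc p n c)) e)
        , s

    ¬Norm-inert : ∀ {p n} → Prime p → χ p ≡ - + 1 → ¬ p ℕ.∣ n → ¬ Norm (p ℕ.* n)
    ¬Norm-inert {p} {n} pr χp p∤n nm with inert-square pr χp nm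
    ... | x , y , c , e , s with euclidsLemma n c pr
        (divides (x ℕ.* x ℕ.+ N ℕ.* (y ℕ.* y)) (trans e (ℕ.*-comm p (x ℕ.* x ℕ.+ N ℕ.* (y ℕ.* y)))))
    ... | inj₁ p∣n = p∤n p∣n
    ... | inj₂ p∣c = split≢inert (s pr p∣c) χp

    -- The first branch excludes divisors of norms in the sense of `Norm`, so a norm prime to q is
    -- forced into the branch with a positive divisor sum.
    Dichotomy : ℕ → Set
    Dichotomy n = (σχ n ≡ + 0 × ¬ Norm n) ⊎ (+ 1 ≤ σχ n × Split n)

    module _ {p m} (pr : Prime p) (1≤m : 1 ℕ.≤ m) (p∤m : ¬ p ℕ.∣ m) where

      -- The recurrence adds `σχ m` at every step, giving (k + 1) `σχ m`. For the norm condition,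
      -- split primes are absorbed into the cofactor until m is reached.
      power-split : χ p ≡ + 1 → Dichotomy m → ∀ k → Dichotomy (p ℕ.^ k ℕ.* m)
      power-split χp dm zero = subst Dichotomy (sym (ℕ.*-identityˡ m)) dm
      power-split χp dm (suc k) = go dm (power-split χp dm k)
        where
        recurrence : σχ (p ℕ.^ suc k ℕ.* m) ≡ σχ (p ℕ.^ k ℕ.* m) + σχ m
        recurrence = trans (σχ-power pr k m 1≤m p∤m)
            (cong (_+ σχ m) (trans (cong (_* σχ (p ℕ.^ k ℕ.* m)) χp) (ℤ.*-identityˡ _)))
        assoc = ℕ.*-assoc p (p ℕ.^ k) m
        descend : ∀ k → Norm (p ℕ.^ k ℕ.* m) → Norm m
        descend zero    nm = subst Norm (ℕ.*-identityˡ m) nm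
        descend (suc k) nm = descend k (Norm-split pr χp (subst Norm (ℕ.*-assoc p (p ℕ.^ k) m) nm))
        go : Dichotomy m → Dichotomy (p ℕ.^ k ℕ.* m) → Dichotomy (p ℕ.^ suc k ℕ.* m)
        go (inj₁ (z , ¬nm)) (inj₁ (zₖ , _)) = inj₁ (trans recurrence (cong₂ _+_ zₖ z) , ¬nm ∘ descend (suc k))
        go (inj₁ (z , ¬nm)) (inj₂ (≥1 , sp)) =
            inj₂ (ℤ.≤-trans ≥1 (ℤ.≤-reflexive
            (sym (trans recurrence (trans (cong (λ t → σχ (p ℕ.^ k ℕ.* m) + t) z) (ℤ.+-identityʳ _))))) ,
            subst Split (sym assoc) (split pr χp sp))
        go (inj₂ (≥1 , sp)) (inj₁ (zₖ , ¬nm)) =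
            inj₂ (ℤ.≤-trans ≥1 (ℤ.≤-reflexive
            (sym (trans recurrence (trans (cong (_+ σχ m) zₖ) (ℤ.+-identityˡ _))))) , powers (suc k) sp)
          where
          powers : ∀ k → Split m → Split (p ℕ.^ k ℕ.* m)
          powers zero    s = subst Split (sym (ℕ.*-identityˡ m)) s
          powers (suc k) s = subst Split (sym (ℕ.*-assoc p (p ℕ.^ k) m)) (split pr χp (powers k s))
        go (inj₂ (≥1 , _)) (inj₂ (≥1ₖ , sp)) =
            inj₂ (ℤ.≤-trans (ℤ.≤-trans (+≤+ (s≤s z≤n)) (ℤ.+-mono-≤ ≥1ₖ ≥1)) (ℤ.≤-reflexive (sym recurrence)) ,
            subst Split (sym assoc) (split pr χp sp))

      -- The values alternate: `σχ m` for even exponents and 0 for odd ones. Correspondingly `inert`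
      -- removes p² from a norm, and a single remaining factor p is impossible, since the cofactor
      -- contains split primes only.
      power-inert : χ p ≡ - + 1 → Dichotomy m → ∀ k → Dichotomy (p ℕ.^ k ℕ.* m)
      power-inert χp dm zero = subst Dichotomy (sym (ℕ.*-identityˡ m)) dm
      power-inert χp dm (suc zero) = inj₁
          (trans (σχ-power pr 0 m 1≤m p∤m) (trans (cong₂ (λ s t → s * t + σχ m) χp (cong σχ (ℕ.*-identityˡ m)))
          (lem (σχ m)))
                                         , subst (¬_ ∘ Norm) (cong (ℕ._* m) (sym (ℕ.*-identityʳ p)))
                                             (¬Norm-inert pr χp p∤m))
        where
        lem : ∀ x → - + 1 * x + x ≡ + 0
        lem = solve-∀
      power-inert χp dm (suc (suc k)) = go (power-inert χp dm k)
        where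
        lem : ∀ x y → - + 1 * (- + 1 * x + y) + y ≡ x
        lem = solve-∀
        recurrence : σχ (p ℕ.^ suc (suc k) ℕ.* m) ≡ σχ (p ℕ.^ k ℕ.* m)
        recurrence = trans (σχ-power pr (suc k) m 1≤m p∤m)
            (trans (cong (λ t → χ p * t + σχ m) (σχ-power pr k m 1≤m p∤m))
            (trans (cong (λ s → s * (s * σχ (p ℕ.^ k ℕ.* m) + σχ m) + σχ m) χp) (lem (σχ (p ℕ.^ k ℕ.* m)) (σχ m))))
        assoc : p ℕ.^ suc (suc k) ℕ.* m ≡ p ℕ.* (p ℕ.* (p ℕ.^ k ℕ.* m))
        assoc = trans (ℕ.*-assoc p (p ℕ.* p ℕ.^ k) m) (cong (p ℕ.*_) (ℕ.*-assoc p (p ℕ.^ k) m))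
        go : Dichotomy (p ℕ.^ k ℕ.* m) → Dichotomy (p ℕ.^ suc (suc k) ℕ.* m)
        go (inj₁ (z , ¬nm)) = inj₁ (trans recurrence z , ¬nm ∘ Norm-inert pr χp ∘ subst Norm assoc)
        go (inj₂ (≥1 , sp)) = inj₂ (ℤ.≤-trans ≥1 (ℤ.≤-reflexive (sym recurrence)) , subst Split (sym assoc)
            (square {p} sp))

    Unit-∣ : ∀ {d n} → d ℕ.∣ n → Unit (+ q) (+ n) → Unit (+ q) (+ d)
    Unit-∣ {d} (divides c refl) (unit b e) =
        unit (+ c * b) (≈-trans (≈-reflexive (trans (lem (+ c) (+ d) b) (cong (_* b) (sym (ℤ.pos-* c d))))) e)
      where
      lem : ∀ c d b → d * (c * b) ≡ (c * d) * b
      lem = solve-∀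

    dichotomy : ∀ n → 1 ℕ.≤ n → Unit (+ q) (+ n) → Dichotomy n
    dichotomy n = go n (<-wellFounded n)
      where
      go : ∀ n → Acc ℕ._<_ n → 1 ℕ.≤ n → Unit (+ q) (+ n) → Dichotomy n
      go zero _ () _
      go (suc zero) _ _ u = inj₂ (ℤ.≤-reflexive (sym σχ1) , one)
        where
        χ1 : χ 1 ≡ + 1
        χ1 with χ-cases 1
        ... | inj₁ z = contradiction z (χ-unit 1 Unit-1)
        ... | inj₂ (_ , inj₁ e) = e
        ... | inj₂ (_ , inj₂ e) with trans (sym e) (trans (χ-* 1 1) (cong₂ _*_ e e))
        ... | ()
        σχ1 : σχ 1 ≡ + 1
        σχ1 = cong (λ t → + 0 + + 1 * t) χ1
      go n@(suc (suc _)) (acc rec) 1≤n u with prime-divisor n (s≤s (s≤s z≤n))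
      ... | p , pr , p∣n with valuation pr n 1≤n
      ... | zero , m , e , p∤m , _ = contradiction (subst (p ℕ.∣_) (trans e (ℕ.*-identityˡ m)) p∣n) p∤m
      ... | suc k , m , e , p∤m , 1≤m = subst Dichotomy (sym e) (cases (χ-cases p))
        where
        m∣n : m ℕ.∣ n
        m∣n = divides (p ℕ.^ suc k) e
        m<n : m ℕ.< n
        m<n = ℕ.≤∧≢⇒< (ℕ.∣⇒≤ m∣n) (λ m≡n → p∤m (subst (p ℕ.∣_) (sym m≡n) p∣n))
        dm : Dichotomy m
        dm = rec′ m<n
          where
          rec′ : m ℕ.< n → Dichotomy m
          rec′ lt = go m (rec lt) 1≤m (Unit-∣ m∣n u)
        cases : _ → Dichotomy (p ℕ.^ suc k ℕ.* m)
        cases (inj₁ z) = contradiction z (χ-unit p (Unit-∣ p∣n u))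
        cases (inj₂ (_ , inj₁ χp)) = power-split pr 1≤m p∤m χp dm (suc k)
        cases (inj₂ (_ , inj₂ χp)) = power-inert pr 1≤m p∤m χp dm (suc k)

-- Abundance of norms in the class of 1

module LowerBound
  (q K N C : ℕ) .{{_ : NonZero q}} (K≡ : K ≡ 6 ℕ.* q) (C≡ : C ≡ N ℕ.* (q ℕ.* K ℕ.* (q ℕ.* K))) (0<N : 0 ℕ.< N)
  (G : ℕ → ℤ) (G≥0 : ∀ n → 1 ℕ.≤ n → + 0 ≤ G n)
  (G-norm : ∀ x y → + (x ℕ.* x ℕ.+ N ℕ.* (y ℕ.* y)) ≈ + 1 [ + q ] →
      1 ℕ.≤ x ℕ.* x ℕ.+ N ℕ.* (y ℕ.* y) → + 1 ≤ G (x ℕ.* x ℕ.+ N ℕ.* (y ℕ.* y)))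
  where

  H : ℕ → ℤ
  H Z = ∑ Z G

  H-mono : ∀ {A B} → A ℕ.≤ B → H A ≤ H B
  H-mono {A} {B} A≤B = ℤ.≤-trans (ℤ.≤-trans (ℤ.≤-reflexive (sym (ℤ.+-identityʳ (H A)))) (ℤ.+-monoʳ-≤ (H A) tail≥0))
      (ℤ.≤-reflexive (trans (sym (∑-++ A (B ℕ.∸ A) G)) (cong H (ℕ.m+[n∸m]≡n A≤B))))
    where
    tail≥0 : + 0 ≤ ∑ (B ℕ.∸ A) (λ i → G (A ℕ.+ i))
    tail≥0 = ℤ.≤-trans (ℤ.≤-reflexive (sym (∑-zero (B ℕ.∸ A) {λ _ → + 0} λ _ _ _ → refl)))
        (∑-≤ (B ℕ.∸ A) λ i 1≤i _ → G≥0 (A ℕ.+ i) (ℕ.≤-trans 1≤i (ℕ.m≤n+m i A)))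

  H-step : ∀ {A t} → A ℕ.< t → + 1 ≤ G t → H A + + 1 ≤ H t
  H-step {A} {suc t} (s≤s A≤t) G≥1 = ℤ.+-mono-≤ (H-mono A≤t) G≥1

  x : ℕ → ℕ
  x i = 1 ℕ.+ q ℕ.* (C ℕ.+ i)

  -- For j ≤ K these norms ≡ 1 (mod q) lie between the squares of x i and x (suc i).
  t : ℕ → ℕ → ℕ
  t i j = x i ℕ.* x i ℕ.+ N ℕ.* (q ℕ.* j ℕ.* (q ℕ.* j))

  t-≈ : ∀ i j → + t i j ≈ + 1 [ + q ]
  t-≈ i j = step (+ k) (trans (cong +_ (lem q (C ℕ.+ i) N j)) (cong (λ s → + 1 + s) (ℤ.pos-* k q)))
    where
    k = (2 ℕ.* (C ℕ.+ i) ℕ.+ q ℕ.* ((C ℕ.+ i) ℕ.* (C ℕ.+ i))) ℕ.+ N ℕ.* (q ℕ.* (j ℕ.* j))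
    lem : ∀ q c N j → (1 ℕ.+ q ℕ.* c) ℕ.* (1 ℕ.+ q ℕ.* c) ℕ.+ N ℕ.* (q ℕ.* j ℕ.* (q ℕ.* j)) ≡
        1 ℕ.+ ((2 ℕ.* c ℕ.+ q ℕ.* (c ℕ.* c)) ℕ.+ N ℕ.* (q ℕ.* (j ℕ.* j))) ℕ.* q
    lem = solveℕ

  t-G : ∀ i j → + 1 ≤ G (t i j)
  t-G i j = G-norm (x i) (q ℕ.* j) (t-≈ i j) (s≤s z≤n)

  t-< : ∀ i j → t i j ℕ.< t i (suc j)
  t-< i j = ℕ.+-monoʳ-< (x i ℕ.* x i) (ℕ.*-monoʳ-< N {{ℕ.>-nonZero 0<N}} (ℕ.*-mono-< lt lt))
    where
    lt : q ℕ.* j ℕ.< q ℕ.* suc j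
    lt = ℕ.*-monoʳ-< q (ℕ.n<1+n j)

  row : ∀ {A} i j → A ℕ.< t i 0 → H A + + suc j ≤ H (t i j)
  row i zero    A<t = H-step A<t (t-G i 0)
  row {A} i (suc j) A<t = ℤ.≤-trans
      (ℤ.≤-trans (ℤ.≤-reflexive (lem (H A) (+ suc j))) (ℤ.+-monoˡ-≤ (+ 1) (row i j A<t)))
      (H-step (t-< i j) (t-G i (suc j)))
    where
    lem : ∀ a j → a + (+ 1 + j) ≡ a + j + + 1
    lem = solve-∀

  -- A row spreads over N(qK)² = C above its square, while the next square exceeds the present one
  -- by more than `x i`. Starting at 1 + qC ensures C < `x i`, so rows do not overlap.
  t-next : ∀ i → t i K ℕ.< t (suc i) 0
  t-next i = begin-strict
    t i K                                     ≡⟨ cong (x i ℕ.* x i ℕ.+_) (sym C≡) ⟩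
    x i ℕ.* x i ℕ.+ C                         <⟨ ℕ.+-monoʳ-< (x i ℕ.* x i) C<x ⟩
    x i ℕ.* x i ℕ.+ x i                       ≤⟨ ℕ.+-monoʳ-≤ (x i ℕ.* x i) (ℕ.m≤n*m (x i) q) ⟩
    x i ℕ.* x i ℕ.+ q ℕ.* x i                 ≤⟨ ℕ.m≤m+n _ _ ⟩
    x i ℕ.* x i ℕ.+ q ℕ.* x i ℕ.+ (q ℕ.* x i ℕ.+ q ℕ.* q ℕ.+ N ℕ.* (q ℕ.* 0 ℕ.* (q ℕ.* 0))) ≡⟨
        lem q (C ℕ.+ i) (N ℕ.* (q ℕ.* 0 ℕ.* (q ℕ.* 0))) ⟩
    (1 ℕ.+ q ℕ.* suc (C ℕ.+ i)) ℕ.* (1 ℕ.+ q ℕ.* suc (C ℕ.+ i)) ℕ.+ N ℕ.* (q ℕ.* 0 ℕ.* (q ℕ.* 0)) ≡⟨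
        cong (λ s → (1 ℕ.+ q ℕ.* s) ℕ.* (1 ℕ.+ q ℕ.* s) ℕ.+ N ℕ.* (q ℕ.* 0 ℕ.* (q ℕ.* 0))) (sym (ℕ.+-suc C i)) ⟩
    t (suc i) 0                               ∎
    where
    open ℕ.≤-Reasoning
    C<x : C ℕ.< x i
    C<x = s≤s (ℕ.≤-trans (ℕ.m≤m+n C i) (ℕ.m≤n*m (C ℕ.+ i) q))
    lem : ∀ q c z → (1 ℕ.+ q ℕ.* c) ℕ.* (1 ℕ.+ q ℕ.* c) ℕ.+ q ℕ.* (1 ℕ.+ q ℕ.* c) ℕ.+
        (q ℕ.* (1 ℕ.+ q ℕ.* c) ℕ.+ q ℕ.* q ℕ.+ z) ≡ (1 ℕ.+ q ℕ.* suc c) ℕ.* (1 ℕ.+ q ℕ.* suc c) ℕ.+ z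
    lem = solveℕ

  rows : ∀ i → + (suc i ℕ.* suc K) ≤ H (t i K)
  rows zero    = ℤ.≤-trans (ℤ.≤-reflexive (trans (cong +_ (ℕ.*-identityˡ (suc K))) (sym (ℤ.+-identityˡ (+ suc K)))))
      (row 0 K (s≤s z≤n))
  rows (suc i) = ℤ.≤-trans (ℤ.≤-reflexive (cong +_ (ℕ.+-comm (suc K) (suc i ℕ.* suc K))))
      (ℤ.≤-trans (ℤ.+-monoˡ-≤ (+ suc K) (rows i)) (row (suc i) K (t-next i)))

  Y = x (suc C)

  -- There are C + 1 rows of K + 1 norms below Y², where Y = 1 + q(2C + 1). With K = 6q their number
  -- (C + 1)(6q + 1) exceeds 3Y by 3q + C - 2, which is positive.
  H-large : + (3 ℕ.* Y) < H (Y ℕ.* Y)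
  H-large = ℤ.<-≤-trans (+<+ count) (ℤ.≤-trans (rows C) (H-mono (ℕ.<⇒≤ (subst (t C K ℕ.<_) zeros (t-next C)))))
    where
    zeros : t (suc C) 0 ≡ Y ℕ.* Y
    zeros = trans (cong (λ s → Y ℕ.* Y ℕ.+ N ℕ.* (s ℕ.* s)) (ℕ.*-zeroʳ q))
        (trans (cong (Y ℕ.* Y ℕ.+_) (ℕ.*-zeroʳ N)) (ℕ.+-identityʳ _))
    lem : ∀ C q → 3 ℕ.* (1 ℕ.+ q ℕ.* (C ℕ.+ suc C)) ℕ.+ (3 ℕ.* q ℕ.+ suc C) ≡ 3 ℕ.+ suc C ℕ.* suc (6 ℕ.* q)
    lem = solveℕ
    4≤q : 4 ℕ.≤ 3 ℕ.* q ℕ.+ suc C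
    4≤q = ℕ.+-mono-≤ (ℕ.*-monoʳ-≤ 3 (ℕ.>-nonZero⁻¹ q)) (s≤s z≤n)
    count : 3 ℕ.* Y ℕ.< suc C ℕ.* suc K
    count = subst (λ k → 3 ℕ.* Y ℕ.< suc C ℕ.* suc k) (sym K≡)
        (ℕ.+-cancelˡ-< 3 _ _ (ℕ.≤-trans (ℕ.≤-reflexive (lem′ (3 ℕ.* Y)))
        (ℕ.≤-trans (ℕ.+-monoʳ-≤ (3 ℕ.* Y) 4≤q) (ℕ.≤-reflexive (lem C q)))))
      where
      lem′ : ∀ y → suc (3 ℕ.+ y) ≡ y ℕ.+ 4
      lem′ = solveℕ


abstract
  norms-abundant : ∀ q N .{{_ : NonZero q}} → 0 ℕ.< N → (G : ℕ → ℤ) → (∀ n → 1 ℕ.≤ n → + 0 ≤ G n) →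
    (∀ x y → + (x ℕ.* x ℕ.+ N ℕ.* (y ℕ.* y)) ≈ + 1 [ + q ] →
        1 ℕ.≤ x ℕ.* x ℕ.+ N ℕ.* (y ℕ.* y) → + 1 ≤ G (x ℕ.* x ℕ.+ N ℕ.* (y ℕ.* y))) →
    ∃[ Y ] 1 ℕ.≤ Y × + (3 ℕ.* Y) < ∑ (Y ℕ.* Y) G
  norms-abundant q N 0<N G G≥0 G-norm = Y , s≤s z≤n , H-large
    where open LowerBound q (6 ℕ.* q) N (N ℕ.* (q ℕ.* (6 ℕ.* q) ℕ.* (q ℕ.* (6 ℕ.* q)))) refl refl 0<N G G≥0 G-norm

-- The Kronecker symbol of -N and split numbers in residue classes

1≉0[2] : ¬ + 1 ≈ + 0 [ + 2 ]
1≉0[2] e with ≈0⇒≡0 {+ 1} {2} (s≤s (s≤s z≤n)) e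
... | ()

Unit-argˡ : ∀ {n a b} → Unit n (a * b) → Unit n a
Unit-argˡ {n} {a} {b} u = Unit-swap (Unit-factorˡ {a} {b} (Unit-swap u))

Unit-argʳ : ∀ {n a b} → Unit n (a * b) → Unit n b
Unit-argʳ {n} {a} {b} u = Unit-swap (Unit-factorʳ {a} {b} (Unit-swap u))

Unit⇒coprime : ∀ {m n} → Unit (+ m) (+ n) → Coprime.Coprime m n
Unit⇒coprime {m} {n} (unit b (step k e)) {d} (divides x refl , divides y refl) =
    ℕ.∣1⇒≡1 (Signed.∣⇒∣ᵤ {+ d} {+ 1} (Signed.divides (+ y * b - k * + x) eq))
  where
  lem : ∀ x y d b k → (y * d) * b ≡ + 1 + k * (x * d) → + 1 ≡ (y * b - k * x) * d
  lem x y d b k e = trans (lem₁ k x d) (trans (cong (_- k * (x * d)) (sym e)) (lem₂ x y d b k))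
    where
    lem₁ : ∀ k x d → + 1 ≡ + 1 + k * (x * d) - k * (x * d)
    lem₁ = solve-∀
    lem₂ : ∀ x y d b k → (y * d) * b - k * (x * d) ≡ (y * b - k * x) * d
    lem₂ = solve-∀
  eq : + 1 ≡ (+ y * b - k * + x) * + d
  eq = lem (+ x) (+ y) (+ d) b k (trans (cong (_* b) (sym (ℤ.pos-* y d)))
      (trans e (cong (λ t → + 1 + k * t) (ℤ.pos-* x d))))

abstract
  Unit? : ∀ m n → Dec (Unit (+ m) (+ n))
  Unit? m n with Coprime.coprime? m n
  ... | yes c = yes (coprime⇒Unit c)
  ... | no ¬c = no (¬c ∘ Unit⇒coprime)

≈⇒∣ : ∀ {p x} → + x ≈ + 0 [ + p ] → p ℕ.∣ x
≈⇒∣ {p} {x} (step k e) = Signed.∣⇒∣ᵤ {+ p} {+ x} (Signed.divides k (trans e (ℤ.+-identityˡ _)))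

∣⇒≈ : ∀ {p x} → p ℕ.∣ x → + x ≈ + 0 [ + p ]
∣⇒≈ {p} (divides k refl) = step (+ k) (trans (ℤ.pos-* k p) (sym (ℤ.+-identityˡ _)))

⌊odd/2⌋ : ∀ h → ℕ.⌊ odd h /2⌋ ≡ h
⌊odd/2⌋ zero    = refl
⌊odd/2⌋ (suc h) = cong suc (trans (cong ℕ.⌊_/2⌋ (ℕ.+-suc h (h ℕ.+ 0))) (⌊odd/2⌋ h))

+-cancelʳ-< : ∀ {x y} z → x + z < y + z → x < y
+-cancelʳ-< {x} {y} z lt = subst₂ _<_ (lem x z) (lem y z) (ℤ.+-monoˡ-< (- z) lt)
  where
  lem : ∀ x z → x + z + - z ≡ x
  lem = solve-∀

-- The substitute for a prime m ≡ a modulo q with (-N/m) = 1. The square s² does no harm because s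
-- becomes the border entry of the ternary form.
RootInClass : ℕ → ℤ → ℤ → Set
RootInClass N a q = ∃[ m ] ∃[ s ] ∃[ b ] 1 ℕ.≤ m × + m * (+ s * + s) ≈ a [ q ] × b * b ≈ - + N [ + m ]

module Kronecker (N q : ℕ) (0<N : 0 ℕ.< N) (q≡8N : q ≡ 8 ℕ.* N) where

  open Character (character N 0<N) using () renaming (multiplicative to J-⊙; periodic to J-periodic)

  private
    +q≡8N : + q ≡ + 8 * + N
    +q≡8N = trans (cong +_ q≡8N) (ℤ.pos-* 8 N)

    +q : + q ≡ + 2 * (+ 4 * + N)
    +q = trans +q≡8N (lem (+ N))
      where
      lem : ∀ n → + 8 * n ≡ + 2 * (+ 4 * n)
      lem = solve-∀

  Unit-q⇒2 : ∀ {x} → Unit (+ q) x → Unit (+ 2) x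
  Unit-q⇒2 {x} u = Unit-factorˡ {+ 2} {+ 4 * + N} (subst (λ m → Unit m x) +q u)

  Unit-q⇒N : ∀ {x} → Unit (+ q) x → Unit (+ N) x
  Unit-q⇒N {x} u = Unit-factorʳ {+ 8} {+ N} (subst (λ m → Unit m x) +q≡8N u)

  Unit-q⇒-N : ∀ {x} → Unit (+ q) x → Unit (- + N) x
  Unit-q⇒-N u = Unit-swap (subst (Unit _) (ℤ.-1*i≡-i (+ N)) (Unit-* (Unit-σ Sign.-) (Unit-swap (Unit-q⇒N u))))

  odd-Unit : ∀ {h} → Unit (+ N) (+ odd h) → Unit (+ q) (+ odd h)
  odd-Unit {h} u = Unit-swap (subst (Unit (+ odd h)) (sym +q≡8N) (Unit-* unit-8 (Unit-swap u)))
    where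
    unit-8 : Unit (+ odd h) (+ 8)
    unit-8 = Unit-* {+ odd h} {+ 2} {+ 4} (Unit-2 h) (Unit-* {+ odd h} {+ 2} {+ 2} (Unit-2 h) (Unit-2 h))

  2-Unit[2] : ¬ Unit (+ 2) (+ 2)
  2-Unit[2] (unit b e) = 1≉0[2] (≈-trans (≈-sym e) (step b (lem b)))
    where
    lem : ∀ b → + 2 * b ≡ + 0 + b * + 2
    lem = solve-∀

  abstract
    Unit-odd : ∀ {n} → Unit (+ q) (+ n) → ∃[ h ] n ≡ odd h
    Unit-odd {n} u with parity n
    ... | h , inj₂ e = h , e
    ... | h , inj₁ e = contradiction
        (Unit-argˡ {+ 2} {+ 2} {+ h} (subst (Unit (+ 2)) (trans (cong +_ e) (ℤ.pos-* 2 h)) (Unit-q⇒2 u))) 2-Unit[2]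

  -- The symbol (-N/n), extended by 0 to n not prime to 8N.
  χ : ℕ → ℤ
  χ n with Unit? q n
  ... | yes _ = σ (J ℕ.⌊ n /2⌋ (- + N))
  ... | no _  = + 0

  χ-odd : ∀ h → Unit (+ q) (+ odd h) → χ (odd h) ≡ σ (J h (- + N))
  χ-odd h u with Unit? q (odd h)
  ... | yes _ = cong (λ t → σ (J t (- + N))) (⌊odd/2⌋ h)
  ... | no ¬u = contradiction u ¬u

  χ-zero : ∀ n → ¬ Unit (+ q) (+ n) → χ n ≡ + 0
  χ-zero n ¬u with Unit? q n
  ... | yes u = contradiction u ¬u
  ... | no _  = refl

  σ-± : ∀ s → σ s ≡ + 1 ⊎ σ s ≡ - + 1
  σ-± Sign.+ = inj₁ refl
  σ-± Sign.- = inj₂ refl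

  χ-cases : ∀ n → χ n ≡ + 0 ⊎ Unit (+ q) (+ n) × (χ n ≡ + 1 ⊎ χ n ≡ - + 1)
  χ-cases n with Unit? q n
  ... | yes u = inj₂ (u , σ-± _)
  ... | no _  = inj₁ refl

  χ-unit : ∀ n → Unit (+ q) (+ n) → χ n ≢ + 0
  χ-unit n u e with Unit-odd u
  ... | h , refl with J h (- + N) | χ-odd h u
  ... | Sign.+ | e′ = contradiction (trans (sym e′) e) λ ()
  ... | Sign.- | e′ = contradiction (trans (sym e′) e) λ ()

  χ-* : ∀ m n → χ (m ℕ.* n) ≡ χ m * χ n
  χ-* m n with Unit? q m | Unit? q n
  ... | no ¬u | _ = χ-zero (m ℕ.* n) (¬u ∘ Unit-argˡ {+ q} {+ m} {+ n} ∘ subst (Unit (+ q)) (ℤ.pos-* m n))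
  ... | yes _ | no ¬v = trans (χ-zero (m ℕ.* n)
      (¬v ∘ Unit-argʳ {+ q} {+ m} {+ n} ∘ subst (Unit (+ q)) (ℤ.pos-* m n)))
      (sym (ℤ.*-zeroʳ (σ (J ℕ.⌊ m /2⌋ (- + N)))))
  ... | yes u | yes v with Unit-odd u | Unit-odd v
  ... | h , refl | g , refl = begin
    χ (odd h ℕ.* odd g)                                ≡⟨ cong χ (sym (odd-⊙ h g)) ⟩
    χ (odd (h ⊙ g))                                    ≡⟨
        χ-odd (h ⊙ g) (subst (Unit (+ q)) (sym (+odd-⊙ h g)) (Unit-* u v)) ⟩
    σ (J (h ⊙ g) (- + N))                              ≡⟨ cong σ (J-⊙ h g (Unit-q⇒-N u) (Unit-q⇒-N v)) ⟩
    σ (J h (- + N) Sign.* J g (- + N))                 ≡⟨ σ-* (J h (- + N)) (J g (- + N)) ⟩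
    σ (J h (- + N)) * σ (J g (- + N))                  ≡⟨
        sym (cong₂ (λ s t → σ (J s (- + N)) * σ (J t (- + N))) (⌊odd/2⌋ h) (⌊odd/2⌋ g)) ⟩
    σ (J ℕ.⌊ odd h /2⌋ (- + N)) * σ (J ℕ.⌊ odd g /2⌋ (- + N)) ∎
    where open ≡-Reasoning

  instance
    q-nonZero : NonZero q
    q-nonZero = ℕ.>-nonZero (subst (0 ℕ.<_) (sym q≡8N) (ℕ.*-mono-≤ (s≤s (z≤n {7})) 0<N))

  χ-shift : ∀ r k → χ (r ℕ.+ k ℕ.* q) ≡ χ r
  χ-shift r k = cases (Unit? q r)
    where
    shift≈ : + (r ℕ.+ k ℕ.* q) ≈ + r [ + q ]
    shift≈ = step (+ k) (cong (λ t → + r + t) (ℤ.pos-* k q))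
    lem : ∀ h k → odd h ℕ.+ k ℕ.* q ≡ odd (h ℕ.+ 4 ℕ.* (N ℕ.* k))
    lem h k = trans (cong (λ t → odd h ℕ.+ k ℕ.* t) q≡8N) (lem′ h k N)
      where
      lem′ : ∀ h k N → suc (2 ℕ.* h) ℕ.+ k ℕ.* (8 ℕ.* N) ≡ suc (2 ℕ.* (h ℕ.+ 4 ℕ.* (N ℕ.* k)))
      lem′ = solveℕ
    cases : Dec (Unit (+ q) (+ r)) → χ (r ℕ.+ k ℕ.* q) ≡ χ r
    cases (no ¬u) = trans (χ-zero _ (¬u ∘ Unit-cong shift≈)) (sym (χ-zero r ¬u))
    cases (yes u) with Unit-odd u
    ... | h , refl = trans (cong χ (lem h k))
        (trans (χ-odd (h ℕ.+ 4 ℕ.* (N ℕ.* k))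
        (subst (λ t → Unit (+ q) (+ t)) (lem h k) (Unit-cong (≈-sym shift≈) u)))
      (trans (cong σ (trans (cong (λ t → J (h ℕ.+ 4 ℕ.* (t ℕ.* k)) (- + N)) (sym (ℤ.∣-i∣≡∣i∣ (+ N))))
          (J-periodic h k (Unit-q⇒-N u)))) (sym (χ-odd h u))))

  χ-mod : ∀ m n → m ℕ.% q ≡ n ℕ.% q → χ m ≡ χ n
  χ-mod m n e = trans (self m) (trans (cong χ e) (sym (self n)))
    where
    self : ∀ m → χ m ≡ χ (m ℕ.% q)
    self m = trans (cong χ (ℕ.m≡m%n+[m/n]*n m q)) (χ-shift (m ℕ.% q) (m ℕ./ q))

  σ≡ : ∀ {s t} → σ s ≡ σ t → s ≡ t
  σ≡ {Sign.+} {Sign.+} _ = refl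
  σ≡ {Sign.-} {Sign.-} _ = refl

  χ-prime : ∀ {p} s → χ p ≡ σ s → ∃[ h ] p ≡ odd h × Unit (+ odd h) (- + N) × J h (- + N) ≡ s
  χ-prime {p} s e with χ-cases p
  ... | inj₁ z = contradiction (trans (sym z) e) (0≢σ s)
    where
    0≢σ : ∀ s → + 0 ≢ σ s
    0≢σ Sign.+ ()
    0≢σ Sign.- ()
  ... | inj₂ (u , _) with Unit-odd u
  ... | h , refl = h , refl , Unit-swap (Unit-q⇒-N u) , σ≡ (trans (sym (χ-odd h u)) e)

  abstract
    root : ∀ {p} → Prime p → χ p ≡ + 1 → ∃[ b ] b * b ≈ - + N [ + p ]
    root pr e with χ-prime Sign.+ e
    ... | h , refl , u , Jh = Legendre.sqrt h pr u Jh

  -- If y were invertible modulo p, then -N would be the square of x/y and have symbol +. So p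
  -- divides y, and then x².
  inert : ∀ {p x y} → Prime p → χ p ≡ - + 1 → p ℕ.∣ x ℕ.* x ℕ.+ N ℕ.* (y ℕ.* y) → p ℕ.∣ x × p ℕ.∣ y
  inert {p} {x} {y} pr e p∣ with χ-prime Sign.- e
  ... | h , refl , u , Jh = p∣x , p∣y
    where
    norm≈0 : + x * + x + + N * (+ y * + y) ≈ + 0 [ + p ]
    norm≈0 = ≈-trans (≈-reflexive (sym
        (cong₂ _+_ (ℤ.pos-* x x) (trans (ℤ.pos-* N (y ℕ.* y)) (cong (+ N *_) (ℤ.pos-* y y)))))) (∣⇒≈ p∣)
    p∣y : p ℕ.∣ y
    p∣y with OddPrime.zero-or-Unit h pr (+ y)
    ... | inj₁ z = ≈⇒∣ z
    ... | inj₂ (unit z yz≈1) = contradiction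
        (trans (sym Jh) (trans (J-cong {h} (≈-sym square))
        (J-□ {h} (Unit-argˡ {+ odd h} {+ x * z} {+ x * z} (Unit-cong (≈-sym square) u))))) λ ()
      where
      lem : ∀ x y z N → (x * z) * (x * z) ≡ z * z * (x * x + N * (y * y)) + - N * ((y * z) * (y * z))
      lem = solve-∀
      lem₂ : ∀ z N → z * z * + 0 + - N * (+ 1 * + 1) ≡ - N
      lem₂ = solve-∀
      square : (+ x * z) * (+ x * z) ≈ - + N [ + odd h ]
      square = ≈-trans (≈-reflexive (lem (+ x) (+ y) z (+ N)))
          (≈-trans (≈-+ (≈-*ˡ (z * z) norm≈0) (≈-*ˡ (- + N) (≈-* yz≈1 yz≈1))) (≈-reflexive (lem₂ z (+ N))))
    p∣x : p ℕ.∣ x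
    p∣x with euclidsLemma x x pr (ℕ.∣m+n∣m⇒∣n (subst (p ℕ.∣_) (ℕ.+-comm (x ℕ.* x) _) p∣)
        (ℕ.∣n⇒∣m*n N (ℕ.∣m⇒∣m*n y p∣y)))
    ... | inj₁ d = d
    ... | inj₂ d = d

  open Divisors χ χ-*

  -- A new split prime p is joined to m by the Chinese remainder theorem. If p already divides m,
  -- lifting a root to p² is avoided by moving p into the square part.
  Split⇒root : ∀ {n} → Split n → ∃[ m ] ∃[ s ] ∃[ b ] n ≡ m ℕ.* (s ℕ.* s) × b * b ≈ - + N [ + m ]
  Split⇒root one = 1 , 1 , + 0 , refl , step (+ N) (lem (+ N))
    where
    lem : ∀ n → + 0 * + 0 ≡ - n + n * + 1
    lem = solve-∀
  Split⇒root (square {p} sp) with Split⇒root sp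
  ... | m , s , b , refl , e = m , p ℕ.* s , b , lem p m s , e
    where
    lem : ∀ p m s → p ℕ.* (p ℕ.* (m ℕ.* (s ℕ.* s))) ≡ m ℕ.* (p ℕ.* s ℕ.* (p ℕ.* s))
    lem = solveℕ
  Split⇒root (split {p} pr χp sp) with Split⇒root sp
  ... | m , s , b , refl , e with p ℕ.∣? m
  -- Here p m s² = k (ps)², and the root modulo m = kp is also one modulo k.
  ... | yes (divides k refl) = k , p ℕ.* s , b , lem p k s , ≈-factor {a = + p} {+ k}
      (trans (ℤ.pos-* k p) (ℤ.*-comm (+ k) (+ p))) e
    where
    lem : ∀ p k s → p ℕ.* (k ℕ.* p ℕ.* (s ℕ.* s)) ≡ k ℕ.* (p ℕ.* s ℕ.* (p ℕ.* s))
    lem = solveℕ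
    ≈-factor : ∀ {x y m a b} → m ≡ a * b → x ≈ y [ m ] → x ≈ y [ b ]
    ≈-factor {y = y} {a = a} {b} refl (step k e) =
        step (k * a) (trans e (cong (λ t → y + t) (sym (ℤ.*-assoc k a b))))
  ... | no p∤m = p ℕ.* m , s , b′ , sym (ℕ.*-assoc p m (s ℕ.* s)) , step (N₁ * v + N₂ * u)
      (trans final (cong (λ t → - + N + (N₁ * v + N₂ * u) * t) (sym (ℤ.pos-* p m))))
    where
    r = proj₁ (root pr χp)
    rr : r * r ≈ - + N [ + p ]
    rr = proj₂ (root pr χp)
    unitm : Unit (+ p) (+ m)
    unitm = coprime⇒Unit (prime∤⇒coprime pr p∤m)
    u = inverse unitm
    v = - _≈_[_].multiple (product unitm)
    bezout : + m * u + + p * v ≡ + 1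
    bezout = trans (cong (_+ + p * v) (_≈_[_].shift (product unitm))) (lem (_≈_[_].multiple (product unitm)) (+ p))
      where
      lem : ∀ k p → + 1 + k * p + p * - k ≡ + 1
      lem = solve-∀
    -- As mu + pv = 1, this is r modulo p and b modulo m.
    b′ = r * (+ m * u) + b * (+ p * v)
    b′≈b : b′ ≈ b [ + m ]
    b′≈b = step (r * u - b * u) (trans (lem r b (+ m * u) (+ p * v))
        (trans (cong (λ t → b * t + (r * (+ m * u) - b * (+ m * u))) bezout) (lem₂ b r (+ m) u)))
      where
      lem : ∀ r b x y → r * x + b * y ≡ b * (x + y) + (r * x - b * x)
      lem = solve-∀
      lem₂ : ∀ b r m u → b * + 1 + (r * (m * u) - b * (m * u)) ≡ b + (r * u - b * u) * m
      lem₂ = solve-∀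
    b′≈r : b′ ≈ r [ + p ]
    b′≈r = step (b * v - r * v) (trans (lem r b (+ m * u) (+ p * v))
        (trans (cong (λ t → r * t + (b * (+ p * v) - r * (+ p * v))) bezout) (lem₂ r b (+ p) v)))
      where
      lem : ∀ r b x y → r * x + b * y ≡ r * (x + y) + (b * y - r * y)
      lem = solve-∀
      lem₂ : ∀ r b p v → r * + 1 + (b * (p * v) - r * (p * v)) ≡ r + (b * v - r * v) * p
      lem₂ = solve-∀
    modm : b′ * b′ ≈ - + N [ + m ]
    modm = ≈-trans (≈-* b′≈b b′≈b) e
    modp : b′ * b′ ≈ - + N [ + p ]
    modp = ≈-trans (≈-* b′≈r b′≈r) rr
    N₁ = _≈_[_].multiple modm
    N₂ = _≈_[_].multiple modp
    final : b′ * b′ ≡ - + N + (N₁ * v + N₂ * u) * (+ p * + m)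
    final = trans (lem₁ (b′ * b′) (- + N)) (trans (cong (λ t → - + N + (b′ * b′ - - + N) * t) (sym bezout))
      (trans (cong (λ t → - + N + t) (trans (ℤ.*-distribˡ-+ (b′ * b′ - - + N) (+ m * u) (+ p * v))
          (cong₂ (λ s t → (s - - + N) * (+ m * u) + (t - - + N) * (+ p * v)) (_≈_[_].shift modp)
          (_≈_[_].shift modm)))) (lem₂ (- + N) N₁ N₂ u v (+ p) (+ m))))
      where
      lem₁ : ∀ x n → x ≡ n + (x - n) * + 1
      lem₁ = solve-∀
      lem₂ : ∀ n N₁ N₂ u v p m → n + ((n + N₂ * p - n) * (m * u) + (n + N₁ * m - n) * (p * v)) ≡
          n + (N₁ * v + N₂ * u) * (p * m)
      lem₂ = solve-∀

  open Hyperbola q χ χ-cases χ-* χ-mod hiding (root)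
  open Dichotomy q N χ-cases χ-unit inert hiding (dichotomy)

  abstract
    dichotomy : ∀ n → 1 ℕ.≤ n → Unit (+ q) (+ n) → Dichotomy n
    dichotomy = Dichotomy.dichotomy q N χ-cases χ-unit inert

  divisorSum≡σχ : ∀ X n → 1 ℕ.≤ n → n ℕ.≤ X → divisorSum X n ≡ σχ n
  divisorSum≡σχ X n 1≤n n≤X = trans (∑-cong X λ d 1≤d _ → cofactor d 1≤d (d ℕ.∣? n))
      (∑-truncate _ n≤X λ d n<d → trans
          (cong (_* χ d) (⟦⟧-no (d ℕ.∣? n) (λ d∣n → ℕ.<⇒≱ n<d (ℕ.∣⇒≤ {{ℕ.>-nonZero 1≤n}} d∣n)))) (ℤ.*-zeroˡ (χ d)))
    where
    cofactor : ∀ d → 1 ℕ.≤ d → (p : Dec (d ℕ.∣ n)) → ∑ X (λ e → ⟦ d ℕ.* e ℕ.≟ n ⟧ * χ d) ≡ ⟦ p ⟧ * χ d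
    cofactor d 1≤d (no d∤n) = trans (∑-zero X λ e _ _ →
        trans (cong (_* χ d) (⟦⟧-no (d ℕ.* e ℕ.≟ n) λ { refl → d∤n (ℕ.m∣m*n e) })) (ℤ.*-zeroˡ (χ d)))
        (sym (ℤ.*-zeroˡ (χ d)))
    cofactor d 1≤d (yes (divides k refl)) =
        trans (∑-ext X λ e → cong (_* χ d) (⟦⟧-cong (d ℕ.* e ℕ.≟ k ℕ.* d) (k ℕ.≟ e)
        (λ eq → sym (ℕ.*-cancelˡ-≡ e k d (trans eq (ℕ.*-comm k d)))) (λ { refl → ℕ.*-comm d k })))
        (trans (∑-δ X k (λ _ → χ d) (pos k 1≤n)) (cong (_* χ d) (⟦⟧-yes (k ℕ.≤? X) (ℕ.≤-trans (ℕ.m≤m*n k d) n≤X))))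
      where
      instance _ = ℕ.>-nonZero 1≤d
      pos : ∀ k → 1 ℕ.≤ k ℕ.* d → 1 ℕ.≤ k
      pos (suc k) _ = s≤s z≤n

  private
    G : ℕ → ℤ
    G n = class 1 n * σχ n

    class1⇒Unit : ∀ n → n ℕ.% q ≡ 1 ℕ.% q → Unit (+ q) (+ n)
    class1⇒Unit n e = Unit-cong (≈-sym (%⇒≈ n 1 e)) Unit-1

    G≥0 : ∀ n → 1 ℕ.≤ n → + 0 ≤ G n
    G≥0 n 1≤n with n ℕ.% q ℕ.≟ 1 ℕ.% q
    ... | no _ = ℤ.≤-reflexive (sym (ℤ.*-zeroˡ (σχ n)))
    ... | yes e with dichotomy n 1≤n (class1⇒Unit n e)
    ... | inj₁ (z , _) = ℤ.≤-reflexive (sym (trans (ℤ.*-identityˡ (σχ n)) z))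
    ... | inj₂ (≥1 , _) = ℤ.≤-trans (+≤+ z≤n) (ℤ.≤-trans ≥1 (ℤ.≤-reflexive (sym (ℤ.*-identityˡ (σχ n)))))

    G≥1 : ∀ n → 1 ℕ.≤ n → + n ≈ + 1 [ + q ] → Norm n → + 1 ≤ G n
    G≥1 n 1≤n n≈1 nm with n ℕ.% q ℕ.≟ 1 ℕ.% q
    ... | no ≢ = contradiction (≈⇒% n 1 n≈1) ≢
    ... | yes e with dichotomy n 1≤n (class1⇒Unit n e)
    ... | inj₁ (_ , ¬nm) = contradiction nm ¬nm
    ... | inj₂ (≥1 , _) = ℤ.≤-trans ≥1 (ℤ.≤-reflexive (sym (ℤ.*-identityˡ (σχ n))))

    abundant : ∃[ Y ] 1 ℕ.≤ Y × + (3 ℕ.* Y) < ∑ (Y ℕ.* Y) G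
    abundant = norms-abundant q N 0<N G G≥0 (λ x y n≈1 1≤n →
        G≥1 _ 1≤n n≈1 (x , y , 1 , ℕ.*-identityʳ _ , λ pr r∣1 →
        contradiction (subst Prime (ℕ.∣1⇒≡1 r∣1) pr) ¬prime[1]))

  class-Split : ∀ a → χ a ≡ + 1 → ∃[ n ] 1 ℕ.≤ n × + n ≈ + a [ + q ] × Split n
  class-Split a χa = from abundant
    where
    from : (∃[ Y ] 1 ℕ.≤ Y × + (3 ℕ.* Y) < ∑ (Y ℕ.* Y) G) → ∃[ n ] 1 ℕ.≤ n × + n ≈ + a [ + q ] × Split n
    from (Y , 1≤Y , large) = found (∑-positive X _ positive)
      where
      X = Y ℕ.* Y
      1∈class : χ 1 ≡ + 1
      1∈class = χ-odd 0 Unit-1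
      classSum1 : classSum X 1 ≡ ∑ X G
      classSum1 = ∑-cong X λ n 1≤n n≤X → cong (class 1 n *_) (divisorSum≡σχ X n 1≤n n≤X)
      positive : + 0 < classSum X a
      positive = +-cancelʳ-< {+ 0} {classSum X a} (+ (3 ℕ.* Y))
          (ℤ.<-≤-trans (subst₂ _<_ (sym (ℤ.+-identityˡ (+ (3 ℕ.* Y)))) (sym classSum1) large)
          (classSum-close Y 1≤Y 1 a 1∈class χa))
      found : (∃[ n ] 1 ℕ.≤ n × n ℕ.≤ X × + 0 < class a n * divisorSum X n) → ∃[ n ] 1 ℕ.≤ n × + n ≈ + a [ + q ] ×
          Split n
      found (n , 1≤n , n≤X , 0<) with n ℕ.% q ℕ.≟ a ℕ.% q
      ... | no _ = contradiction (subst (+ 0 <_) (ℤ.*-zeroˡ (divisorSum X n)) 0<) (ℤ.<-irrefl refl)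
      ... | yes e with dichotomy n 1≤n unit-n
        where
        unit-n : Unit (+ q) (+ n)
        unit-n with χ-cases n
        ... | inj₂ (u , _) = u
        ... | inj₁ z = contradiction (trans (sym z) (trans (χ-mod n a e) χa)) λ ()
      ... | inj₂ (_ , sp) = n , 1≤n , %⇒≈ n a e , sp
      ... | inj₁ (z , _) = contradiction
          (subst (+ 0 <_) (trans (ℤ.*-identityˡ _) (trans (divisorSum≡σχ X n 1≤n n≤X) z)) 0<) (ℤ.<-irrefl refl)

  class-root : ∀ g → Unit (+ N) (+ odd g) → J g (- + N) ≡ Sign.+ →
              RootInClass N (+ odd g) (+ q)
  class-root g u Jg = from (class-Split (odd g) (trans (χ-odd g (odd-Unit {g} u)) (cong σ Jg)))
    where
    pos : ∀ m {t} → 1 ℕ.≤ m ℕ.* t → 1 ℕ.≤ m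
    pos (suc m) _ = s≤s z≤n
    decompose : ∀ {n} → 1 ℕ.≤ n → + n ≈ + odd g [ + q ] →
        (∃[ m ] ∃[ s ] ∃[ b ] n ≡ m ℕ.* (s ℕ.* s) × b * b ≈ - + N [ + m ]) → RootInClass N (+ odd g) (+ q)
    decompose 1≤n n≈ (m , s , b , refl , e) =
      m , s , b , pos m 1≤n , ≈-trans
          (≈-reflexive (sym (trans (ℤ.pos-* m (s ℕ.* s)) (cong (+ m *_) (ℤ.pos-* s s))))) n≈ , e
    from : (∃[ n ] 1 ℕ.≤ n × + n ≈ + odd g [ + q ] × Split n) → RootInClass N (+ odd g) (+ q)
    from (n , 1≤n , n≈ , sp) = decompose 1≤n n≈ (Split⇒root sp)

abstract
  class-root : ∀ N g → 0 ℕ.< N → Unit (+ N) (+ odd g) → J g (- + N) ≡ Sign.+ →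
              RootInClass N (+ odd g) (+ 8 * + N)
  class-root N g 0<N u Jg = subst (λ q → RootInClass N (+ odd g) q) (ℤ.pos-* 8 N)
                              (Kronecker.class-root N (8 ℕ.* N) 0<N refl g u Jg)

-- Selling reduction of ternary forms

-- The number of spanning trees of K₄ with edge weights a = 01, b = 02, c = 03, d = 12, e = 13, f = 23.
trees : ℕ → ℕ → ℕ → ℕ → ℕ → ℕ → ℕ
trees a b c d e f =
  (b ℕ.* c ℕ.* (d ℕ.+ e) ℕ.+ b ℕ.* e ℕ.* (d ℕ.+ f) ℕ.+ b ℕ.* f ℕ.* d ℕ.+ c ℕ.* d ℕ.* e ℕ.+ c ℕ.* f ℕ.* (d ℕ.+ e))
      ℕ.+
  a ℕ.* (b ℕ.* c ℕ.+ b ℕ.* e ℕ.+ b ℕ.* f ℕ.+ c ℕ.* d ℕ.+ c ℕ.* f ℕ.+ d ℕ.* e ℕ.+ d ℕ.* f ℕ.+ e ℕ.* f)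

-- Write the determinant as A + aB. If B ≥ 1, then a ≤ aB is bounded by it. If B = 0, then A
-- vanishes too, being part of the expansion of B(d + e + f), and the determinant would be 0.
edge-≤ : ∀ a b c d e f {k} → trees a b c d e f ≡ suc k → a ℕ.≤ suc k
edge-≤ a b c d e f {k} eq with b ℕ.* c ℕ.+ b ℕ.* e ℕ.+ b ℕ.* f ℕ.+ c ℕ.* d ℕ.+ c ℕ.* f ℕ.+ d ℕ.* e ℕ.+ d ℕ.* f ℕ.+
    e ℕ.* f in B
... | suc B′ = ℕ.≤-trans (ℕ.m≤m*n a (suc B′)) (ℕ.≤-trans (ℕ.m≤n+m _ _) (ℕ.≤-reflexive eq))
... | zero = contradiction (trans (sym (cong₂ ℕ._+_ A≡0 (ℕ.*-zeroʳ a))) eq) λ ()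
  where
  lem : ∀ b c d e f →
    (b ℕ.* c ℕ.+ b ℕ.* e ℕ.+ b ℕ.* f ℕ.+ c ℕ.* d ℕ.+ c ℕ.* f ℕ.+ d ℕ.* e ℕ.+ d ℕ.* f ℕ.+ e ℕ.* f) ℕ.*
        (d ℕ.+ e ℕ.+ f) ≡
    (b ℕ.* c ℕ.* (d ℕ.+ e) ℕ.+ b ℕ.* e ℕ.* (d ℕ.+ f) ℕ.+ b ℕ.* f ℕ.* d ℕ.+ c ℕ.* d ℕ.* e ℕ.+ c ℕ.* f ℕ.* (d ℕ.+ e))
        ℕ.+
    (b ℕ.* c ℕ.* f ℕ.+ b ℕ.* e ℕ.* e ℕ.+ b ℕ.* f ℕ.* (e ℕ.+ f) ℕ.+ c ℕ.* d ℕ.* (d ℕ.+ f) ℕ.+ c ℕ.* f ℕ.* f ℕ.+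
        (d ℕ.* e ℕ.+ d ℕ.* f ℕ.+ e ℕ.* f) ℕ.* (d ℕ.+ e ℕ.+ f))
  lem = solveℕ
  A≡0 : b ℕ.* c ℕ.* (d ℕ.+ e) ℕ.+ b ℕ.* e ℕ.* (d ℕ.+ f) ℕ.+ b ℕ.* f ℕ.* d ℕ.+ c ℕ.* d ℕ.* e ℕ.+ c ℕ.* f ℕ.*
      (d ℕ.+ e) ≡ 0
  A≡0 = ℕ.m+n≡0⇒m≡0 _ (trans (sym (lem b c d e f)) (cong (ℕ._* (d ℕ.+ e ℕ.+ f)) B))

infixl 6 _⊕_

_⊕_ : Vec ℕ 6 → Vec ℕ 6 → Vec ℕ 6
_⊕_ = zipWith ℕ._+_

infixl 7 _⊛_

_⊛_ : ℕ → Vec ℕ 6 → Vec ℕ 6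
k ⊛ v = map (k ℕ.*_) v

δ : Fin 6 → Vec ℕ 6
δ 0F = 1 ∷ 0 ∷ 0 ∷ 0 ∷ 0 ∷ 0 ∷ []
δ 1F = 0 ∷ 1 ∷ 0 ∷ 0 ∷ 0 ∷ 0 ∷ []
δ 2F = 0 ∷ 0 ∷ 1 ∷ 0 ∷ 0 ∷ 0 ∷ []
δ 3F = 0 ∷ 0 ∷ 0 ∷ 1 ∷ 0 ∷ 0 ∷ []
δ 4F = 0 ∷ 0 ∷ 0 ∷ 0 ∷ 1 ∷ 0 ∷ []
δ 5F = 0 ∷ 0 ∷ 0 ∷ 0 ∷ 0 ∷ 1 ∷ []

-- The sides are listed so that the difference along the third is the sum of the differences along
-- the first two.
triangle : Fin 4 → Fin 6 × Fin 6 × Fin 6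
triangle 0F = 0F , 3F , 1F
triangle 1F = 0F , 4F , 2F
triangle 2F = 1F , 5F , 2F
triangle 3F = 3F , 5F , 4F

-- The form is then `diagonal k` in the differences along the three edges.
Tree : ℕ → Vec ℕ 6 → Set
Tree k p = ∃[ i ] ∃[ j ] ∃[ l ] p ≡ δ i ⊕ δ j ⊕ k ⊛ δ l

-- A triangle with a pendant edge also has three spanning trees. As one side is the sum of the other
-- two, its form is `hexagonal`.
Unicyclic : Vec ℕ 6 → Set
Unicyclic p = ∃[ t ] ∃[ m ] p ≡ δ (proj₁ (triangle t)) ⊕ δ (proj₁ (proj₂ (triangle t))) ⊕ δ
    (proj₂ (proj₂ (triangle t))) ⊕ δ m

_≟ᵛ_ : (p r : Vec ℕ 6) → Dec (p ≡ r)
_≟ᵛ_ = Vec.≡-dec ℕ._≟_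

Tree? : ∀ k p → Dec (Tree k p)
Tree? k p = Fin.any? λ i → Fin.any? λ j → Fin.any? λ l → p ≟ᵛ (δ i ⊕ δ j ⊕ k ⊛ δ l)

Unicyclic? : ∀ p → Dec (Unicyclic p)
Unicyclic? p = Fin.any? λ t → Fin.any? λ m → p ≟ᵛ _

Bounded : ℕ → (ℕ → ℕ → ℕ → ℕ → ℕ → ℕ → Set) → Set
Bounded n P = ∀ {a} → a ℕ.< n → ∀ {b} → b ℕ.< n → ∀ {c} → c ℕ.< n → ∀ {d} → d ℕ.< n → ∀ {e} → e ℕ.< n → ∀ {f} →
    f ℕ.< n → P a b c d e f

Bounded? : ∀ n {P} → (∀ a b c d e f → Dec (P a b c d e f)) → Dec (Bounded n P)
Bounded? n P? = ℕ.allUpTo? (λ a →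
    ℕ.allUpTo? (λ b → ℕ.allUpTo? (λ c → ℕ.allUpTo? (λ d → ℕ.allUpTo? (λ e → ℕ.allUpTo? (λ f → P? a b c d e f) n) n)
    n) n) n) n

abstract
  -- A finite check: `edges-≤` bounds every weight by the determinant, leaving 2^6 weight vectors
  -- here and 4^6 for determinant 3.
  trees-1 : Bounded 2 λ a b c d e f → trees a b c d e f ≡ 1 → Tree 1 (a ∷ b ∷ c ∷ d ∷ e ∷ f ∷ [])
  trees-1 = toWitness {a? = Bounded? 2 λ a b c d e f →
      (trees a b c d e f ℕ.≟ 1) →-dec Tree? 1 (a ∷ b ∷ c ∷ d ∷ e ∷ f ∷ [])} tt

  trees-3 : Bounded 4 λ a b c d e f → trees a b c d e f ≡ 3 →
      Tree 3 (a ∷ b ∷ c ∷ d ∷ e ∷ f ∷ []) ⊎ Unicyclic (a ∷ b ∷ c ∷ d ∷ e ∷ f ∷ [])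
  trees-3 = toWitness {a? = Bounded? 4 λ a b c d e f →
      (trees a b c d e f ℕ.≟ 3) →-dec
      (Tree? 3 (a ∷ b ∷ c ∷ d ∷ e ∷ f ∷ []) ⊎-dec Unicyclic? (a ∷ b ∷ c ∷ d ∷ e ∷ f ∷ []))} tt

Point : Set
Point = ℤ × ℤ × ℤ × ℤ

dot : Point → Point → ℤ
dot (p , q , r , s) (x , y , z , w) = p * x + q * y + r * z + s * w

-- Selling parameters -vᵢ·vⱼ of a superbase v₀ + v₁ + v₂ + v₃ = 0, on the edges 01, 02, 03, 12, 13, 23.
Weights : Set
Weights = ℤ × ℤ × ℤ × ℤ × ℤ × ℤ

-- Selling's formula for the norm of xv₀ + yv₁ + zv₂ + wv₃. Only differences enter, because v₀ + v₁
-- + v₂ + v₃ = 0.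
F : Weights → Point → ℤ
F (a , b , c , d , e , f) (x , y , z , w) =
  a * ((x - y) * (x - y)) + b * ((x - z) * (x - z)) + c * ((x - w) * (x - w)) +
  d * ((y - z) * (y - z)) + e * ((y - w) * (y - w)) + f * ((z - w) * (z - w))

-- By the matrix-tree theorem this is the Gram determinant of any three vectors of the superbase.
det : Weights → ℤ
det (a , b , c , d , e , f) =
  (b * c * (d + e) + b * e * (d + f) + b * f * d + c * d * e + c * f * (d + e)) +
  a * (b * c + b * e + b * f + c * d + c * f + d * e + d * f + e * f)

total : Weights → ℤ
total (a , b , c , d , e , f) = a + b + c + d + e + f

Positive : Weights → Set
Positive p = ∀ v → + 0 ≤ F p v

Represented : (ℤ → ℤ → ℤ → ℤ) → Weights → Set
Represented N p = ∃[ L ] ∃[ M ] ∃[ K ] (∀ v → F p v ≡ N (dot L v) (dot M v) (dot K v))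

record _⇝_ (p q : Weights) : Set where
  field
    forward  : Positive p → Positive q
    backward : ∀ N → Represented N q → Represented N p
    det-≡    : det q ≡ det p
open _⇝_

⇝-refl : ∀ {p} → p ⇝ p
⇝-refl = record { forward = λ P → P ; backward = λ _ R → R ; det-≡ = refl }

⇝-trans : ∀ {p q r} → p ⇝ q → q ⇝ r → p ⇝ r
⇝-trans A B = record
  { forward  = λ P → forward B (forward A P)
  ; backward = λ N R → backward A N (backward B N R)
  ; det-≡    = trans (det-≡ B) (det-≡ A)
  }

-- Each change of superbase acts on coordinates as an involution `s`; its transpose `s*` pulls back
-- the linear forms of a representation.
substitution : ∀ {p q} (s s* : Point → Point) → (∀ v → s (s v) ≡ v) → (∀ L v → dot L (s v) ≡ dot (s* L) v) →
               (∀ v → F p (s v) ≡ F q v) → det q ≡ det p → p ⇝ q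
substitution {p} {q} s s* involutive adjoint F≡ det≡ = record
  { forward  = λ P v → subst (+ 0 ≤_) (F≡ v) (P (s v))
  ; backward = λ { N (L , M , K , R) → s* L , s* M , s* K , λ v →
      trans (trans (cong (F p) (sym (involutive v))) (trans (F≡ (s v)) (R (s v))))
          (trans (cong₂ (λ x y → N x y (dot K (s v))) (adjoint L v) (adjoint M v))
          (cong (N (dot (s* L) v) (dot (s* M) v)) (adjoint K v))) }
  ; det-≡    = det≡
  }

swap01 swap12 swap23 flip : Weights → Weights
swap01 (a , b , c , d , e , f) = a , d , e , b , c , f
swap12 (a , b , c , d , e , f) = b , a , c , d , f , e
swap23 (a , b , c , d , e , f) = a , c , b , e , d , f
flip   (a , b , c , d , e , f) = d + e , b + d , c - d , - d , a + d , f + d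

⇝-swap01 : ∀ p → p ⇝ swap01 p
⇝-swap01 (a , b , c , d , e , f) =
    substitution (λ { (x , y , z , w) → y , x , z , w }) (λ { (x , y , z , w) → y , x , z , w }) (λ _ → refl)
  (λ { (p , q , r , s) (x , y , z , w) → adj p q r s x y z w }) (λ { (x , y , z , w) → F≡ a b c d e f x y z w })
      (det≡ a b c d e f)
  where
  adj : ∀ p q r s x y z w → p * y + q * x + r * z + s * w ≡ q * x + p * y + r * z + s * w
  adj = solve-∀
  F≡ : ∀ a b c d e f x y z w →
    a * ((y - x) * (y - x)) + b * ((y - z) * (y - z)) + c * ((y - w) * (y - w)) + d * ((x - z) * (x - z)) + e
        * ((x - w) * (x - w)) + f * ((z - w) * (z - w)) ≡
    a * ((x - y) * (x - y)) + d * ((x - z) * (x - z)) + e * ((x - w) * (x - w)) + b * ((y - z) * (y - z)) + c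
        * ((y - w) * (y - w)) + f * ((z - w) * (z - w))
  F≡ = solve-∀
  det≡ : ∀ a b c d e f →
    (d * e * (b + c) + d * c * (b + f) + d * f * b + e * b * c + e * f * (b + c)) + a
        * (d * e + d * c + d * f + e * b + e * f + b * c + b * f + c * f) ≡
    (b * c * (d + e) + b * e * (d + f) + b * f * d + c * d * e + c * f * (d + e)) + a
        * (b * c + b * e + b * f + c * d + c * f + d * e + d * f + e * f)
  det≡ = solve-∀

⇝-swap12 : ∀ p → p ⇝ swap12 p
⇝-swap12 (a , b , c , d , e , f) =
    substitution (λ { (x , y , z , w) → x , z , y , w }) (λ { (x , y , z , w) → x , z , y , w }) (λ _ → refl)
  (λ { (p , q , r , s) (x , y , z , w) → adj p q r s x y z w }) (λ { (x , y , z , w) → F≡ a b c d e f x y z w })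
      (det≡ a b c d e f)
  where
  adj : ∀ p q r s x y z w → p * x + q * z + r * y + s * w ≡ p * x + r * y + q * z + s * w
  adj = solve-∀
  F≡ : ∀ a b c d e f x y z w →
    a * ((x - z) * (x - z)) + b * ((x - y) * (x - y)) + c * ((x - w) * (x - w)) + d * ((z - y) * (z - y)) + e
        * ((z - w) * (z - w)) + f * ((y - w) * (y - w)) ≡
    b * ((x - y) * (x - y)) + a * ((x - z) * (x - z)) + c * ((x - w) * (x - w)) + d * ((y - z) * (y - z)) + f
        * ((y - w) * (y - w)) + e * ((z - w) * (z - w))
  F≡ = solve-∀
  det≡ : ∀ a b c d e f →
    (a * c * (d + f) + a * f * (d + e) + a * e * d + c * d * f + c * e * (d + f)) + b
        * (a * c + a * f + a * e + c * d + c * e + d * f + d * e + f * e) ≡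
    (b * c * (d + e) + b * e * (d + f) + b * f * d + c * d * e + c * f * (d + e)) + a
        * (b * c + b * e + b * f + c * d + c * f + d * e + d * f + e * f)
  det≡ = solve-∀

⇝-swap23 : ∀ p → p ⇝ swap23 p
⇝-swap23 (a , b , c , d , e , f) =
    substitution (λ { (x , y , z , w) → x , y , w , z }) (λ { (x , y , z , w) → x , y , w , z }) (λ _ → refl)
  (λ { (p , q , r , s) (x , y , z , w) → adj p q r s x y z w }) (λ { (x , y , z , w) → F≡ a b c d e f x y z w })
      (det≡ a b c d e f)
  where
  adj : ∀ p q r s x y z w → p * x + q * y + r * w + s * z ≡ p * x + q * y + s * z + r * w
  adj = solve-∀
  F≡ : ∀ a b c d e f x y z w →
    a * ((x - y) * (x - y)) + b * ((x - w) * (x - w)) + c * ((x - z) * (x - z)) + d * ((y - w) * (y - w)) + e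
        * ((y - z) * (y - z)) + f * ((w - z) * (w - z)) ≡
    a * ((x - y) * (x - y)) + c * ((x - z) * (x - z)) + b * ((x - w) * (x - w)) + e * ((y - z) * (y - z)) + d
        * ((y - w) * (y - w)) + f * ((z - w) * (z - w))
  F≡ = solve-∀
  det≡ : ∀ a b c d e f →
    (c * b * (e + d) + c * d * (e + f) + c * f * e + b * e * d + b * f * (e + d)) + a
        * (c * b + c * d + c * f + b * e + b * f + e * d + e * f + d * f) ≡
    (b * c * (d + e) + b * e * (d + f) + b * f * d + c * d * e + c * f * (d + e)) + a
        * (b * c + b * e + b * f + c * d + c * f + d * e + d * f + e * f)
  det≡ = solve-∀

-- The superbase (v₀ + v₁, -v₁, v₂, v₃ + v₁).
⇝-flip : ∀ p → p ⇝ flip p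
⇝-flip (a , b , c , d , e , f) = substitution (λ { (x , y , z , w) → x , x + w - y , z , w })
    (λ { (p , q , r , s) → p + q , - q , r , s + q })
  (λ { (x , y , z , w) → cong (λ t → x , t , z , w) (inv x y w) })
  (λ { (p , q , r , s) (x , y , z , w) → adj p q r s x y z w }) (λ { (x , y , z , w) → F≡ a b c d e f x y z w })
      (det≡ a b c d e f)
  where
  inv : ∀ x y w → x + w - (x + w - y) ≡ y
  inv = solve-∀
  adj : ∀ p q r s x y z w → p * x + q * (x + w - y) + r * z + s * w ≡ (p + q) * x + (- q) * y + r * z + (s + q) * w
  adj = solve-∀
  F≡ : ∀ a b c d e f x y z w →
    a * ((x - (x + w - y)) * (x - (x + w - y))) + b * ((x - z) * (x - z)) + c * ((x - w) * (x - w)) +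
    d * (((x + w - y) - z) * ((x + w - y) - z)) + e * (((x + w - y) - w) * ((x + w - y) - w)) + f
        * ((z - w) * (z - w)) ≡
    (d + e) * ((x - y) * (x - y)) + (b + d) * ((x - z) * (x - z)) + (c - d) * ((x - w) * (x - w)) +
    (- d) * ((y - z) * (y - z)) + (a + d) * ((y - w) * (y - w)) + (f + d) * ((z - w) * (z - w))
  F≡ = solve-∀
  det≡ : ∀ a b c d e f →
    ((b + d) * (c - d) * ((- d) + (a + d)) + (b + d) * (a + d) * ((- d) + (f + d)) + (b + d) * (f + d) * (- d)
        + (c - d) * (- d) * (a + d) + (c - d) * (f + d) * ((- d) + (a + d))) +
    (d + e) * ((b + d) * (c - d) + (b + d) * (a + d) + (b + d) * (f + d) + (c - d) * (- d) + (c - d) * (f + d)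
        + (- d) * (a + d) + (- d) * (f + d) + (a + d) * (f + d)) ≡
    (b * c * (d + e) + b * e * (d + f) + b * f * d + c * d * e + c * f * (d + e)) + a
        * (b * c + b * e + b * f + c * d + c * f + d * e + d * f + e * f)
  det≡ = solve-∀

-- A negative weight on the edge 12 makes the total drop, which is the measure of Selling's descent.
total-flip : ∀ p → total (flip p) ≡ total p + proj₁ (proj₂ (proj₂ (proj₂ p)))
total-flip (a , b , c , d , e , f) = lem a b c d e f
  where
  lem : ∀ a b c d e f → (d + e) + (b + d) + (c - d) + (- d) + (a + d) + (f + d) ≡ a + b + c + d + e + f + d
  lem = solve-∀

-- The values are the norms of the four superbase vectors, in which each edge is counted at both
-- ends. This shows that the total stays nonnegative.
2*total : ∀ p → + 2 * total p ≡
    F p (+ 1 , + 0 , + 0 , + 0) + F p (+ 0 , + 1 , + 0 , + 0) + (F p (+ 0 , + 0 , + 1 , + 0) + F p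
    (+ 0 , + 0 , + 0 , + 1))
2*total (a , b , c , d , e , f) = lem a b c d e f
  where
  lem : ∀ a b c d e f → + 2 * (a + b + c + d + e + f) ≡
    a * + 1 + b * + 1 + c * + 1 + d * + 0 + e * + 0 + f * + 0
        + (a * + 1 + b * + 0 + c * + 0 + d * + 1 + e * + 1 + f * + 0) +
    (a * + 0 + b * + 1 + c * + 0 + d * + 1 + e * + 0 + f * + 1
        + (a * + 0 + b * + 0 + c * + 1 + d * + 0 + e * + 1 + f * + 1))
  lem = solve-∀

total-nonneg : ∀ {p} → Positive p → + 0 ≤ total p
total-nonneg {p} P = ℤ.*-cancelˡ-≤-pos (+ 0) (total p) (+ 2)
    (ℤ.≤-trans (ℤ.+-mono-≤ (ℤ.+-mono-≤ (P (+ 1 , + 0 , + 0 , + 0)) (P (+ 0 , + 1 , + 0 , + 0)))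
    (ℤ.+-mono-≤ (P (+ 0 , + 0 , + 1 , + 0)) (P (+ 0 , + 0 , + 0 , + 1)))) (ℤ.≤-reflexive (sym (2*total p))))

Obtuse : Weights → Set
Obtuse (a , b , c , d , e , f) = (+ 0 ≤ a × + 0 ≤ b × + 0 ≤ c) × (+ 0 ≤ d × + 0 ≤ e × + 0 ≤ f)

12-edge : Weights → ℤ
12-edge (_ , _ , _ , d , _ , _) = d

-- Permuting the superbase brings a negative weight to the edge 12, the one on which `flip` acts.
acute-edge : ∀ p → Obtuse p ⊎ (∃[ q ] p ⇝ q × total q ≡ total p × 12-edge q < + 0)
acute-edge p@(a , b , c , d , e , f) with + 0 ℤ.≤? a | + 0 ℤ.≤? b | + 0 ℤ.≤? c | + 0 ℤ.≤? d | + 0 ℤ.≤? e | + 0 ℤ.≤?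
    f
... | yes 0≤a | yes 0≤b | yes 0≤c | yes 0≤d | yes 0≤e | yes 0≤f = inj₁ ((0≤a , 0≤b , 0≤c) , (0≤d , 0≤e , 0≤f))
... | no a<0 | _ | _ | _ | _ | _ =
    inj₂ (swap01 (swap12 p) , ⇝-trans (⇝-swap12 p) (⇝-swap01 _) , lem a b c d e f , ℤ.≰⇒> a<0)
  where
  lem : ∀ a b c d e f → b + d + f + a + c + e ≡ a + b + c + d + e + f
  lem = solve-∀
... | yes _ | no b<0 | _ | _ | _ | _ = inj₂ (swap01 p , ⇝-swap01 p , lem a b c d e f , ℤ.≰⇒> b<0)
  where
  lem : ∀ a b c d e f → a + d + e + b + c + f ≡ a + b + c + d + e + f
  lem = solve-∀
... | yes _ | yes _ | no c<0 | _ | _ | _ =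
    inj₂ (swap01 (swap23 p) , ⇝-trans (⇝-swap23 p) (⇝-swap01 _) , lem a b c d e f , ℤ.≰⇒> c<0)
  where
  lem : ∀ a b c d e f → a + e + d + c + b + f ≡ a + b + c + d + e + f
  lem = solve-∀
... | yes _ | yes _ | yes _ | no d<0 | _ | _ = inj₂ (p , ⇝-refl , refl , ℤ.≰⇒> d<0)
... | yes _ | yes _ | yes _ | yes _ | no e<0 | _ = inj₂ (swap23 p , ⇝-swap23 p , lem a b c d e f , ℤ.≰⇒> e<0)
  where
  lem : ∀ a b c d e f → a + c + b + e + d + f ≡ a + b + c + d + e + f
  lem = solve-∀
... | yes _ | yes _ | yes _ | yes _ | yes _ | no f<0 =
    inj₂ (swap23 (swap12 p) , ⇝-trans (⇝-swap12 p) (⇝-swap23 _) , lem a b c d e f , ℤ.≰⇒> f<0)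
  where
  lem : ∀ a b c d e f → b + c + a + f + d + e ≡ a + b + c + d + e + f
  lem = solve-∀

selling : ∀ p → Positive p → ∃[ q ] Obtuse q × p ⇝ q
selling p P = go p P (<-wellFounded ∣ total p ∣)
  where
  smaller : ∀ {x y} → + 0 ≤ x → x < y → ∣ x ∣ ℕ.< ∣ y ∣
  smaller (+≤+ _) (+<+ lt) = lt
  go : ∀ p → Positive p → Acc ℕ._<_ ∣ total p ∣ → ∃[ q ] Obtuse q × p ⇝ q
  go p P (acc rec) = step′ (acute-edge p)
    where
    step′ : _ → ∃[ q ] Obtuse q × p ⇝ q
    step′ (inj₁ o) = p , o , ⇝-refl
    step′ (inj₂ (q , p⇝q , t≡ , neg)) = finish (go (flip q) Q (rec (smaller (total-nonneg {flip q} Q) less)))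
      where
      p⇝ = ⇝-trans p⇝q (⇝-flip q)
      Q = forward p⇝ P
      less : total (flip q) < total p
      less = subst₂ _<_ (sym (total-flip q)) (trans (ℤ.+-identityʳ (total q)) t≡) (ℤ.+-monoʳ-< (total q) neg)
      finish : (∃[ r ] Obtuse r × flip q ⇝ r) → ∃[ r ] Obtuse r × p ⇝ r
      finish (r , o , ⇝r) = r , o , ⇝-trans p⇝ ⇝r

weights : Vec ℕ 6 → Weights
weights (a ∷ b ∷ c ∷ d ∷ e ∷ f ∷ []) = + a , + b , + c , + d , + e , + f

difference : Fin 6 → Point
difference 0F = + 1 , - + 1 , + 0 , + 0
difference 1F = + 1 , + 0 , - + 1 , + 0
difference 2F = + 1 , + 0 , + 0 , - + 1
difference 3F = + 0 , + 1 , - + 1 , + 0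
difference 4F = + 0 , + 1 , + 0 , - + 1
difference 5F = + 0 , + 0 , + 1 , - + 1

F-⊕ : ∀ p q v → F (weights (p ⊕ q)) v ≡ F (weights p) v + F (weights q) v
F-⊕ (a ∷ b ∷ c ∷ d ∷ e ∷ f ∷ []) (a′ ∷ b′ ∷ c′ ∷ d′ ∷ e′ ∷ f′ ∷ []) (x , y , z , w) =
  lem (+ a) (+ b) (+ c) (+ d) (+ e) (+ f) (+ a′) (+ b′) (+ c′) (+ d′) (+ e′) (+ f′) ((x - y) * (x - y))
      ((x - z) * (x - z)) ((x - w) * (x - w)) ((y - z) * (y - z)) ((y - w) * (y - w)) ((z - w) * (z - w))
  where
  lem : ∀ a b c d e f a′ b′ c′ d′ e′ f′ A B C D E G →
    (a + a′) * A + (b + b′) * B + (c + c′) * C + (d + d′) * D + (e + e′) * E + (f + f′) * G ≡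
    (a * A + b * B + c * C + d * D + e * E + f * G) + (a′ * A + b′ * B + c′ * C + d′ * D + e′ * E + f′ * G)
  lem = solve-∀

F-⊛ : ∀ k p v → F (weights (k ⊛ p)) v ≡ + k * F (weights p) v
F-⊛ k (a ∷ b ∷ c ∷ d ∷ e ∷ f ∷ []) (x , y , z , w) =
  trans (cong₂ _+_ (cong₂ _+_ (cong₂ _+_ (cong₂ _+_ (cong₂ _+_ (cast a A) (cast b B)) (cast c C)) (cast d D))
      (cast e E)) (cast f G))
    (lem (+ k) (+ a) (+ b) (+ c) (+ d) (+ e) (+ f) A B C D E G)
  where
  A = (x - y) * (x - y)
  B = (x - z) * (x - z)
  C = (x - w) * (x - w)
  D = (y - z) * (y - z)
  E = (y - w) * (y - w)
  G = (z - w) * (z - w)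
  cast : ∀ a A → + (k ℕ.* a) * A ≡ + k * + a * A
  cast a A = cong (_* A) (ℤ.pos-* k a)
  lem : ∀ k a b c d e f A B C D E G →
    k * a * A + k * b * B + k * c * C + k * d * D + k * e * E + k * f * G ≡
        k * (a * A + b * B + c * C + d * D + e * E + f * G)
  lem = solve-∀

F-δ : ∀ i v → F (weights (δ i)) v ≡ dot (difference i) v * dot (difference i) v
F-δ 0F (x , y , z , w) = lem x y z w
  where
  lem : ∀ x y z w → + 1 * ((x - y) * (x - y)) + + 0 * ((x - z) * (x - z)) + + 0 * ((x - w) * (x - w)) + + 0
      * ((y - z) * (y - z)) + + 0 * ((y - w) * (y - w)) + + 0 * ((z - w) * (z - w)) ≡
        (+ 1 * x + - + 1 * y + + 0 * z + + 0 * w) * (+ 1 * x + - + 1 * y + + 0 * z + + 0 * w)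
  lem = solve-∀
F-δ 1F (x , y , z , w) = lem x y z w
  where
  lem : ∀ x y z w → + 0 * ((x - y) * (x - y)) + + 1 * ((x - z) * (x - z)) + + 0 * ((x - w) * (x - w)) + + 0
      * ((y - z) * (y - z)) + + 0 * ((y - w) * (y - w)) + + 0 * ((z - w) * (z - w)) ≡
        (+ 1 * x + + 0 * y + - + 1 * z + + 0 * w) * (+ 1 * x + + 0 * y + - + 1 * z + + 0 * w)
  lem = solve-∀
F-δ 2F (x , y , z , w) = lem x y z w
  where
  lem : ∀ x y z w → + 0 * ((x - y) * (x - y)) + + 0 * ((x - z) * (x - z)) + + 1 * ((x - w) * (x - w)) + + 0
      * ((y - z) * (y - z)) + + 0 * ((y - w) * (y - w)) + + 0 * ((z - w) * (z - w)) ≡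
        (+ 1 * x + + 0 * y + + 0 * z + - + 1 * w) * (+ 1 * x + + 0 * y + + 0 * z + - + 1 * w)
  lem = solve-∀
F-δ 3F (x , y , z , w) = lem x y z w
  where
  lem : ∀ x y z w → + 0 * ((x - y) * (x - y)) + + 0 * ((x - z) * (x - z)) + + 0 * ((x - w) * (x - w)) + + 1
      * ((y - z) * (y - z)) + + 0 * ((y - w) * (y - w)) + + 0 * ((z - w) * (z - w)) ≡
        (+ 0 * x + + 1 * y + - + 1 * z + + 0 * w) * (+ 0 * x + + 1 * y + - + 1 * z + + 0 * w)
  lem = solve-∀
F-δ 4F (x , y , z , w) = lem x y z w
  where
  lem : ∀ x y z w → + 0 * ((x - y) * (x - y)) + + 0 * ((x - z) * (x - z)) + + 0 * ((x - w) * (x - w)) + + 0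
      * ((y - z) * (y - z)) + + 1 * ((y - w) * (y - w)) + + 0 * ((z - w) * (z - w)) ≡
        (+ 0 * x + + 1 * y + + 0 * z + - + 1 * w) * (+ 0 * x + + 1 * y + + 0 * z + - + 1 * w)
  lem = solve-∀
F-δ 5F (x , y , z , w) = lem x y z w
  where
  lem : ∀ x y z w → + 0 * ((x - y) * (x - y)) + + 0 * ((x - z) * (x - z)) + + 0 * ((x - w) * (x - w)) + + 0
      * ((y - z) * (y - z)) + + 0 * ((y - w) * (y - w)) + + 1 * ((z - w) * (z - w)) ≡
        (+ 0 * x + + 0 * y + + 1 * z + - + 1 * w) * (+ 0 * x + + 0 * y + + 1 * z + - + 1 * w)
  lem = solve-∀

diagonal : ℕ → ℤ → ℤ → ℤ → ℤ
diagonal k x y z = x * x + y * y + + k * (z * z)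

-- The norm form of ℤ ⊕ A₂, the second reduced class of determinant 3.
hexagonal : ℤ → ℤ → ℤ → ℤ
hexagonal x y z = x * x + + 2 * (y * y + y * z + z * z)

Tree⇒ : ∀ k p → Tree k p → Represented (diagonal k) (weights p)
Tree⇒ k _ (i , j , l , refl) = difference i , difference j , difference l , λ v →
  trans (F-⊕ (δ i ⊕ δ j) (k ⊛ δ l) v) (cong₂ _+_ (trans (F-⊕ (δ i) (δ j) v) (cong₂ _+_ (F-δ i v) (F-δ j v)))
      (trans (F-⊛ k (δ l) v) (cong (+ k *_) (F-δ l v))))

triangle-sum : ∀ t v → dot (difference (proj₂ (proj₂ (triangle t)))) v ≡
    dot (difference (proj₁ (triangle t))) v + dot (difference (proj₁ (proj₂ (triangle t)))) v
triangle-sum 0F (x , y , z , w) = lem x y z w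
  where
  lem : ∀ x y z w → + 1 * x + + 0 * y + - + 1 * z + + 0 * w ≡
      (+ 1 * x + - + 1 * y + + 0 * z + + 0 * w) + (+ 0 * x + + 1 * y + - + 1 * z + + 0 * w)
  lem = solve-∀
triangle-sum 1F (x , y , z , w) = lem x y z w
  where
  lem : ∀ x y z w → + 1 * x + + 0 * y + + 0 * z + - + 1 * w ≡
      (+ 1 * x + - + 1 * y + + 0 * z + + 0 * w) + (+ 0 * x + + 1 * y + + 0 * z + - + 1 * w)
  lem = solve-∀
triangle-sum 2F (x , y , z , w) = lem x y z w
  where
  lem : ∀ x y z w → + 1 * x + + 0 * y + + 0 * z + - + 1 * w ≡
      (+ 1 * x + + 0 * y + - + 1 * z + + 0 * w) + (+ 0 * x + + 0 * y + + 1 * z + - + 1 * w)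
  lem = solve-∀
triangle-sum 3F (x , y , z , w) = lem x y z w
  where
  lem : ∀ x y z w → + 0 * x + + 1 * y + + 0 * z + - + 1 * w ≡
      (+ 0 * x + + 1 * y + - + 1 * z + + 0 * w) + (+ 0 * x + + 0 * y + + 1 * z + - + 1 * w)
  lem = solve-∀

Unicyclic⇒ : ∀ p → Unicyclic p → Represented hexagonal (weights p)
Unicyclic⇒ _ (t , m , refl) = difference m , difference i , difference j , λ v →
  trans (F-⊕ (δ i ⊕ δ j ⊕ δ l) (δ m) v)
      (trans (cong₂ _+_ (trans (F-⊕ (δ i ⊕ δ j) (δ l) v)
      (cong₂ _+_ (trans (F-⊕ (δ i) (δ j) v) (cong₂ _+_ (F-δ i v) (F-δ j v)))
    (trans (F-δ l v) (cong₂ _*_ (triangle-sum t v) (triangle-sum t v))))) (F-δ m v))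
        (lem (dot (difference i) v) (dot (difference j) v) (dot (difference m) v)))
  where
  i = proj₁ (triangle t)
  j = proj₁ (proj₂ (triangle t))
  l = proj₂ (proj₂ (triangle t))
  lem : ∀ y z x → y * y + z * z + (y + z) * (y + z) + x * x ≡ x * x + + 2 * (y * y + y * z + z * z)
  lem = solve-∀

det-weights : ∀ a b c d e f → det (+ a , + b , + c , + d , + e , + f) ≡ + trees a b c d e f
det-weights a b c d e f = sym (cong₂ _+_
  (cong₂ _+_ (cong₂ _+_ (cong₂ _+_ (cong₂ _+_ (p₃ b c (d ℕ.+ e)) (p₃ b e (d ℕ.+ f))) (p₃ b f d)) (p₃ c d e))
      (p₃ c f (d ℕ.+ e)))
  (trans (ℤ.pos-* a _) (cong (+ a *_)
      (cong₂ _+_ (cong₂ _+_ (cong₂ _+_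
      (cong₂ _+_ (cong₂ _+_ (cong₂ _+_ (cong₂ _+_ (ℤ.pos-* b c) (ℤ.pos-* b e)) (ℤ.pos-* b f)) (ℤ.pos-* c d))
      (ℤ.pos-* c f)) (ℤ.pos-* d e)) (ℤ.pos-* d f)) (ℤ.pos-* e f)))))
  where
  p₃ : ∀ x y z → + (x ℕ.* y ℕ.* z) ≡ + x * + y * + z
  p₃ x y z = trans (ℤ.pos-* (x ℕ.* y) z) (cong (_* + z) (ℤ.pos-* x y))

-- `trees` is invariant under permutations of the four vertices, and these carry any edge to the
-- first place.
edges-≤ : ∀ a b c d e f {k} → trees a b c d e f ≡ suc k →
          a ℕ.< suc (suc k) × b ℕ.< suc (suc k) × c ℕ.< suc (suc k) × d ℕ.< suc (suc k) × e ℕ.< suc (suc k) ×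
              f ℕ.< suc (suc k)
edges-≤ a b c d e f eq = s≤s (edge-≤ a b c d e f eq) , s≤s (edge-≤ b a c d f e (trans (12↔ a b c d e f) eq)) , s≤s
    (edge-≤ c b a f e d (trans (13↔ a b c d e f) eq)) ,
  s≤s (edge-≤ d b f a e c (trans (02↔ a b c d e f) eq)) , s≤s (edge-≤ e f c d a b (trans (03↔ a b c d e f) eq)) ,
      s≤s (edge-≤ f b d c e a (trans (02,13↔ a b c d e f) eq))
  where
  12↔ : ∀ a b c d e f →
    (a ℕ.* c ℕ.* (d ℕ.+ f) ℕ.+ a ℕ.* f ℕ.* (d ℕ.+ e) ℕ.+ a ℕ.* e ℕ.* d ℕ.+ c ℕ.* d ℕ.* f ℕ.+ c ℕ.* e ℕ.* (d ℕ.+ f))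
        ℕ.+ b ℕ.* (a ℕ.* c ℕ.+ a ℕ.* f ℕ.+ a ℕ.* e ℕ.+ c ℕ.* d ℕ.+ c ℕ.* e ℕ.+ d ℕ.* f ℕ.+ d ℕ.* e ℕ.+ f ℕ.* e) ≡
        (b ℕ.* c ℕ.* (d ℕ.+ e) ℕ.+ b ℕ.* e ℕ.* (d ℕ.+ f) ℕ.+ b ℕ.* f ℕ.* d ℕ.+ c ℕ.* d ℕ.* e ℕ.+ c ℕ.* f ℕ.*
        (d ℕ.+ e)) ℕ.+ a ℕ.* (b ℕ.* c ℕ.+ b ℕ.* e ℕ.+ b ℕ.* f ℕ.+ c ℕ.* d ℕ.+ c ℕ.* f ℕ.+ d ℕ.* e ℕ.+ d ℕ.* f ℕ.+
        e ℕ.* f)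
  12↔ = solveℕ
  13↔ : ∀ a b c d e f →
    (b ℕ.* a ℕ.* (f ℕ.+ e) ℕ.+ b ℕ.* e ℕ.* (f ℕ.+ d) ℕ.+ b ℕ.* d ℕ.* f ℕ.+ a ℕ.* f ℕ.* e ℕ.+ a ℕ.* d ℕ.* (f ℕ.+ e))
        ℕ.+ c ℕ.* (b ℕ.* a ℕ.+ b ℕ.* e ℕ.+ b ℕ.* d ℕ.+ a ℕ.* f ℕ.+ a ℕ.* d ℕ.+ f ℕ.* e ℕ.+ f ℕ.* d ℕ.+ e ℕ.* d) ≡
        (b ℕ.* c ℕ.* (d ℕ.+ e) ℕ.+ b ℕ.* e ℕ.* (d ℕ.+ f) ℕ.+ b ℕ.* f ℕ.* d ℕ.+ c ℕ.* d ℕ.* e ℕ.+ c ℕ.* f ℕ.*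
        (d ℕ.+ e)) ℕ.+ a ℕ.* (b ℕ.* c ℕ.+ b ℕ.* e ℕ.+ b ℕ.* f ℕ.+ c ℕ.* d ℕ.+ c ℕ.* f ℕ.+ d ℕ.* e ℕ.+ d ℕ.* f ℕ.+
        e ℕ.* f)
  13↔ = solveℕ
  02↔ : ∀ a b c d e f →
    (b ℕ.* f ℕ.* (a ℕ.+ e) ℕ.+ b ℕ.* e ℕ.* (a ℕ.+ c) ℕ.+ b ℕ.* c ℕ.* a ℕ.+ f ℕ.* a ℕ.* e ℕ.+ f ℕ.* c ℕ.* (a ℕ.+ e))
        ℕ.+ d ℕ.* (b ℕ.* f ℕ.+ b ℕ.* e ℕ.+ b ℕ.* c ℕ.+ f ℕ.* a ℕ.+ f ℕ.* c ℕ.+ a ℕ.* e ℕ.+ a ℕ.* c ℕ.+ e ℕ.* c) ≡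
        (b ℕ.* c ℕ.* (d ℕ.+ e) ℕ.+ b ℕ.* e ℕ.* (d ℕ.+ f) ℕ.+ b ℕ.* f ℕ.* d ℕ.+ c ℕ.* d ℕ.* e ℕ.+ c ℕ.* f ℕ.*
        (d ℕ.+ e)) ℕ.+ a ℕ.* (b ℕ.* c ℕ.+ b ℕ.* e ℕ.+ b ℕ.* f ℕ.+ c ℕ.* d ℕ.+ c ℕ.* f ℕ.+ d ℕ.* e ℕ.+ d ℕ.* f ℕ.+
        e ℕ.* f)
  02↔ = solveℕ
  03↔ : ∀ a b c d e f →
    (f ℕ.* c ℕ.* (d ℕ.+ a) ℕ.+ f ℕ.* a ℕ.* (d ℕ.+ b) ℕ.+ f ℕ.* b ℕ.* d ℕ.+ c ℕ.* d ℕ.* a ℕ.+ c ℕ.* b ℕ.* (d ℕ.+ a))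
        ℕ.+ e ℕ.* (f ℕ.* c ℕ.+ f ℕ.* a ℕ.+ f ℕ.* b ℕ.+ c ℕ.* d ℕ.+ c ℕ.* b ℕ.+ d ℕ.* a ℕ.+ d ℕ.* b ℕ.+ a ℕ.* b) ≡
        (b ℕ.* c ℕ.* (d ℕ.+ e) ℕ.+ b ℕ.* e ℕ.* (d ℕ.+ f) ℕ.+ b ℕ.* f ℕ.* d ℕ.+ c ℕ.* d ℕ.* e ℕ.+ c ℕ.* f ℕ.*
        (d ℕ.+ e)) ℕ.+ a ℕ.* (b ℕ.* c ℕ.+ b ℕ.* e ℕ.+ b ℕ.* f ℕ.+ c ℕ.* d ℕ.+ c ℕ.* f ℕ.+ d ℕ.* e ℕ.+ d ℕ.* f ℕ.+
        e ℕ.* f)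
  03↔ = solveℕ
  02,13↔ : ∀ a b c d e f →
    (b ℕ.* d ℕ.* (c ℕ.+ e) ℕ.+ b ℕ.* e ℕ.* (c ℕ.+ a) ℕ.+ b ℕ.* a ℕ.* c ℕ.+ d ℕ.* c ℕ.* e ℕ.+ d ℕ.* a ℕ.* (c ℕ.+ e))
        ℕ.+ f ℕ.* (b ℕ.* d ℕ.+ b ℕ.* e ℕ.+ b ℕ.* a ℕ.+ d ℕ.* c ℕ.+ d ℕ.* a ℕ.+ c ℕ.* e ℕ.+ c ℕ.* a ℕ.+ e ℕ.* a) ≡
        (b ℕ.* c ℕ.* (d ℕ.+ e) ℕ.+ b ℕ.* e ℕ.* (d ℕ.+ f) ℕ.+ b ℕ.* f ℕ.* d ℕ.+ c ℕ.* d ℕ.* e ℕ.+ c ℕ.* f ℕ.*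
        (d ℕ.+ e)) ℕ.+ a ℕ.* (b ℕ.* c ℕ.+ b ℕ.* e ℕ.+ b ℕ.* f ℕ.+ c ℕ.* d ℕ.+ c ℕ.* f ℕ.+ d ℕ.* e ℕ.+ d ℕ.* f ℕ.+
        e ℕ.* f)
  02,13↔ = solveℕ

obtuse-1 : ∀ p → Obtuse p → det p ≡ + 1 → Represented (diagonal 1) p
obtuse-1 (+ a , + b , + c , + d , + e , + f) o D =
    Tree⇒ 1 (a ∷ b ∷ c ∷ d ∷ e ∷ f ∷ []) (use (edges-≤ a b c d e f eq))
  where
  eq : trees a b c d e f ≡ 1
  eq = ℤ.+-injective (trans (sym (det-weights a b c d e f)) D)
  use : _ → Tree 1 (a ∷ b ∷ c ∷ d ∷ e ∷ f ∷ [])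
  use (a< , b< , c< , d< , e< , f<) = trees-1 a< b< c< d< e< f< eq

obtuse-3 : ∀ p → Obtuse p → det p ≡ + 3 → Represented (diagonal 3) p ⊎ Represented hexagonal p
obtuse-3 (+ a , + b , + c , + d , + e , + f) o D = classify (use (edges-≤ a b c d e f eq))
  where
  p = a ∷ b ∷ c ∷ d ∷ e ∷ f ∷ []
  eq : trees a b c d e f ≡ 3
  eq = ℤ.+-injective (trans (sym (det-weights a b c d e f)) D)
  use : _ → Tree 3 p ⊎ Unicyclic p
  use (a< , b< , c< , d< , e< , f<) = trees-3 a< b< c< d< e< f< eq
  classify : Tree 3 p ⊎ Unicyclic p → Represented (diagonal 3) (weights p) ⊎ Represented hexagonal (weights p)
  classify (inj₁ t) = inj₁ (Tree⇒ 3 p t)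
  classify (inj₂ u) = inj₂ (Unicyclic⇒ p u)

abstract
  represented-1 : ∀ p → Positive p → det p ≡ + 1 → Represented (diagonal 1) p
  represented-1 p P D = from (selling p P)
    where
    from : (∃[ q ] Obtuse q × p ⇝ q) → Represented (diagonal 1) p
    from (q , o , p⇝q) = backward p⇝q (diagonal 1) (obtuse-1 q o (trans (det-≡ p⇝q) D))

  represented-3 : ∀ p → Positive p → det p ≡ + 3 → Represented (diagonal 3) p ⊎ Represented hexagonal p
  represented-3 p P D = from (selling p P)
    where
    from : (∃[ q ] Obtuse q × p ⇝ q) → Represented (diagonal 3) p ⊎ Represented hexagonal p
    from (q , o , p⇝q) = ⊎.map (backward p⇝q (diagonal 3)) (backward p⇝q hexagonal)
        (obtuse-3 q o (trans (det-≡ p⇝q) D))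

-- Bordered binary forms

trit : ∀ x → ∃[ u ] (x ≡ + 3 * u ⊎ x ≡ + 1 + + 3 * u ⊎ x ≡ - + 1 + + 3 * u)
trit x with centred 1 x
... | + 0 , _ , step k e = k , inj₁ (trans e (trans (ℤ.+-identityˡ _) (ℤ.*-comm k (+ 3))))
... | + 1 , _ , step k e = k , inj₂ (inj₁ (trans e (cong (λ t → + 1 + t) (ℤ.*-comm k (+ 3)))))
... | -[1+ 0 ] , _ , step k e = k , inj₂ (inj₂ (trans e (cong (λ t → - + 1 + t) (ℤ.*-comm k (+ 3)))))
... | + suc (suc _) , s≤s () , _
... | -[1+ suc _ ] , s≤s () , _

0≉1[3] : ¬ + 0 ≈ + 1 [ + 3 ]
0≉1[3] e with ≈0⇒≡0 {+ 1} {3} (s≤s (s≤s z≤n)) (≈-sym e)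
... | ()

2≉1[3] : ¬ + 2 ≈ + 1 [ + 3 ]
2≉1[3] (step k e) = 0≉1[3] (≈-sym (step k (lem (+ 2) k e)))
  where
  lem : ∀ x k → x ≡ + 1 + k * + 3 → x - + 1 ≡ + 0 + k * + 3
  lem _ k refl = lem′ k
    where
    lem′ : ∀ k → + 1 + k * + 3 - + 1 ≡ + 0 + k * + 3
    lem′ = solve-∀

square-mod-3 : ∀ x → x * x ≈ + 0 [ + 3 ] × (∃[ u ] x ≡ + 3 * u) ⊎ x * x ≈ + 1 [ + 3 ]
square-mod-3 x with trit x
... | u , inj₁ refl = inj₁ (step (+ 3 * u * u) (lem u) , u , refl)
  where
  lem : ∀ u → (+ 3 * u) * (+ 3 * u) ≡ + 0 + (+ 3 * u * u) * + 3
  lem = solve-∀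
... | u , inj₂ (inj₁ refl) = inj₂ (step (+ 2 * u + + 3 * u * u) (lem u))
  where
  lem : ∀ u → (+ 1 + + 3 * u) * (+ 1 + + 3 * u) ≡ + 1 + (+ 2 * u + + 3 * u * u) * + 3
  lem = solve-∀
... | u , inj₂ (inj₂ refl) = inj₂ (step (- (+ 2 * u) + + 3 * u * u) (lem u))
  where
  lem : ∀ u → (- + 1 + + 3 * u) * (- + 1 + + 3 * u) ≡ + 1 + (- (+ 2 * u) + + 3 * u * u) * + 3
  lem = solve-∀

half-≡ : ∀ {a b x y} → a + + 2 * x + b ≡ a + + 2 * y + b → x ≡ y
half-≡ {a} {b} {x} {y} e = ℤ.*-cancelˡ-≡ (+ 2) x y
    (trans (sym (lem a b x)) (trans (cong (λ t → t - a - b) e) (lem a b y)))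
  where
  lem : ∀ a b x → a + + 2 * x + b - a - b ≡ + 2 * x
  lem = solve-∀

-- Cauchy-Binet for the Gram matrix of two vectors.
diagonal-minor : ∀ k {a b r} x₁ y₁ z₁ x₂ y₂ z₂ → a ≡ diagonal k x₁ y₁ z₁ → b ≡ diagonal k x₂ y₂ z₂ →
  a + + 2 * r + b ≡ diagonal k (x₁ + x₂) (y₁ + y₂) (z₁ + z₂) →
  ∃[ x ] ∃[ y ] ∃[ z ] a * b - r * r ≡ x * x + + k * (y * y) + + k * (z * z)
diagonal-minor k {a} {b} {r} x₁ y₁ z₁ x₂ y₂ z₂ refl refl e =
    x₁ * y₂ - x₂ * y₁ , x₁ * z₂ - x₂ * z₁ , y₁ * z₂ - y₂ * z₁ ,
  trans (cong (λ r → a * b - r * r) r≡) (lem₂ (+ k) x₁ y₁ z₁ x₂ y₂ z₂)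
  where
  lem : ∀ k x₁ y₁ z₁ x₂ y₂ z₂ → (x₁ + x₂) * (x₁ + x₂) + (y₁ + y₂) * (y₁ + y₂) + k * ((z₁ + z₂) * (z₁ + z₂)) ≡
    (x₁ * x₁ + y₁ * y₁ + k * (z₁ * z₁)) + + 2 * (x₁ * x₂ + y₁ * y₂ + k * (z₁ * z₂))
        + (x₂ * x₂ + y₂ * y₂ + k * (z₂ * z₂))
  lem = solve-∀
  r≡ : r ≡ x₁ * x₂ + y₁ * y₂ + + k * (z₁ * z₂)
  r≡ = half-≡ {a} {b} (trans e (lem (+ k) x₁ y₁ z₁ x₂ y₂ z₂))
  lem₂ : ∀ k x₁ y₁ z₁ x₂ y₂ z₂ →
    (x₁ * x₁ + y₁ * y₁ + k * (z₁ * z₁)) * (x₂ * x₂ + y₂ * y₂ + k * (z₂ * z₂)) - (x₁ * x₂ + y₁ * y₂ + k * (z₁ * z₂))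
        * (x₁ * x₂ + y₁ * y₂ + k * (z₁ * z₂)) ≡
    (x₁ * y₂ - x₂ * y₁) * (x₁ * y₂ - x₂ * y₁) + k * ((x₁ * z₂ - x₂ * z₁) * (x₁ * z₂ - x₂ * z₁)) + k
        * ((y₁ * z₂ - y₂ * z₁) * (y₁ * z₂ - y₂ * z₁))
  lem₂ = solve-∀

-- Modulo 3 the hexagonal form is x² + 2(y - z)², so its binary minors are twice a square.
hexagonal-minor : ∀ {a b r} x₁ y₁ z₁ x₂ y₂ z₂ → a ≡ hexagonal x₁ y₁ z₁ → b ≡ hexagonal x₂ y₂ z₂ →
  a + + 2 * r + b ≡ hexagonal (x₁ + x₂) (y₁ + y₂) (z₁ + z₂) → ¬ a * b - r * r ≈ + 1 [ + 3 ]
hexagonal-minor {a} {b} {r} x₁ y₁ z₁ x₂ y₂ z₂ refl refl e minor≈1 = from (square-mod-3 W)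
  where
  W = x₁ * (y₂ - z₂) - x₂ * (y₁ - z₁)
  cross = x₁ * x₂ + + 2 * (y₁ * y₂ + z₁ * z₂) + (y₁ * z₂ + z₁ * y₂)
  lem : ∀ x₁ y₁ z₁ x₂ y₂ z₂ → (x₁ + x₂) * (x₁ + x₂) + + 2
      * ((y₁ + y₂) * (y₁ + y₂) + (y₁ + y₂) * (z₁ + z₂) + (z₁ + z₂) * (z₁ + z₂)) ≡
    (x₁ * x₁ + + 2 * (y₁ * y₁ + y₁ * z₁ + z₁ * z₁)) + + 2
        * (x₁ * x₂ + + 2 * (y₁ * y₂ + z₁ * z₂) + (y₁ * z₂ + z₁ * y₂))
        + (x₂ * x₂ + + 2 * (y₂ * y₂ + y₂ * z₂ + z₂ * z₂))
  lem = solve-∀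
  r≡ : r ≡ cross
  r≡ = half-≡ {a} {b} (trans e (lem x₁ y₁ z₁ x₂ y₂ z₂))
  V : ℤ
  V = + 2 * (y₁ * z₁) * (x₂ * x₂ + + 2 * ((y₂ - z₂) * (y₂ - z₂))) + + 2 * (y₂ * z₂)
      * (x₁ * x₁ + + 2 * ((y₁ - z₁) * (y₁ - z₁))) + + 12 * (y₁ * z₁ * (y₂ * z₂))
      - + 2 * ((x₁ * x₂ + + 2 * ((y₁ - z₁) * (y₂ - z₂))) * (y₁ * z₂ + z₁ * y₂)) - + 3
          * ((y₁ * z₂ + z₁ * y₂) * (y₁ * z₂ + z₁ * y₂))
  lem₂ : ∀ x₁ y₁ z₁ x₂ y₂ z₂ →
    (x₁ * x₁ + + 2 * (y₁ * y₁ + y₁ * z₁ + z₁ * z₁)) * (x₂ * x₂ + + 2 * (y₂ * y₂ + y₂ * z₂ + z₂ * z₂)) -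
    (x₁ * x₂ + + 2 * (y₁ * y₂ + z₁ * z₂) + (y₁ * z₂ + z₁ * y₂))
        * (x₁ * x₂ + + 2 * (y₁ * y₂ + z₁ * z₂) + (y₁ * z₂ + z₁ * y₂)) ≡
    + 2 * ((x₁ * (y₂ - z₂) - x₂ * (y₁ - z₁)) * (x₁ * (y₂ - z₂) - x₂ * (y₁ - z₁))) +
    (+ 2 * (y₁ * z₁) * (x₂ * x₂ + + 2 * ((y₂ - z₂) * (y₂ - z₂))) + + 2 * (y₂ * z₂)
        * (x₁ * x₁ + + 2 * ((y₁ - z₁) * (y₁ - z₁))) + + 12 * (y₁ * z₁ * (y₂ * z₂))
      - + 2 * ((x₁ * x₂ + + 2 * ((y₁ - z₁) * (y₂ - z₂))) * (y₁ * z₂ + z₁ * y₂)) - + 3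
          * ((y₁ * z₂ + z₁ * y₂) * (y₁ * z₂ + z₁ * y₂))) * + 3
  lem₂ = solve-∀
  2W²≈1 : + 2 * (W * W) ≈ + 1 [ + 3 ]
  2W²≈1 = ≈-trans (≈-sym (step V (trans (cong (λ r → a * b - r * r) r≡) (lem₂ x₁ y₁ z₁ x₂ y₂ z₂)))) minor≈1
  from : _ → ⊥
  from (inj₁ (W²≈0 , _)) = 0≉1[3] (≈-trans (≈-sym (≈-*ˡ (+ 2) W²≈0)) 2W²≈1)
  from (inj₂ W²≈1) = 2≉1[3] (≈-trans (≈-sym (≈-*ˡ (+ 2) W²≈1)) 2W²≈1)

0≤□ : ∀ x → + 0 ≤ x * x
0≤□ (+ n)    = subst (+ 0 ≤_) (ℤ.pos-* n n) (+≤+ z≤n)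
0≤□ -[1+ n ] = +≤+ z≤n

-- The form mx² + 2bxy + cy² + 2syz + tz².
module Ternary (m b c s t : ℤ) where

  -- Selling parameters of v₁, v₂, v₃ with Gram rows (m, b, 0), (b, c, s), (0, s, t), completed by
  -- v₀ = -v₁ - v₂ - v₃.
  p : Weights
  p = m + b , c + b + s , t + s , - b , + 0 , - s

  N = m * c - b * b

  det-p : det p ≡ t * N - m * (s * s)
  det-p = lem m b c s t
    where
    lem : ∀ m b c s t →
      ((c + b + s) * (t + s) * (- b + + 0) + (c + b + s) * + 0 * (- b + - s) + (c + b + s) * - s * - b + (t + s)
          * - b * + 0 + (t + s) * - s * (- b + + 0)) +
      (m + b) * ((c + b + s) * (t + s) + (c + b + s) * + 0 + (c + b + s) * - s + (t + s) * - b + (t + s) * - s + - b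
          * + 0 + - b * - s + + 0 * - s) ≡
      t * (m * c - b * b) - m * (s * s)
    lem = solve-∀

  F-p : ∀ w x y z → F p (w , x , y , z) ≡
      m * ((x - w) * (x - w)) + + 2 * b * ((x - w) * (y - w)) + c * ((y - w) * (y - w)) + + 2 * s
      * ((y - w) * (z - w)) + t * ((z - w) * (z - w))
  F-p w x y z = lem m b c s t w x y z
    where
    lem : ∀ m b c s t w x y z →
      (m + b) * ((w - x) * (w - x)) + (c + b + s) * ((w - y) * (w - y)) + (t + s) * ((w - z) * (w - z)) + (- b)
          * ((x - y) * (x - y)) + + 0 * ((x - z) * (x - z)) + (- s) * ((y - z) * (y - z)) ≡
      m * ((x - w) * (x - w)) + + 2 * b * ((x - w) * (y - w)) + c * ((y - w) * (y - w)) + + 2 * s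
          * ((y - w) * (z - w)) + t * ((z - w) * (z - w))
    lem = solve-∀

  0≤* : ∀ {x y} → + 0 ≤ x → + 0 ≤ y → + 0 ≤ x * y
  0≤* {+ m} {+ n} _ _ = subst (+ 0 ≤_) (ℤ.pos-* m n) (+≤+ z≤n)

  -- Two completions of squares, cleared of denominators: mN times the form is N(mx + by)² + (Ny +
  -- msz)² + m·det·z².
  positive-p : + 0 < m → + 0 < N → + 0 ≤ t * N - m * (s * s) → Positive p
  positive-p 0<m 0<N 0≤det (w , x , y , z) =
      cancel N 0<N (cancel m 0<m (subst (+ 0 ≤_)
      (trans (sym (lem m b c s t (x - w) (y - w) (z - w))) (cong (λ t → m * (N * t)) (sym (F-p w x y z))))
    (ℤ.+-mono-≤ (ℤ.+-mono-≤ (0≤* (ℤ.<⇒≤ 0<N) (0≤□ (m * (x - w) + b * (y - w))))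
        (0≤□ (N * (y - w) + m * s * (z - w)))) (0≤* (0≤* (ℤ.<⇒≤ 0<m) 0≤det) (0≤□ (z - w))))))
    where
    lem : ∀ m b c s t x y z →
      m * ((m * c - b * b) * (m * (x * x) + + 2 * b * (x * y) + c * (y * y) + + 2 * s * (y * z) + t * (z * z))) ≡
      (m * c - b * b) * ((m * x + b * y) * (m * x + b * y)) + ((m * c - b * b) * y + m * s * z)
          * ((m * c - b * b) * y + m * s * z) + m * (t * (m * c - b * b) - m * (s * s)) * (z * z)
    lem = solve-∀
    cancel : ∀ n {v} → + 0 < n → + 0 ≤ n * v → + 0 ≤ v
    cancel (+ suc n) {v} _ le = ℤ.*-cancelˡ-≤-pos (+ 0) v (+ suc n)
        (ℤ.≤-trans (ℤ.≤-reflexive (ℤ.*-zeroʳ (+ suc n))) le)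
    cancel (+ zero) (+<+ ()) _

  coord₁ coord₂ coord₃ : Point → ℤ
  coord₁ (_ , q , _ , _) = q
  coord₂ (_ , _ , r , _) = r
  coord₃ (_ , _ , _ , s) = s

  dot-1 : ∀ L → dot L (+ 0 , + 1 , + 0 , + 0) ≡ coord₁ L
  dot-1 (p , q , r , s) = lem p q r s
    where
    lem : ∀ p q r s → p * + 0 + q * + 1 + r * + 0 + s * + 0 ≡ q
    lem = solve-∀
  dot-2 : ∀ L → dot L (+ 0 , + 0 , + 1 , + 0) ≡ coord₂ L
  dot-2 (p , q , r , s) = lem p q r s
    where
    lem : ∀ p q r s → p * + 0 + q * + 0 + r * + 1 + s * + 0 ≡ r
    lem = solve-∀
  dot-3 : ∀ L → dot L (+ 0 , + 0 , + 0 , + 1) ≡ coord₃ L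
  dot-3 (p , q , r , s) = lem p q r s
    where
    lem : ∀ p q r s → p * + 0 + q * + 0 + r * + 0 + s * + 1 ≡ s
    lem = solve-∀
  dot-12 : ∀ L → dot L (+ 0 , + 1 , + 1 , + 0) ≡ coord₁ L + coord₂ L
  dot-12 (p , q , r , s) = lem p q r s
    where
    lem : ∀ p q r s → p * + 0 + q * + 1 + r * + 1 + s * + 0 ≡ q + r
    lem = solve-∀
  dot-23 : ∀ L → dot L (+ 0 , + 0 , + 1 , + 1) ≡ coord₂ L + coord₃ L
  dot-23 (p , q , r , s) = lem p q r s
    where
    lem : ∀ p q r s → p * + 0 + q * + 0 + r * + 1 + s * + 1 ≡ r + s
    lem = solve-∀

  F-1 : F p (+ 0 , + 1 , + 0 , + 0) ≡ m
  F-1 = trans (F-p (+ 0) (+ 1) (+ 0) (+ 0)) (lem m b c s t)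
    where
    lem : ∀ m b c s t → m * + 1 + + 2 * b * + 0 + c * + 0 + + 2 * s * + 0 + t * + 0 ≡ m
    lem = solve-∀
  F-2 : F p (+ 0 , + 0 , + 1 , + 0) ≡ c
  F-2 = trans (F-p (+ 0) (+ 0) (+ 1) (+ 0)) (lem m b c s t)
    where
    lem : ∀ m b c s t → m * + 0 + + 2 * b * + 0 + c * + 1 + + 2 * s * + 0 + t * + 0 ≡ c
    lem = solve-∀
  F-3 : F p (+ 0 , + 0 , + 0 , + 1) ≡ t
  F-3 = trans (F-p (+ 0) (+ 0) (+ 0) (+ 1)) (lem m b c s t)
    where
    lem : ∀ m b c s t → m * + 0 + + 2 * b * + 0 + c * + 0 + + 2 * s * + 0 + t * + 1 ≡ t
    lem = solve-∀
  F-12 : F p (+ 0 , + 1 , + 1 , + 0) ≡ m + + 2 * b + c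
  F-12 = trans (F-p (+ 0) (+ 1) (+ 1) (+ 0)) (lem m b c s t)
    where
    lem : ∀ m b c s t → m * + 1 + + 2 * b * + 1 + c * + 1 + + 2 * s * + 0 + t * + 0 ≡ m + + 2 * b + c
    lem = solve-∀
  F-23 : F p (+ 0 , + 0 , + 1 , + 1) ≡ c + + 2 * s + t
  F-23 = trans (F-p (+ 0) (+ 0) (+ 1) (+ 1)) (lem m b c s t)
    where
    lem : ∀ m b c s t → m * + 0 + + 2 * b * + 0 + c * + 1 + + 2 * s * + 1 + t * + 1 ≡ c + + 2 * s + t
    lem = solve-∀

  evaluate : ∀ N v {l n k x} (R : Represented N p) → F p v ≡ x → dot (proj₁ R) v ≡ l → dot (proj₁ (proj₂ R)) v ≡ n →
      dot (proj₁ (proj₂ (proj₂ R))) v ≡ k → x ≡ N l n k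
  evaluate N v (L , M , K , R) Fx refl refl refl = trans (sym Fx) (R v)

  diagonal⇒N : ∀ k → Represented (diagonal k) p → ∃[ x ] ∃[ y ] ∃[ z ] N ≡ x * x + + k * (y * y) + + k * (z * z)
  diagonal⇒N k R@(L , M , K , _) = diagonal-minor k (coord₁ L) (coord₁ M) (coord₁ K) (coord₂ L) (coord₂ M)
      (coord₂ K)
    (evaluate (diagonal k) (+ 0 , + 1 , + 0 , + 0) R F-1 (dot-1 L) (dot-1 M) (dot-1 K))
    (evaluate (diagonal k) (+ 0 , + 0 , + 1 , + 0) R F-2 (dot-2 L) (dot-2 M) (dot-2 K))
    (evaluate (diagonal k) (+ 0 , + 1 , + 1 , + 0) R F-12 (dot-12 L) (dot-12 M) (dot-12 K))

  hexagonal⇒12 : Represented hexagonal p → ¬ m * c - b * b ≈ + 1 [ + 3 ]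
  hexagonal⇒12 R@(L , M , K , _) = hexagonal-minor (coord₁ L) (coord₁ M) (coord₁ K) (coord₂ L) (coord₂ M) (coord₂ K)
    (evaluate hexagonal (+ 0 , + 1 , + 0 , + 0) R F-1 (dot-1 L) (dot-1 M) (dot-1 K))
    (evaluate hexagonal (+ 0 , + 0 , + 1 , + 0) R F-2 (dot-2 L) (dot-2 M) (dot-2 K))
    (evaluate hexagonal (+ 0 , + 1 , + 1 , + 0) R F-12 (dot-12 L) (dot-12 M) (dot-12 K))

  hexagonal⇒23 : Represented hexagonal p → ¬ c * t - s * s ≈ + 1 [ + 3 ]
  hexagonal⇒23 R@(L , M , K , _) = hexagonal-minor (coord₂ L) (coord₂ M) (coord₂ K) (coord₃ L) (coord₃ M) (coord₃ K)
    (evaluate hexagonal (+ 0 , + 0 , + 1 , + 0) R F-2 (dot-2 L) (dot-2 M) (dot-2 K))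
    (evaluate hexagonal (+ 0 , + 0 , + 0 , + 1) R F-3 (dot-3 L) (dot-3 M) (dot-3 K))
    (evaluate hexagonal (+ 0 , + 0 , + 1 , + 1) R F-23 (dot-23 L) (dot-23 M) (dot-23 K))

  minor-1 : + 0 < m → + 0 < N → t * N - m * (s * s) ≡ + 1 → ∃[ x ] ∃[ y ] ∃[ z ] N ≡
      x * x + + 1 * (y * y) + + 1 * (z * z)
  minor-1 0<m 0<N D = diagonal⇒N 1 (represented-1 p (positive-p 0<m 0<N (subst (+ 0 ≤_) (sym D) (+≤+ z≤n)))
      (trans det-p D))

  -- Either of two binary minors may exclude the hexagonal class. The first serves when N ≡ 1 (mod
  -- 3), the second when N itself is a multiple of 3.
  minor-3 : + 0 < m → + 0 < N → t * N - m * (s * s) ≡ + 3 →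
      (m * c - b * b ≈ + 1 [ + 3 ]) ⊎ (c * t - s * s ≈ + 1 [ + 3 ]) →
            ∃[ x ] ∃[ y ] ∃[ z ] N ≡ x * x + + 3 * (y * y) + + 3 * (z * z)
  minor-3 0<m 0<N D minor = from (represented-3 p (positive-p 0<m 0<N (subst (+ 0 ≤_) (sym D) (+≤+ z≤n)))
      (trans det-p D))
    where
    excluded : _ → Represented hexagonal p → ⊥
    excluded (inj₁ e) H = hexagonal⇒12 H e
    excluded (inj₂ e) H = hexagonal⇒23 H e
    from : _ → ∃[ x ] ∃[ y ] ∃[ z ] N ≡ x * x + + 3 * (y * y) + + 3 * (z * z)
    from (inj₁ R) = diagonal⇒N 3 R
    from (inj₂ H) = ⊥-elim (excluded minor H)

-- Sums of three squares and the forms of determinant 3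

ℕ-≈ : ∀ {x y k n} → x ≡ y ℕ.+ k ℕ.* n → + x ≈ + y [ + n ]
ℕ-≈ {x} {y} {k} {n} e = step (+ k) (trans (cong +_ e) (cong (λ t → + y + t) (ℤ.pos-* k n)))

Unit-neg : ∀ {n a} → Unit n a → Unit n (- a)
Unit-neg {n} {a} u = subst (Unit n) (ℤ.-1*i≡-i a) (Unit-* (Unit-σ Sign.-) u)

J-neg : ∀ {h a} → Unit (+ odd h) a → J h (- a) ≡ sgn h Sign.* J h a
J-neg {h} {a} u = trans (cong (J h) (sym (ℤ.-1*i≡-i a)))
    (trans (J-* {h} (Unit-σ Sign.-) u) (cong (Sign._* J h a) (J-neg1 h)))

J-4* : ∀ {h a b} → Unit (+ odd h) a → a * + 4 ≈ b [ + odd h ] → J h a ≡ J h b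
J-4* {h} {a} {b} u e = trans (sym (Sign.*-identityʳ (J h a)))
    (trans (cong (J h a Sign.*_) (sym (J-□ {h} (Unit-2 h))))
    (trans (sym (J-* {h} u (Unit-* (Unit-2 h) (Unit-2 h)))) (J-cong {h} e)))

J-2* : ∀ {h a b} → J h (+ 2) ≡ Sign.+ → Unit (+ odd h) a → a * + 2 ≈ b [ + odd h ] → J h a ≡ J h b
J-2* {h} {a} {b} J2 u e = trans (sym (Sign.*-identityʳ (J h a)))
    (trans (cong (J h a Sign.*_) (sym J2)) (trans (sym (J-* {h} u (Unit-2 h))) (J-cong {h} e)))

J-2-mod-8 : ∀ j → J (4 ℕ.* j) (+ 2) ≡ Sign.+
J-2-mod-8 j = trans (J-2 (4 ℕ.* j)) (sgn-sucs-periodic 0 j)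

-- The sign from (-1/n) cancels the one from reciprocity, so the symbol is (n/3).
J--3 : ∀ {h} i → odd h ≡ 1 ℕ.+ i ℕ.* 3 → J h (- + 3) ≡ Sign.+
J--3 {h} i e = trans (J-neg {h} {+ 3} unit-3)
    (trans (cong (sgn h Sign.*_) (trans (reciprocity 1 h unit-3)
    (cong₂ Sign._*_ (trans (J-cong {1} h≈1) (J-1 1)) (cong sgn (ℕ.*-identityʳ h))))) (Sign.s*s≡+ (sgn h)))
  where
  h≈1 : + odd h ≈ + 1 [ + 3 ]
  h≈1 = ℕ-≈ {k = i} e
  unit-3 : Unit (+ odd h) (+ 3)
  unit-3 = Unit-swap (Unit-cong (≈-sym h≈1) Unit-1)

minor-≡ : ∀ {m b c n} → b * b ≡ - n + c * m → m * c - b * b ≡ n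
minor-≡ {m} {b} {c} {n} e = trans (cong (λ t → m * c - t) e) (lem m c n)
  where
  lem : ∀ m c n → m * c - (- n + c * m) ≡ n
  lem = solve-∀

0<+ : ∀ {n} → 1 ℕ.≤ n → + 0 < + n
0<+ = +<+

-- The class is a = 2N - 1 ≡ 1 (mod 8), for which -1 and 2 have symbol +, while 2(-N) ≡ -1. From ms²
-- = a + 8kN the entry t = 2 + 8k gives determinant 1.
three-squares-1-mod-4 : ∀ j → ∃[ x ] ∃[ y ] ∃[ z ] + suc (4 ℕ.* j) ≡ x * x + y * y + z * z
three-squares-1-mod-4 j = from (class-root N g (s≤s z≤n) (Unit-swap u) JN)
  where
  N = suc (4 ℕ.* j)
  g = 4 ℕ.* j
  2N : N ℕ.* 2 ≡ 1 ℕ.+ 1 ℕ.* odd g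
  2N = lem j
    where
    lem : ∀ j → suc (4 ℕ.* j) ℕ.* 2 ≡ 1 ℕ.+ 1 ℕ.* suc (2 ℕ.* (4 ℕ.* j))
    lem = solveℕ
  2N≈1 : + N * + 2 ≈ + 1 [ + odd g ]
  2N≈1 = ≈-trans (≈-reflexive (sym (ℤ.pos-* N 2))) (ℕ-≈ {k = 1} 2N)
  u : Unit (+ odd g) (+ N)
  u = unit (+ 2) 2N≈1
  JN : J g (- + N) ≡ Sign.+
  JN = trans (J-neg {g} u) (cong₂ Sign._*_ (trans (cong sgn (even j)) (sgn-2* (2 ℕ.* j)))
      (trans (J-2* {g} (J-2-mod-8 j) u 2N≈1) (J-1 g)))
    where
    even : ∀ j → 4 ℕ.* j ≡ 2 ℕ.* (2 ℕ.* j)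
    even = solveℕ
  from : RootInClass N (+ odd g) (+ 8 * + N) → _
  from (m , s , b , 1≤m , step k e , step c r) =
      unpack (minor-1 (0<+ 1≤m) (subst (+ 0 <_) (sym N≡) (0<+ (s≤s z≤n))) D)
    where
    open Ternary (+ m) b c (+ s) (+ 2 + + 8 * k) renaming (N to N′)
    N≡ : N′ ≡ + N
    N≡ = minor-≡ {+ m} {b} {c} r
    lem : ∀ k n a → n * + 2 ≡ + 1 + a → (+ 2 + + 8 * k) * n - (a + k * (+ 8 * n)) ≡ + 1
    lem k n a h = trans (lem₁ k n a) (trans (cong (_- a) h) (lem₂ a))
      where
      lem₁ : ∀ k n a → (+ 2 + + 8 * k) * n - (a + k * (+ 8 * n)) ≡ n * + 2 - a
      lem₁ = solve-∀
      lem₂ : ∀ a → + 1 + a - a ≡ + 1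
      lem₂ = solve-∀
    D : (+ 2 + + 8 * k) * N′ - + m * (+ s * + s) ≡ + 1
    D = trans (cong₂ (λ x y → (+ 2 + + 8 * k) * x - y) N≡ e)
        (lem k (+ N) (+ odd g) (trans (sym (ℤ.pos-* N 2))
        (trans (cong +_ 2N) (cong (λ t → + (1 ℕ.+ t)) (ℕ.*-identityˡ (odd g))))))
    unpack : (∃[ x ] ∃[ y ] ∃[ z ] N′ ≡ x * x + + 1 * (y * y) + + 1 * (z * z)) → _
    unpack (x , y , z , h) = x , y , z , trans (sym N≡)
        (trans h (cong₂ (λ s t → x * x + s + t) (ℤ.*-identityˡ (y * y)) (ℤ.*-identityˡ (z * z))))

even-or-odd : ∀ x → ∃[ u ] (x ≡ + 2 * u ⊎ x ≡ + 1 + + 2 * u)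
even-or-odd (+ n) with parity n
... | c , inj₁ refl = + c , inj₁ (ℤ.pos-* 2 c)
... | c , inj₂ refl = + c , inj₂ (cong (λ t → + 1 + t) (ℤ.pos-* 2 c))
even-or-odd -[1+ n ] with parity n
... | c , inj₁ refl = - + suc c , inj₂ (trans (cong (λ t → - (+ 1 + t)) (ℤ.pos-* 2 c)) (lem (+ c)))
  where
  lem : ∀ c → - (+ 1 + + 2 * c) ≡ + 1 + + 2 * - (+ 1 + c)
  lem = solve-∀
... | c , inj₂ refl = - + suc c , inj₁ (trans (cong (λ t → - (+ 2 + t)) (ℤ.pos-* 2 c)) (lem (+ c)))
  where
  lem : ∀ c → - (+ 2 + + 2 * c) ≡ + 2 * - (+ 1 + c)
  lem = solve-∀

even≢odd : ∀ x y → + 2 * x ≢ + 1 + + 2 * y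
even≢odd x y e = 1≉0[2] (step (x - y) (trans (lem y) (trans (cong (_- + 2 * y) (sym e)) (lem₂ x y))))
  where
  lem : ∀ y → + 1 ≡ + 1 + + 2 * y - + 2 * y
  lem = solve-∀
  lem₂ : ∀ x y → + 2 * x - + 2 * y ≡ + 0 + (x - y) * + 2
  lem₂ = solve-∀

-- Adding the odd number m if necessary makes b odd; then cm = b² + n is even, and so is c.
root-mod-2m : ∀ {μ n j} b c m → m ≡ + 1 + + 2 * μ → n ≡ + 3 + + 4 * j → b * b ≡ - n + c * m →
              ∃[ b ] ∃[ c ] b * b ≡ - n + c * (+ 2 * m)
root-mod-2m {μ} {n} {j} b c m refl refl e = cases (even-or-odd b)
  where
  odd-root : ∀ v c → (+ 1 + + 2 * v) * (+ 1 + + 2 * v) ≡ - n + c * m → ∃[ b ] ∃[ c ] b * b ≡ - n + c * (+ 2 * m)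
  odd-root v c e = + 1 + + 2 * v , d , trans e (cong (λ c → - n + c) (trans (cong (_* m) c≡) (lem₂ d m)))
    where
    -- Half of c = cm - 2μc, where cm = b² + n = 4(v² + v + 1 + j).
    d = + 2 * (v * v + v + + 1 + j) - μ * c
    lem : ∀ v j c μ → c ≡ (- (+ 3 + + 4 * j) + c * (+ 1 + + 2 * μ)) + (+ 3 + + 4 * j) - + 2 * (μ * c)
    lem = solve-∀
    lem₁ : ∀ v j c μ → (+ 1 + + 2 * v) * (+ 1 + + 2 * v) + (+ 3 + + 4 * j) - + 2 * (μ * c) ≡
        + 2 * (+ 2 * (v * v + v + + 1 + j) - μ * c)
    lem₁ = solve-∀
    c≡ : c ≡ + 2 * d
    c≡ = trans (lem v j c μ) (trans (cong (λ t → t + (+ 3 + + 4 * j) - + 2 * (μ * c)) (sym e)) (lem₁ v j c μ))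
    lem₂ : ∀ d m → + 2 * d * m ≡ d * (+ 2 * m)
    lem₂ = solve-∀
  cases : _ → _
  cases (v , inj₂ refl) = odd-root v c e
  -- The new root is b + m = 1 + 2(v + μ), and its square exceeds b² by (2b + m)m with 2b = 4v.
  cases (v , inj₁ refl) = odd-root (v + μ) (c + + 4 * v + m)
      (trans (lem v μ) (trans (cong (_+ (+ 4 * v + m) * m) e) (lem₂ n c m v)))
    where
    lem : ∀ v μ → (+ 1 + + 2 * (v + μ)) * (+ 1 + + 2 * (v + μ)) ≡
        + 2 * v * (+ 2 * v) + (+ 4 * v + (+ 1 + + 2 * μ)) * (+ 1 + + 2 * μ)
    lem = solve-∀
    lem₂ : ∀ n c m v → - n + c * m + (+ 4 * v + m) * m ≡ - n + (c + + 4 * v + m) * m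
    lem₂ = solve-∀

-- Now 2N - 1 ≡ 5 (mod 8) gives 2 the symbol -, so that class fails. Instead a = (N - 1)/2 ≡ 1 (mod
-- 4), where -N ≡ -1, and 2m takes the place of m, because N - 2a = 1.
three-squares-3-mod-8 : ∀ j → ∃[ x ] ∃[ y ] ∃[ z ] + (3 ℕ.+ 8 ℕ.* j) ≡ x * x + y * y + z * z
three-squares-3-mod-8 j = from (class-root N g (s≤s z≤n) (Unit-swap (Unit-cong (≈-sym N≈1) Unit-1)) JN)
  where
  N = 3 ℕ.+ 8 ℕ.* j
  g = 2 ℕ.* j
  N≡2a+1 : N ≡ 1 ℕ.+ 2 ℕ.* odd g
  N≡2a+1 = lem j
    where
    lem : ∀ j → 3 ℕ.+ 8 ℕ.* j ≡ 1 ℕ.+ 2 ℕ.* suc (2 ℕ.* (2 ℕ.* j))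
    lem = solveℕ
  N≈1 : + N ≈ + 1 [ + odd g ]
  N≈1 = ℕ-≈ {k = 2} N≡2a+1
  JN : J g (- + N) ≡ Sign.+
  JN = trans (J-cong {g} (≈-neg N≈1)) (trans (J-neg1 g) (sgn-2* j))
  n≡ : + N ≡ + 3 + + 4 * (+ 2 * + j)
  n≡ = cong (λ t → + 3 + t) (trans (ℤ.pos-* 8 j) (lem (+ j)))
    where
    lem : ∀ j → + 8 * j ≡ + 4 * (+ 2 * j)
    lem = solve-∀
  from : RootInClass N (+ odd g) (+ 8 * + N) → _
  from (m , s , b , 1≤m , step k e , step c r) = lift (even-or-odd (+ m))
    where
    lift : (∃[ u ] (+ m ≡ + 2 * u ⊎ + m ≡ + 1 + + 2 * u)) → _
    -- m is odd because ms² = `odd g` + 8kN is.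
    lift (u , inj₁ h) = contradiction
        (trans (sym (ℤ.*-assoc (+ 2) u (+ s * + s)))
        (trans (cong (_* (+ s * + s)) (sym h)) (trans e (lem (+ g) k (+ N)))))
        (even≢odd (u * (+ s * + s)) (+ g + + 4 * (k * + N)))
      where
      lem′ : ∀ g k n → + 1 + + 2 * g + k * (+ 8 * n) ≡ + 1 + + 2 * (g + + 4 * (k * n))
      lem′ = solve-∀
      lem : ∀ x k n → + odd g + k * (+ 8 * n) ≡ + 1 + + 2 * (+ g + + 4 * (k * n))
      lem x k n = trans (cong (λ t → + 1 + t + k * (+ 8 * n)) (ℤ.pos-* 2 g)) (lem′ (+ g) k n)
    lift (u , inj₂ h) = finish (root-mod-2m {u} {+ N} {+ 2 * + j} b c (+ m) h n≡ r)
      where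
      finish : (∃[ b ] ∃[ c ] b * b ≡ - + N + c * (+ 2 * + m)) → _
      finish (b , c , r) = unpack (minor-1 (subst (+ 0 <_) (ℤ.pos-* 2 m) (0<+ (ℕ.*-mono-≤ (s≤s (z≤n {1})) 1≤m)))
          (subst (+ 0 <_) (sym N≡) (0<+ (s≤s z≤n))) D)
        where
        open Ternary (+ 2 * + m) b c (+ s) (+ 1 + + 16 * k) renaming (N to N′)
        N≡ : N′ ≡ + N
        N≡ = minor-≡ {+ 2 * + m} {b} {c} r
        lem : ∀ k n a → n ≡ + 1 + + 2 * a → (+ 1 + + 16 * k) * n - + 2 * (a + k * (+ 8 * n)) ≡ + 1
        lem k n a h = trans (lem₁ k n a) (trans (cong (_- + 2 * a) h) (lem₂ a))
          where
          lem₁ : ∀ k n a → (+ 1 + + 16 * k) * n - + 2 * (a + k * (+ 8 * n)) ≡ n - + 2 * a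
          lem₁ = solve-∀
          lem₂ : ∀ a → + 1 + + 2 * a - + 2 * a ≡ + 1
          lem₂ = solve-∀
        D : (+ 1 + + 16 * k) * N′ - + 2 * + m * (+ s * + s) ≡ + 1
        D = trans (cong₂ (λ x y → (+ 1 + + 16 * k) * x - y) N≡
            (trans (ℤ.*-assoc (+ 2) (+ m) (+ s * + s)) (cong (+ 2 *_) e)))
              (lem k (+ N) (+ odd g) (trans (cong +_ N≡2a+1) (cong (λ t → + 1 + t) (ℤ.pos-* 2 (odd g)))))
        unpack : (∃[ x ] ∃[ y ] ∃[ z ] N′ ≡ x * x + + 1 * (y * y) + + 1 * (z * z)) → _
        unpack (x , y , z , h) = x , y , z , trans (sym N≡)
            (trans h (cong₂ (λ s t → x * x + s + t) (ℤ.*-identityˡ (y * y)) (ℤ.*-identityˡ (z * z))))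

-- The class is a = 4N - 3 ≡ 1 (mod 3), so that (-N/a) = (-4N/a) = (-3/a) = 1, and t = 4 + 8k gives
-- determinant 3. As N ≡ 1 (mod 3), the minor N excludes the hexagonal class.
form-133 : ∀ j → ∃[ x ] ∃[ y ] ∃[ z ] + (7 ℕ.+ 24 ℕ.* j) ≡ x * x + + 3 * (y * y) + + 3 * (z * z)
form-133 j = from (class-root N g (s≤s z≤n) unit-N JN)
  where
  N = 7 ℕ.+ 24 ℕ.* j
  g = 12 ℕ.+ 48 ℕ.* j
  unit-N : Unit (+ N) (+ odd g)
  unit-N = unit (+ (2 ℕ.+ 8 ℕ.* j)) (≈-trans (≈-reflexive (sym (ℤ.pos-* (odd g) (2 ℕ.+ 8 ℕ.* j))))
      (ℕ-≈ {k = 7 ℕ.+ 32 ℕ.* j} (lem j)))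
    where
    lem : ∀ j → suc (2 ℕ.* (12 ℕ.+ 48 ℕ.* j)) ℕ.* (2 ℕ.+ 8 ℕ.* j) ≡ 1 ℕ.+ (7 ℕ.+ 32 ℕ.* j) ℕ.* (7 ℕ.+ 24 ℕ.* j)
    lem = solveℕ
  4N≡ : N ℕ.* 4 ≡ 3 ℕ.+ 1 ℕ.* odd g
  4N≡ = lem j
    where
    lem : ∀ j → (7 ℕ.+ 24 ℕ.* j) ℕ.* 4 ≡ 3 ℕ.+ 1 ℕ.* suc (2 ℕ.* (12 ℕ.+ 48 ℕ.* j))
    lem = solveℕ
  JN : J g (- + N) ≡ Sign.+
  JN = trans (J-4* {g} (Unit-neg (Unit-swap unit-N))
      (≈-trans (≈-reflexive (trans (sym (ℤ.neg-distribˡ-* (+ N) (+ 4))) (cong -_ (sym (ℤ.pos-* N 4)))))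
      (≈-neg {y = + 3} {n = + odd g} (ℕ-≈ {k = 1} 4N≡)))) (J--3 {g} (8 ℕ.+ 32 ℕ.* j) (lem j))
    where
    lem : ∀ j → suc (2 ℕ.* (12 ℕ.+ 48 ℕ.* j)) ≡ 1 ℕ.+ (8 ℕ.+ 32 ℕ.* j) ℕ.* 3
    lem = solveℕ
  from : RootInClass N (+ odd g) (+ 8 * + N) → _
  from (m , s , b , 1≤m , step k e , step c r) =
      unpack (minor-3 (0<+ 1≤m) (subst (+ 0 <_) (sym N≡) (0<+ (s≤s z≤n))) D
      (inj₁ (≈-trans (≈-reflexive N≡) (ℕ-≈ {k = 2 ℕ.+ 8 ℕ.* j} (mod3 j)))))
    where
    mod3 : ∀ j → 7 ℕ.+ 24 ℕ.* j ≡ 1 ℕ.+ (2 ℕ.+ 8 ℕ.* j) ℕ.* 3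
    mod3 = solveℕ
    open Ternary (+ m) b c (+ s) (+ 4 + + 8 * k) renaming (N to N′)
    N≡ : N′ ≡ + N
    N≡ = minor-≡ {+ m} {b} {c} r
    lem : ∀ k n a → n * + 4 ≡ + 3 + a → (+ 4 + + 8 * k) * n - (a + k * (+ 8 * n)) ≡ + 3
    lem k n a h = trans (lem₁ k n a) (trans (cong (_- a) h) (lem₂ a))
      where
      lem₁ : ∀ k n a → (+ 4 + + 8 * k) * n - (a + k * (+ 8 * n)) ≡ n * + 4 - a
      lem₁ = solve-∀
      lem₂ : ∀ a → + 3 + a - a ≡ + 3
      lem₂ = solve-∀
    D : (+ 4 + + 8 * k) * N′ - + m * (+ s * + s) ≡ + 3
    D = trans (cong₂ (λ x y → (+ 4 + + 8 * k) * x - y) N≡ e)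
        (lem k (+ N) (+ odd g) (trans (sym (ℤ.pos-* N 4))
        (trans (cong +_ 4N≡) (cong (λ t → + (3 ℕ.+ t)) (ℕ.*-identityˡ (odd g))))))
    unpack : (∃[ x ] ∃[ y ] ∃[ z ] N′ ≡ x * x + + 3 * (y * y) + + 3 * (z * z)) → _
    unpack (x , y , z , h) = x , y , z , trans (sym N≡) h

-- The minor is made 3N: if 3N = x² + 3y² + 3z², then 3 divides x and N = y² + z² + 3(x/3)². As this
-- minor is 0 modulo 3, the hexagonal class has to be excluded by the minor of the second and third
-- vectors.
module Form113 (N g i l : ℕ) (0<N : 0 ℕ.< N) (g≡ : odd g ≡ 1 ℕ.+ i ℕ.* 3) (lN : l ℕ.* N ≡ 1 ℕ.+ odd g)
  (unit-3N : Unit (+ (3 ℕ.* N)) (+ odd g)) (J-3N : J g (- + (3 ℕ.* N)) ≡ Sign.+) where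

  n = + N

  module _ (m s : ℕ) (b : ℤ) (1≤m : 1 ℕ.≤ m) (k : ℤ) (e : + m * (+ s * + s) ≡ + odd g + k * (+ 8 * + (3 ℕ.* N)))
           (c′ : ℤ) (r : b * b ≡ - + (3 ℕ.* N) + c′ * + m) where

    +3N : + (3 ℕ.* N) ≡ + 3 * n
    +3N = ℤ.pos-* 3 N

    e′ : + m * (+ s * + s) ≡ + odd g + k * (+ 8 * (+ 3 * n))
    e′ = trans e (cong (λ t → + odd g + k * (+ 8 * t)) +3N)

    ms²≈1 : + m * (+ s * + s) ≈ + 1 [ + 3 ]
    ms²≈1 = ≈-trans (step (k * (+ 8 * n)) (trans e′ (cong (λ t → + odd g + t) (lem k n)))) (ℕ-≈ {k = i} g≡)
      where
      lem : ∀ k n → k * (+ 8 * (+ 3 * n)) ≡ k * (+ 8 * n) * + 3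
      lem = solve-∀

    m≈1 : + m ≈ + 1 [ + 3 ]
    m≈1 = cases (square-mod-3 (+ s))
      where
      cases : _ → + m ≈ + 1 [ + 3 ]
      cases (inj₁ (s²≈0 , _)) = contradiction
          (≈-trans (≈-sym (≈-trans (≈-*ˡ (+ m) s²≈0) (≈-reflexive (ℤ.*-zeroʳ (+ m))))) ms²≈1) 0≉1[3]
      cases (inj₂ s²≈1) = ≈-trans (≈-sym (≈-trans (≈-*ˡ (+ m) s²≈1) (≈-reflexive (ℤ.*-identityʳ (+ m))))) ms²≈1

    μ = _≈_[_].multiple m≈1
    m≡ : + m ≡ + 1 + μ * + 3
    m≡ = _≈_[_].shift m≈1

    -- Since m ≡ 1 (mod 3), the root b - bm modulo m is divisible by 3; b₁ is its third and c₂ its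
    -- cofactor.
    b₁ = - (b * μ)
    c₂ = c′ - + 2 * (b * b) + b * b * + m
    -- A third of c₂ = mc₂ - 3μc₂, where mc₂ = 9b₁² + 3n.
    c = + 3 * (b₁ * b₁) + n - μ * c₂
    t = + l + + 24 * k

    3b₁ : + 3 * b₁ ≡ b - b * + m
    3b₁ = sym (trans (cong (λ m → b - b * m) m≡) (lem b μ))
      where
      lem : ∀ b μ → b - b * (+ 1 + μ * + 3) ≡ + 3 * - (b * μ)
      lem = solve-∀

    root₂ : + 3 * b₁ * (+ 3 * b₁) + + 3 * n ≡ + m * c₂
    root₂ = trans (cong₂ (λ x y → x * y + + 3 * n) 3b₁ 3b₁)
        (trans (lem b (+ m) n) (trans (cong (λ t → t + + 3 * n + (+ m * (- (+ 2 * (b * b)) + b * b * + m)))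
        (trans r (cong (λ t → - t + c′ * + m) +3N))) (lem₂ b (+ m) n c′)))
      where
      lem : ∀ b m n → (b - b * m) * (b - b * m) + + 3 * n ≡ b * b + + 3 * n + (m * (- (+ 2 * (b * b)) + b * b * m))
      lem = solve-∀
      lem₂ : ∀ b m n c → - (+ 3 * n) + c * m + + 3 * n + (m * (- (+ 2 * (b * b)) + b * b * m)) ≡
          m * (c - + 2 * (b * b) + b * b * m)
      lem₂ = solve-∀

    3c : c₂ ≡ + 3 * c
    3c = trans (lem c₂ μ) (trans (cong (_- + 3 * (μ * c₂)) (trans (cong (_* c₂) (sym m≡)) (sym root₂)))
        (lem₂ b₁ n μ c₂))
      where
      lem : ∀ c μ → c ≡ (+ 1 + μ * + 3) * c - + 3 * (μ * c)
      lem = solve-∀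
      lem₂ : ∀ b n μ c → + 3 * b * (+ 3 * b) + + 3 * n - + 3 * (μ * c) ≡ + 3 * (+ 3 * (b * b) + n - μ * c)
      lem₂ = solve-∀

    mc : + m * c ≡ + 3 * (b₁ * b₁) + n
    mc = ℤ.*-cancelˡ-≡ (+ 3) _ _ (trans (lem (+ m) c)
        (trans (cong (+ m *_) (sym 3c)) (trans (sym root₂) (lem₂ b₁ n))))
      where
      lem : ∀ m c → + 3 * (m * c) ≡ m * (+ 3 * c)
      lem = solve-∀
      lem₂ : ∀ b n → + 3 * b * (+ 3 * b) + + 3 * n ≡ + 3 * (+ 3 * (b * b) + n)
      lem₂ = solve-∀

    tn : t * n ≡ + m * (+ s * + s) + + 1
    tn = trans (lem (+ l) k n) (trans (cong (_+ k * (+ 8 * (+ 3 * n))) (trans (sym (ℤ.pos-* l N)) (cong +_ lN)))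
        (trans (lem₂ (+ odd g) (k * (+ 8 * (+ 3 * n)))) (cong (_+ + 1) (sym e′))))
      where
      lem : ∀ l k n → (l + + 24 * k) * n ≡ l * n + k * (+ 8 * (+ 3 * n))
      lem = solve-∀
      lem₂ : ∀ a x → + 1 + a + x ≡ a + x + + 1
      lem₂ = solve-∀

    open Ternary (+ 3 * + m) (+ 3 * b₁) c (+ s) t renaming (N to N′)

    N≡ : N′ ≡ + 3 * n
    N≡ = trans (lem (+ m) c b₁) (trans (cong (λ x → + 3 * x - + 3 * b₁ * (+ 3 * b₁)) mc) (lem₂ b₁ n))
      where
      lem : ∀ m c b → + 3 * m * c - + 3 * b * (+ 3 * b) ≡ + 3 * (m * c) - + 3 * b * (+ 3 * b)
      lem = solve-∀
      lem₂ : ∀ b n → + 3 * (+ 3 * (b * b) + n) - + 3 * b * (+ 3 * b) ≡ + 3 * n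
      lem₂ = solve-∀

    D : t * N′ - + 3 * + m * (+ s * + s) ≡ + 3
    D = trans (cong (λ x → t * x - + 3 * + m * (+ s * + s)) N≡)
        (trans (lem t n (+ m) (+ s * + s))
        (trans (cong (λ x → + 3 * (x - + m * (+ s * + s))) tn) (lem₂ (+ m * (+ s * + s)))))
      where
      lem : ∀ t n m q → t * (+ 3 * n) - + 3 * m * q ≡ + 3 * (t * n - m * q)
      lem = solve-∀
      lem₂ : ∀ x → + 3 * (x + + 1 - x) ≡ + 3
      lem₂ = solve-∀

    -- Multiplied by m ≡ 1 (mod 3), the minor becomes 3b₁²t + (tn - ms²), where the bracket is 1.
    minor≈1 : c * t - + s * + s ≈ + 1 [ + 3 ]
    minor≈1 = step (b₁ * b₁ * t - μ * w)
        (trans (lem w μ) (trans (cong (λ x → x * w - μ * w * + 3) (sym m≡))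
        (trans (cong (_- μ * w * + 3) mw) (lem₂ b₁ t (μ * w)))))
      where
      w = c * t - + s * + s
      lem : ∀ w μ → w ≡ (+ 1 + μ * + 3) * w - μ * w * + 3
      lem = solve-∀
      lem₂ : ∀ b t x → + 3 * (b * b) * t + + 1 - x * + 3 ≡ + 1 + (b * b * t - x) * + 3
      lem₂ = solve-∀
      lem₃ : ∀ m c t q → m * (c * t - q) ≡ (m * c) * t - m * q
      lem₃ = solve-∀
      lem₄ : ∀ b n t q → (+ 3 * (b * b) + n) * t - q ≡ + 3 * (b * b) * t + (t * n - q)
      lem₄ = solve-∀
      lem₅ : ∀ x q → x + (q + + 1 - q) ≡ x + + 1
      lem₅ = solve-∀
      mw : + m * w ≡ + 3 * (b₁ * b₁) * t + + 1
      mw = trans (lem₃ (+ m) c t (+ s * + s))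
          (trans (cong (λ x → x * t - + m * (+ s * + s)) mc) (trans (lem₄ b₁ n t (+ m * (+ s * + s)))
        (trans (cong (λ x → + 3 * (b₁ * b₁) * t + (x - + m * (+ s * + s))) tn)
            (lem₅ (+ 3 * (b₁ * b₁) * t) (+ m * (+ s * + s))))))

    representation : ∃[ x ] ∃[ y ] ∃[ z ] + N ≡ x * x + y * y + + 3 * (z * z)
    representation = unpack (minor-3 (0<3* 1≤m) (subst (+ 0 <_) (sym N≡) (0<3* 0<N)) D (inj₂ minor≈1))
      where
      0<3* : ∀ {m} → 1 ℕ.≤ m → + 0 < + 3 * + m
      0<3* {m} 1≤m = subst (+ 0 <_) (ℤ.pos-* 3 m) (0<+ (ℕ.*-mono-≤ (s≤s (z≤n {2})) 1≤m))
      unpack : (∃[ x ] ∃[ y ] ∃[ z ] N′ ≡ x * x + + 3 * (y * y) + + 3 * (z * z)) → ∃[ x ] ∃[ y ] ∃[ z ] + N ≡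
          x * x + y * y + + 3 * (z * z)
      unpack (x , y , z , h) = cases (square-mod-3 x)
        where
        lem : ∀ n y z q → + 3 * n ≡ q + + 3 * y + + 3 * z → + 0 ≡ q + (y + z - n) * + 3
        lem n y z q h = trans (lem₁ n) (trans (cong (_- + 3 * n) h) (lem₂ n y z q))
          where
          lem₁ : ∀ n → + 0 ≡ + 3 * n - + 3 * n
          lem₁ = solve-∀
          lem₂ : ∀ n y z q → q + + 3 * y + + 3 * z - + 3 * n ≡ q + (y + z - n) * + 3
          lem₂ = solve-∀
        cases : _ → ∃[ x ] ∃[ y ] ∃[ z ] + N ≡ x * x + y * y + + 3 * (z * z)
        cases (inj₂ x²≈1) = contradiction
            (≈-trans (step (y * y + z * z - n) (lem n (y * y) (z * z) (x * x) (trans (sym N≡) h))) x²≈1) 0≉1[3]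
        cases (inj₁ (_ , u , refl)) = y , z , u , ℤ.*-cancelˡ-≡ (+ 3) _ _ (trans (sym N≡) (trans h (lem₃ u y z)))
          where
          lem₃ : ∀ u y z → + 3 * u * (+ 3 * u) + + 3 * (y * y) + + 3 * (z * z) ≡
              + 3 * (y * y + z * z + + 3 * (u * u))
          lem₃ = solve-∀

  form : ∃[ x ] ∃[ y ] ∃[ z ] + N ≡ x * x + y * y + + 3 * (z * z)
  form = from (class-root (3 ℕ.* N) g (ℕ.*-mono-≤ (s≤s (z≤n {2})) 0<N) unit-3N J-3N)
    where
    from : RootInClass (3 ℕ.* N) (+ odd g) (+ 8 * + (3 ℕ.* N)) → _
    from (m , s , b , 1≤m , step k e , step c′ r) = representation m s b 1≤m k e c′ r

-- The class is a = 4N - 1, which is 1 modulo 3 because N ≡ 2; four times -3N is -3 modulo a.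
form-113-2-mod-3 : ∀ i → ∃[ x ] ∃[ y ] ∃[ z ] + (2 ℕ.+ 3 ℕ.* i) ≡ x * x + y * y + + 3 * (z * z)
form-113-2-mod-3 i = Form113.form N g (2 ℕ.+ 4 ℕ.* i) 4 (s≤s z≤n) (mod3 i) (4N i) unit-3N J-3N
  where
  N = 2 ℕ.+ 3 ℕ.* i
  g = 3 ℕ.+ 6 ℕ.* i
  mod3 : ∀ i → suc (2 ℕ.* (3 ℕ.+ 6 ℕ.* i)) ≡ 1 ℕ.+ (2 ℕ.+ 4 ℕ.* i) ℕ.* 3
  mod3 = solveℕ
  4N : ∀ i → 4 ℕ.* (2 ℕ.+ 3 ℕ.* i) ≡ 1 ℕ.+ suc (2 ℕ.* (3 ℕ.+ 6 ℕ.* i))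
  4N = solveℕ
  unit-3N : Unit (+ (3 ℕ.* N)) (+ odd g)
  unit-3N = unit (+ odd g) (≈-trans (≈-reflexive (sym (ℤ.pos-* (odd g) (odd g))))
      (ℕ-≈ {k = 8 ℕ.* (1 ℕ.+ 2 ℕ.* i)} (lem i)))
    where
    lem : ∀ i → suc (2 ℕ.* (3 ℕ.+ 6 ℕ.* i)) ℕ.* suc (2 ℕ.* (3 ℕ.+ 6 ℕ.* i)) ≡
        1 ℕ.+ (8 ℕ.* (1 ℕ.+ 2 ℕ.* i)) ℕ.* (3 ℕ.* (2 ℕ.+ 3 ℕ.* i))
    lem = solveℕ
  12N≈3 : + (3 ℕ.* N) * + 4 ≈ + 3 [ + odd g ]
  12N≈3 = ≈-trans (≈-reflexive (sym (ℤ.pos-* (3 ℕ.* N) 4))) (ℕ-≈ {k = 3} (lem i))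
    where
    lem : ∀ i → 3 ℕ.* (2 ℕ.+ 3 ℕ.* i) ℕ.* 4 ≡ 3 ℕ.+ 3 ℕ.* suc (2 ℕ.* (3 ℕ.+ 6 ℕ.* i))
    lem = solveℕ
  J-3N : J g (- + (3 ℕ.* N)) ≡ Sign.+
  J-3N = trans (J-4* {g} (Unit-neg (Unit-swap unit-3N))
      (≈-trans (≈-reflexive (sym (ℤ.neg-distribˡ-* (+ (3 ℕ.* N)) (+ 4)))) (≈-neg 12N≈3)))
      (J--3 {g} (2 ℕ.+ 4 ℕ.* i) (mod3 i))

-- As N ≡ 1 (mod 3), the number 4N - 1 is divisible by 3, and a = 2N - 1 is used. It is 1 modulo 24,
-- so 2 and -3 both have symbol +, and twice -3N is -3 modulo a.
form-113-13-mod-24 : ∀ j → ∃[ x ] ∃[ y ] ∃[ z ] + (13 ℕ.+ 24 ℕ.* j) ≡ x * x + y * y + + 3 * (z * z)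
form-113-13-mod-24 j = Form113.form N g (8 ℕ.+ 16 ℕ.* j) 2 (s≤s z≤n) (mod3 j) (2N j) unit-3N J-3N
  where
  N = 13 ℕ.+ 24 ℕ.* j
  g = 4 ℕ.* (3 ℕ.+ 6 ℕ.* j)
  mod3 : ∀ j → suc (2 ℕ.* (4 ℕ.* (3 ℕ.+ 6 ℕ.* j))) ≡ 1 ℕ.+ (8 ℕ.+ 16 ℕ.* j) ℕ.* 3
  mod3 = solveℕ
  2N : ∀ j → 2 ℕ.* (13 ℕ.+ 24 ℕ.* j) ≡ 1 ℕ.+ suc (2 ℕ.* (4 ℕ.* (3 ℕ.+ 6 ℕ.* j)))
  2N = solveℕ
  unit-3N : Unit (+ (3 ℕ.* N)) (+ odd g)
  unit-3N = unit (+ odd g) (≈-trans (≈-reflexive (sym (ℤ.pos-* (odd g) (odd g))))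
      (ℕ-≈ {k = 4 ℕ.* (4 ℕ.+ 8 ℕ.* j)} (lem j)))
    where
    lem : ∀ j → suc (2 ℕ.* (4 ℕ.* (3 ℕ.+ 6 ℕ.* j))) ℕ.* suc (2 ℕ.* (4 ℕ.* (3 ℕ.+ 6 ℕ.* j))) ≡
        1 ℕ.+ (4 ℕ.* (4 ℕ.+ 8 ℕ.* j)) ℕ.* (3 ℕ.* (13 ℕ.+ 24 ℕ.* j))
    lem = solveℕ
  6N≈3 : + (3 ℕ.* N) * + 2 ≈ + 3 [ + odd g ]
  6N≈3 = ≈-trans (≈-reflexive (sym (ℤ.pos-* (3 ℕ.* N) 2))) (ℕ-≈ {k = 3} (lem j))
    where
    lem : ∀ j → 3 ℕ.* (13 ℕ.+ 24 ℕ.* j) ℕ.* 2 ≡ 3 ℕ.+ 3 ℕ.* suc (2 ℕ.* (4 ℕ.* (3 ℕ.+ 6 ℕ.* j)))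
    lem = solveℕ
  J-3N : J g (- + (3 ℕ.* N)) ≡ Sign.+
  J-3N = trans (J-2* {g} (J-2-mod-8 (3 ℕ.+ 6 ℕ.* j)) (Unit-neg (Unit-swap unit-3N))
      (≈-trans (≈-reflexive (sym (ℤ.neg-distribˡ-* (+ (3 ℕ.* N)) (+ 2)))) (≈-neg 6N≈3)))
      (J--3 {g} (8 ℕ.+ 16 ℕ.* j) (mod3 j))

-- Pentagonal numbers

Odd : ℤ → Set
Odd x = ∃[ u ] x ≡ + 1 + + 2 * u

3∤ : ℤ → Set
3∤ x = ¬ x ≈ + 0 [ + 3 ]

3∤-* : ∀ {x} → 3∤ x → x * x ≈ + 1 [ + 3 ]
3∤-* {x} n = cases (square-mod-3 x)
  where
  cases : _ → x * x ≈ + 1 [ + 3 ]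
  cases (inj₂ e) = e
  cases (inj₁ (_ , u , refl)) = contradiction (step u (trans (ℤ.*-comm (+ 3) u) (sym (ℤ.+-identityˡ _)))) n

3∤-from-□ : ∀ {x} → x * x ≈ + 1 [ + 3 ] → 3∤ x
3∤-from-□ e x≈0 = 0≉1[3] (≈-trans (≈-sym (≈-* x≈0 x≈0)) e)

⌊/2⌋-exact : ∀ w → (+ 2 * w) /ℕ 2 ≡ w
⌊/2⌋-exact w = go ((+ 2 * w) %ℕ 2) (n%ℕd<d (+ 2 * w) 2) (a≡a%ℕn+[a/ℕn]*n (+ 2 * w) 2)
  where
  go : ∀ r → r ℕ.< 2 → + 2 * w ≡ + r + (+ 2 * w) /ℕ 2 * + 2 → (+ 2 * w) /ℕ 2 ≡ w
  go 0 _ e = sym (ℤ.*-cancelˡ-≡ (+ 2) w _ (trans e (trans (ℤ.+-identityˡ _) (ℤ.*-comm ((+ 2 * w) /ℕ 2) (+ 2)))))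
  go 1 _ e = contradiction (trans e (cong (λ t → + 1 + t) (ℤ.*-comm ((+ 2 * w) /ℕ 2) (+ 2))))
      (even≢odd w ((+ 2 * w) /ℕ 2))
  go (suc (suc _)) (s≤s (s≤s ())) _

p₅-square : ∀ t → + 24 * p₅ t + + 1 ≡ (+ 6 * t - + 1) * (+ 6 * t - + 1)
p₅-square t = cases (even-or-odd t)
  where
  from : ∀ w → t * (t - + 1) ≡ + 2 * w → + 24 * p₅ t + + 1 ≡ (+ 6 * t - + 1) * (+ 6 * t - + 1)
  from w e = trans (cong (λ s → + 24 * (+ 3 * s + t) + + 1) (trans (cong (_/ℕ 2) e) (⌊/2⌋-exact w)))
      (trans (lem w t) (trans (cong (λ s → + 36 * s + + 24 * t + + 1) (sym e)) (lem₂ t)))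
    where
    lem : ∀ w t → + 24 * (+ 3 * w + t) + + 1 ≡ + 36 * (+ 2 * w) + + 24 * t + + 1
    lem = solve-∀
    lem₂ : ∀ t → + 36 * (t * (t - + 1)) + + 24 * t + + 1 ≡ (+ 6 * t - + 1) * (+ 6 * t - + 1)
    lem₂ = solve-∀
  cases : _ → + 24 * p₅ t + + 1 ≡ (+ 6 * t - + 1) * (+ 6 * t - + 1)
  cases (u , inj₁ e) = from (u * (t - + 1)) (trans (cong (_* (t - + 1)) e) (ℤ.*-assoc (+ 2) u (t - + 1)))
  cases (u , inj₂ e) = from (t * u) (trans (cong (λ s → t * (s - + 1)) e) (lem t u))
    where
    lem : ∀ t u → t * (+ 1 + + 2 * u - + 1) ≡ + 2 * (t * u)
    lem = solve-∀

Admissible : ℤ → Set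
Admissible x = Odd x × 3∤ x

-- A number prime to 6 is ±1 modulo 6, so x or -x has the form 6t - 1. Writing x = 3x - 2x combines
-- its residues modulo 2 and 3.
pentagonal : ∀ {x} → Admissible x → ∃[ t ] x * x ≡ + 24 * p₅ t + + 1
pentagonal {x} ((u , e) , n) = cases (trit x)
  where
  double-triple : ∀ x → x ≡ + 3 * x - + 2 * x
  double-triple = solve-∀
  cases : _ → ∃[ t ] x * x ≡ + 24 * p₅ t + + 1
  cases (v , inj₁ h) = contradiction (step v (trans h (trans (ℤ.*-comm (+ 3) v) (sym (ℤ.+-identityˡ _))))) n
  cases (v , inj₂ (inj₁ h)) = v - u , trans
      (cong (λ s → s * s) (trans (double-triple x) (cong₂ (λ s t → + 3 * s - + 2 * t) e h)))
      (trans (lem u v) (sym (p₅-square (v - u))))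
    where
    lem : ∀ u v → (+ 3 * (+ 1 + + 2 * u) - + 2 * (+ 1 + + 3 * v)) * (+ 3 * (+ 1 + + 2 * u) - + 2 * (+ 1 + + 3 * v))
        ≡ (+ 6 * (v - u) - + 1) * (+ 6 * (v - u) - + 1)
    lem = solve-∀
  cases (v , inj₂ (inj₂ h)) = u - v + + 1 , trans
      (cong (λ s → s * s) (trans (double-triple x) (cong₂ (λ s t → + 3 * s - + 2 * t) e h)))
      (trans (lem u v) (sym (p₅-square (u - v + + 1))))
    where
    lem : ∀ u v → (+ 3 * (+ 1 + + 2 * u) - + 2 * (- + 1 + + 3 * v))
        * (+ 3 * (+ 1 + + 2 * u) - + 2 * (- + 1 + + 3 * v)) ≡
        (+ 6 * (u - v + + 1) - + 1) * (+ 6 * (u - v + + 1) - + 1)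
    lem = solve-∀

Completed : ℤ → ℤ → ℤ → Set
Completed b c n = ∃[ x ] ∃[ y ] ∃[ z ] Admissible x × Admissible y × Admissible z × + 24 * n + (+ 1 + b + c) ≡
    x * x + b * (y * y) + c * (z * z)

uncomplete : ∀ {b c n} → Completed b c n → ∃[ x ] ∃[ y ] ∃[ z ] n ≡ p₅ x + b * p₅ y + c * p₅ z
uncomplete {b} {c} {n} (x , y , z , ax , ay , az , e) = from (pentagonal ax) (pentagonal ay) (pentagonal az)
  where
  from : _ → _ → _ → ∃[ x ] ∃[ y ] ∃[ z ] n ≡ p₅ x + b * p₅ y + c * p₅ z
  from (r , er) (s , es) (t , et) =
      r , s , t , ℤ.*-cancelˡ-≡ (+ 24) n _
      (trans (lem n (+ 1 + b + c)) (trans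
      (cong (_- (+ 1 + b + c)) (trans e (cong₂ _+_ (cong₂ _+_ er (cong (b *_) es)) (cong (c *_) et))))
      (lem₂ b c (p₅ r) (p₅ s) (p₅ t))))
    where
    lem : ∀ n k → + 24 * n ≡ + 24 * n + k - k
    lem = solve-∀
    lem₂ : ∀ b c r s t → + 24 * r + + 1 + b * (+ 24 * s + + 1) + c * (+ 24 * t + + 1) - (+ 1 + b + c) ≡
        + 24 * (r + b * s + c * t)
    lem₂ = solve-∀

-- Odd variables and variables prime to 3

odd-square : ∀ {x} → Odd x → ∃[ t ] x * x ≡ + 1 + + 8 * t
odd-square (u , refl) = cases (even-or-odd u)
  where
  cases : _ → ∃[ t ] (+ 1 + + 2 * u) * (+ 1 + + 2 * u) ≡ + 1 + + 8 * t
  cases (v , inj₁ refl) = v * (+ 1 + + 2 * v) , lem v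
    where
    lem : ∀ v → (+ 1 + + 2 * (+ 2 * v)) * (+ 1 + + 2 * (+ 2 * v)) ≡ + 1 + + 8 * (v * (+ 1 + + 2 * v))
    lem = solve-∀
  cases (v , inj₂ refl) = (+ 1 + + 2 * v) * (+ 1 + v) , lem v
    where
    lem : ∀ v → (+ 1 + + 2 * (+ 1 + + 2 * v)) * (+ 1 + + 2 * (+ 1 + + 2 * v)) ≡
        + 1 + + 8 * ((+ 1 + + 2 * v) * (+ 1 + v))
    lem = solve-∀

-- Multiplication by 1 - √-3, of norm 4, in ℤ[√-3]. The given norm is odd, so u and v have opposite
-- parity and both new components are odd.
odd-pair : ∀ u v w → u * u + + 3 * (v * v) ≡ + 1 + + 2 * w →
           ∃[ x ] ∃[ y ] Odd x × Odd y × + 4 * (u * u + + 3 * (v * v)) ≡ x * x + + 3 * (y * y)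
odd-pair u v w e = u + + 3 * v , u - v , x-odd , y-odd , lem u v
  where
  lem : ∀ u v → + 4 * (u * u + + 3 * (v * v)) ≡ (u + + 3 * v) * (u + + 3 * v) + + 3 * ((u - v) * (u - v))
  lem = solve-∀
  back : ∀ u v → u ≡ u - v + v
  back = solve-∀
  y-odd : Odd (u - v)
  y-odd = cases (even-or-odd (u - v))
    where
    cases : _ → Odd (u - v)
    cases (t , inj₂ h) = t , h
    cases (t , inj₁ h) = contradiction
        (trans (sym (trans (cong (λ s → s * s + + 3 * (v * v)) (trans (back u v) (cong (_+ v) h))) (lem′ t v))) e)
        (even≢odd (+ 2 * (t * t + t * v + v * v)) w)
      where
      lem′ : ∀ t v → (+ 2 * t + v) * (+ 2 * t + v) + + 3 * (v * v) ≡ + 2 * (+ 2 * (t * t + t * v + v * v))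
      lem′ = solve-∀
  x-odd : Odd (u + + 3 * v)
  x-odd = proj₁ y-odd + + 2 * v , trans (lem₁ u v) (trans (cong (_+ + 4 * v) (proj₂ y-odd)) (lem₂ (proj₁ y-odd) v))
    where
    lem₁ : ∀ u v → u + + 3 * v ≡ u - v + + 4 * v
    lem₁ = solve-∀
    lem₂ : ∀ t v → + 1 + + 2 * t + + 4 * v ≡ + 1 + + 2 * (t + + 2 * v)
    lem₂ = solve-∀

-- One of (x ± 3y)/2 + √-3 (x ∓ y)/2 has odd, the other even components.
Halves : ℤ → ℤ → Set
Halves x y =
  ∃[ u ] ∃[ v ] ∃[ s ] ∃[ t ] Odd u × Odd v × x * x + + 3 * (y * y) ≡ u * u + + 3 * (v * v) ×
    x * x + + 3 * (y * y) ≡ + 4 * (s * s) + + 12 * (t * t) ×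
    (x ≡ + 2 * v + y ⊎ x ≡ + 2 * v - y) × (x ≡ + 2 * u - + 3 * y ⊎ x ≡ + 2 * u + + 3 * y)

halve : ∀ {x y} → Odd x → Odd y → Halves x y
halve (u , refl) (v , refl) = cases (even-or-odd (u - v))
  where
  y = + 1 + + 2 * v
  back : ∀ u v → u ≡ u - v + v
  back = solve-∀
  cases : _ → Halves (+ 1 + + 2 * u) y
  cases (t , inj₂ h) = subst (λ u → Halves (+ 1 + + 2 * u) y) (sym (trans (back u v) (cong (_+ v) h)))
    ( + 1 + + 2 * (t + + 1 + + 2 * v) , + 1 + + 2 * t , t - v , t + v + + 1 , (t + + 1 + + 2 * v , refl) ,
        (t , refl) , lem₁ t v , lem₂ t v , inj₁ (lem₃ t v) , inj₁ (lem₄ t v))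
    where
    lem₁ : ∀ t v → (+ 1 + + 2 * (+ 1 + + 2 * t + v)) * (+ 1 + + 2 * (+ 1 + + 2 * t + v)) + + 3
        * ((+ 1 + + 2 * v) * (+ 1 + + 2 * v)) ≡
      (+ 1 + + 2 * (t + + 1 + + 2 * v)) * (+ 1 + + 2 * (t + + 1 + + 2 * v)) + + 3
          * ((+ 1 + + 2 * t) * (+ 1 + + 2 * t))
    lem₁ = solve-∀
    lem₂ : ∀ t v → (+ 1 + + 2 * (+ 1 + + 2 * t + v)) * (+ 1 + + 2 * (+ 1 + + 2 * t + v)) + + 3
        * ((+ 1 + + 2 * v) * (+ 1 + + 2 * v)) ≡
      + 4 * ((t - v) * (t - v)) + + 12 * ((t + v + + 1) * (t + v + + 1))
    lem₂ = solve-∀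
    lem₃ : ∀ t v → + 1 + + 2 * (+ 1 + + 2 * t + v) ≡ + 2 * (+ 1 + + 2 * t) + (+ 1 + + 2 * v)
    lem₃ = solve-∀
    lem₄ : ∀ t v → + 1 + + 2 * (+ 1 + + 2 * t + v) ≡ + 2 * (+ 1 + + 2 * (t + + 1 + + 2 * v)) - + 3 * (+ 1 + + 2 * v)
    lem₄ = solve-∀
  cases (t , inj₁ h) = subst (λ u → Halves (+ 1 + + 2 * u) y) (sym (trans (back u v) (cong (_+ v) h)))
    ( + 1 + + 2 * (t - v - + 1) , + 1 + + 2 * (t + v) , + 1 + t + + 2 * v , t , (t - v - + 1 , refl) ,
        (t + v , refl) , lem₁ t v , lem₂ t v , inj₂ (lem₃ t v) , inj₂ (lem₄ t v))
    where
    lem₁ : ∀ t v → (+ 1 + + 2 * (+ 2 * t + v)) * (+ 1 + + 2 * (+ 2 * t + v)) + + 3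
        * ((+ 1 + + 2 * v) * (+ 1 + + 2 * v)) ≡
      (+ 1 + + 2 * (t - v - + 1)) * (+ 1 + + 2 * (t - v - + 1)) + + 3
          * ((+ 1 + + 2 * (t + v)) * (+ 1 + + 2 * (t + v)))
    lem₁ = solve-∀
    lem₂ : ∀ t v → (+ 1 + + 2 * (+ 2 * t + v)) * (+ 1 + + 2 * (+ 2 * t + v)) + + 3
        * ((+ 1 + + 2 * v) * (+ 1 + + 2 * v)) ≡
      + 4 * ((+ 1 + t + + 2 * v) * (+ 1 + t + + 2 * v)) + + 12 * (t * t)
    lem₂ = solve-∀
    lem₃ : ∀ t v → + 1 + + 2 * (+ 2 * t + v) ≡ + 2 * (+ 1 + + 2 * (t + v)) - (+ 1 + + 2 * v)
    lem₃ = solve-∀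
    lem₄ : ∀ t v → + 1 + + 2 * (+ 2 * t + v) ≡ + 2 * (+ 1 + + 2 * (t - v - + 1)) + + 3 * (+ 1 + + 2 * v)
    lem₄ = solve-∀

3≈0 : ∀ y → + 3 * y ≈ + 0 [ + 3 ]
3≈0 y = step y (trans (ℤ.*-comm (+ 3) y) (sym (ℤ.+-identityˡ _)))

zero-or-not : ∀ x → x ≈ + 0 [ + 3 ] × (∃[ u ] x ≡ + 3 * u) ⊎ 3∤ x
zero-or-not x = cases (square-mod-3 x)
  where
  cases : _ → x ≈ + 0 [ + 3 ] × (∃[ u ] x ≡ + 3 * u) ⊎ 3∤ x
  cases (inj₁ (_ , u , e)) = inj₁ (subst (_≈ + 0 [ + 3 ]) (sym e) (3≈0 u) , u , e)
  cases (inj₂ e) = inj₂ (3∤-from-□ e)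

-- If 3 divides y, the odd halves replace x and y: twice u and twice v differ from x by multiples of
-- y, so they are prime to 3 together with x.
admissible-pair : ∀ {x y} → Admissible x → Odd y → ∃[ u ] ∃[ v ] Admissible u × Admissible v ×
    x * x + + 3 * (y * y) ≡ u * u + + 3 * (v * v)
admissible-pair {x} {y} (ox , nx) oy = cases (zero-or-not y)
  where
  cases : _ → ∃[ u ] ∃[ v ] Admissible u × Admissible v × x * x + + 3 * (y * y) ≡ u * u + + 3 * (v * v)
  cases (inj₂ ny) = x , y , (ox , nx) , (oy , ny) , refl
  cases (inj₁ (y≈0 , _)) = from (halve ox oy)
    where
    from : _ → ∃[ u ] ∃[ v ] Admissible u × Admissible v × x * x + + 3 * (y * y) ≡ u * u + + 3 * (v * v)
    from (u , v , _ , _ , ou , ov , e , _ , hv , hu) = u , v , (ou , nu hu) , (ov , nv hv) , e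
      where
      nu : _ → 3∤ u
      nu (inj₁ h) u≈0 = nx (≈-trans (≈-reflexive h) (≈-+ (≈-*ˡ (+ 2) u≈0) (≈-neg (3≈0 y))))
      nu (inj₂ h) u≈0 = nx (≈-trans (≈-reflexive h) (≈-+ (≈-*ˡ (+ 2) u≈0) (3≈0 y)))
      nv : _ → 3∤ v
      nv (inj₁ h) v≈0 = nx (≈-trans (≈-reflexive h) (≈-+ (≈-*ˡ (+ 2) v≈0) y≈0))
      nv (inj₂ h) v≈0 = nx (≈-trans (≈-reflexive h) (≈-+ (≈-*ˡ (+ 2) v≈0) (≈-neg y≈0)))

Odd-+even : ∀ {x} e → Odd x → Odd (x + + 2 * e)
Odd-+even e (u , refl) = u + e , lem u e
  where
  lem : ∀ u e → + 1 + + 2 * u + + 2 * e ≡ + 1 + + 2 * (u + e)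
  lem = solve-∀

Odd-neg : ∀ {x} → Odd x → Odd (- x)
Odd-neg (u , refl) = - u - + 1 , lem u
  where
  lem : ∀ u → - (+ 1 + + 2 * u) ≡ + 1 + + 2 * (- u - + 1)
  lem = solve-∀

-- x² + y² + 3z² ≡ 5 (mod 8) forces the parities (1, 1, 1), (1, 0, 0) or (0, 1, 0).
odd-113 : ∀ {n k} x y z → n ≡ x * x + y * y + + 3 * (z * z) → n ≡ + 5 + + 8 * k →
          ∃[ x ] ∃[ y ] ∃[ z ] Odd x × Odd y × Odd z × n ≡ x * x + y * y + + 3 * (z * z)
odd-113 {n} {k} x y z e e₅ = cases (even-or-odd x) (even-or-odd y) (even-or-odd z)
  where
  Result = ∃[ x ] ∃[ y ] ∃[ z ] Odd x × Odd y × Odd z × n ≡ x * x + y * y + + 3 * (z * z)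
  n-odd : n ≡ + 1 + + 2 * (+ 2 + + 4 * k)
  n-odd = trans e₅ (lem k)
    where
    lem : ∀ k → + 5 + + 8 * k ≡ + 1 + + 2 * (+ 2 + + 4 * k)
    lem = solve-∀
  parity-clash : ∀ {t} → x * x + y * y + + 3 * (z * z) ≡ + 2 * t → ⊥
  parity-clash {t} h = even≢odd t (+ 2 + + 4 * k) (trans (sym h) (trans (sym e) n-odd))
  one-odd : ∀ {x y z b c} → n ≡ x * x + y * y + + 3 * (z * z) → Odd x → y ≡ + 2 * b → z ≡ + 2 * c →
            ∃[ u ] ∃[ v ] Odd u × Odd v × n ≡ x * x + u * u + + 3 * (v * v)
  one-odd {x} {b = b} {c} e ox refl refl = from (odd-square ox)
    where
    from : _ → ∃[ u ] ∃[ v ] Odd u × Odd v × n ≡ x * x + u * u + + 3 * (v * v)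
    -- n - x² ≡ 4 (mod 8), so b² + 3c² is odd and `odd-pair` applies.
    from (t , x²) = pack (odd-pair b c (k - t)
        (ℤ.*-cancelˡ-≡ (+ 4) _ _ (trans (lem b c (x * x)) (trans (cong₂ _-_ (trans (sym e) e₅) x²) (lem₂ k t)))))
      where
      lem : ∀ b c q → + 4 * (b * b + + 3 * (c * c)) ≡ q + + 2 * b * (+ 2 * b) + + 3 * (+ 2 * c * (+ 2 * c)) - q
      lem = solve-∀
      lem₂ : ∀ k t → + 5 + + 8 * k - (+ 1 + + 8 * t) ≡ + 4 * (+ 1 + + 2 * (k - t))
      lem₂ = solve-∀
      lem₃ : ∀ b c q → q + + 2 * b * (+ 2 * b) + + 3 * (+ 2 * c * (+ 2 * c)) ≡ q + + 4 * (b * b + + 3 * (c * c))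
      lem₃ = solve-∀
      pack : _ → ∃[ u ] ∃[ v ] Odd u × Odd v × n ≡ x * x + u * u + + 3 * (v * v)
      pack (u , v , ou , ov , h) = u , v , ou , ov , trans e
          (trans (lem₃ b c (x * x)) (trans (cong (λ t → x * x + t) h)
          (sym (ℤ.+-assoc (x * x) (u * u) (+ 3 * (v * v))))))
  swap : ∀ a b c → a + b + c ≡ b + a + c
  swap = solve-∀
  cases : _ → _ → _ → Result
  cases (a , inj₂ hx) (b , inj₂ hy) (c , inj₂ hz) = x , y , z , (a , hx) , (b , hy) , (c , hz) , e
  cases (a , inj₂ hx) (b , inj₁ hy) (c , inj₁ hz) = from (one-odd e (a , hx) hy hz)
    where
    from : _ → Result
    from (u , v , ou , ov , h) = x , u , v , (a , hx) , ou , ov , h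
  cases (a , inj₁ hx) (b , inj₂ hy) (c , inj₁ hz) =
      from (one-odd (trans e (swap (x * x) (y * y) (+ 3 * (z * z)))) (b , hy) hx hz)
    where
    from : _ → Result
    from (u , v , ou , ov , h) = y , u , v , (b , hy) , ou , ov , h
  -- n - 3z² ≡ 2 (mod 8) would be a multiple of 4.
  cases (a , inj₁ refl) (b , inj₁ refl) (c , inj₂ hz) = from (odd-square (c , hz))
    where
    from : _ → Result
    from (t , z²) = contradiction (ℤ.*-cancelˡ-≡ (+ 2) (+ 2 * (a * a + b * b)) (+ 1 + + 2 * (+ 2 * (k - + 3 * t)))
        (trans (lem a b (z * z)) (trans (cong₂ (λ s t → s - + 3 * t) (trans (sym e) e₅) z²) (lem₂ k t))))
        (even≢odd (a * a + b * b) (+ 2 * (k - + 3 * t)))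
      where
      lem : ∀ a b q → + 2 * (+ 2 * (a * a + b * b)) ≡ + 2 * a * (+ 2 * a) + + 2 * b * (+ 2 * b) + + 3 * q - + 3 * q
      lem = solve-∀
      lem₂ : ∀ k t → + 5 + + 8 * k - + 3 * (+ 1 + + 8 * t) ≡ + 2 * (+ 1 + + 2 * (+ 2 * (k - + 3 * t)))
      lem₂ = solve-∀
  cases (a , inj₁ refl) (b , inj₁ refl) (c , inj₁ refl) = ⊥-elim (parity-clash (lem a b c))
    where
    lem : ∀ a b c → (+ 2 * a) * (+ 2 * a) + (+ 2 * b) * (+ 2 * b) + + 3 * ((+ 2 * c) * (+ 2 * c)) ≡
        + 2 * (+ 2 * (a * a) + + 2 * (b * b) + + 6 * (c * c))
    lem = solve-∀
  cases (a , inj₂ refl) (b , inj₂ refl) (c , inj₁ refl) = ⊥-elim (parity-clash (lem a b c))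
    where
    lem : ∀ a b c → (+ 1 + + 2 * a) * (+ 1 + + 2 * a) + (+ 1 + + 2 * b) * (+ 1 + + 2 * b) + + 3
        * ((+ 2 * c) * (+ 2 * c)) ≡ + 2 * (+ 1 + + 2 * (a + a * a) + + 2 * (b + b * b) + + 6 * (c * c))
    lem = solve-∀
  cases (a , inj₂ refl) (b , inj₁ refl) (c , inj₂ refl) = ⊥-elim (parity-clash (lem a b c))
    where
    lem : ∀ a b c → (+ 1 + + 2 * a) * (+ 1 + + 2 * a) + (+ 2 * b) * (+ 2 * b) + + 3
        * ((+ 1 + + 2 * c) * (+ 1 + + 2 * c)) ≡ + 2 * (+ 2 + + 2 * (a + a * a) + + 2 * (b * b) + + 6 * (c + c * c))
    lem = solve-∀
  cases (a , inj₁ refl) (b , inj₂ refl) (c , inj₂ refl) = ⊥-elim (parity-clash (lem a b c))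
    where
    lem : ∀ a b c → (+ 2 * a) * (+ 2 * a) + (+ 1 + + 2 * b) * (+ 1 + + 2 * b) + + 3
        * ((+ 1 + + 2 * c) * (+ 1 + + 2 * c)) ≡ + 2 * (+ 2 + + 2 * (a * a) + + 2 * (b + b * b) + + 6 * (c + c * c))
    lem = solve-∀

-- Modulo 8 the parities must be (1, 1, 1), (0, 1, 0) or (0, 0, 1). In the last two cases the even
-- pair is twice a pair of odd norm, which `odd-pair` makes odd.
odd-133 : ∀ {n k} x y z → n ≡ x * x + + 3 * (y * y) + + 3 * (z * z) → n ≡ + 7 + + 8 * k →
          ∃[ x ] ∃[ y ] ∃[ z ] Odd x × Odd y × Odd z × n ≡ x * x + + 3 * (y * y) + + 3 * (z * z)
odd-133 {n} {k} x y z e e₇ = cases (even-or-odd x) (even-or-odd y) (even-or-odd z)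
  where
  Result = ∃[ x ] ∃[ y ] ∃[ z ] Odd x × Odd y × Odd z × n ≡ x * x + + 3 * (y * y) + + 3 * (z * z)
  n-odd : n ≡ + 1 + + 2 * (+ 3 + + 4 * k)
  n-odd = trans e₇ (lem k)
    where
    lem : ∀ k → + 7 + + 8 * k ≡ + 1 + + 2 * (+ 3 + + 4 * k)
    lem = solve-∀
  parity-clash : ∀ {t} → x * x + + 3 * (y * y) + + 3 * (z * z) ≡ + 2 * t → ⊥
  parity-clash {t} h = even≢odd t (+ 3 + + 4 * k) (trans (sym h) (trans (sym e) n-odd))
  one-odd : ∀ {x y z b c} → n ≡ x * x + + 3 * (y * y) + + 3 * (z * z) → Odd y → x ≡ + 2 * b → z ≡ + 2 * c →
            ∃[ u ] ∃[ v ] Odd u × Odd v × n ≡ u * u + + 3 * (y * y) + + 3 * (v * v)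
  one-odd {y = y} {b = b} {c} e oy refl refl = from (odd-square oy)
    where
    from : _ → ∃[ u ] ∃[ v ] Odd u × Odd v × n ≡ u * u + + 3 * (y * y) + + 3 * (v * v)
    from (t , y²) = pack (odd-pair b c (k - + 3 * t)
        (ℤ.*-cancelˡ-≡ (+ 4) _ _ (trans (lem b c (y * y))
        (trans (cong₂ (λ s t → s - + 3 * t) (trans (sym e) e₇) y²) (lem₂ k t)))))
      where
      lem : ∀ b c q → + 4 * (b * b + + 3 * (c * c)) ≡ + 2 * b * (+ 2 * b) + + 3 * q + + 3 * (+ 2 * c * (+ 2 * c))
          - + 3 * q
      lem = solve-∀
      lem₂ : ∀ k t → + 7 + + 8 * k - + 3 * (+ 1 + + 8 * t) ≡ + 4 * (+ 1 + + 2 * (k - + 3 * t))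
      lem₂ = solve-∀
      lem₃ : ∀ b c q → + 2 * b * (+ 2 * b) + + 3 * q + + 3 * (+ 2 * c * (+ 2 * c)) ≡
          + 3 * q + + 4 * (b * b + + 3 * (c * c))
      lem₃ = solve-∀
      lem₄ : ∀ q u v → + 3 * q + (u + + 3 * v) ≡ u + + 3 * q + + 3 * v
      lem₄ = solve-∀
      pack : _ → ∃[ u ] ∃[ v ] Odd u × Odd v × n ≡ u * u + + 3 * (y * y) + + 3 * (v * v)
      pack (u , v , ou , ov , h) = u , v , ou , ov , trans e
          (trans (lem₃ b c (y * y)) (trans (cong (λ t → + 3 * (y * y) + t) h) (lem₄ (y * y) (u * u) (v * v))))
  swap : ∀ a b c → a + b + c ≡ a + c + b
  swap = solve-∀
  cases : _ → _ → _ → Result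
  cases (a , inj₂ hx) (b , inj₂ hy) (c , inj₂ hz) = x , y , z , (a , hx) , (b , hy) , (c , hz) , e
  cases (a , inj₁ hx) (b , inj₂ hy) (c , inj₁ hz) = from (one-odd e (b , hy) hx hz)
    where
    from : _ → Result
    from (u , v , ou , ov , h) = u , y , v , ou , (b , hy) , ov , h
  cases (a , inj₁ hx) (b , inj₁ hy) (c , inj₂ hz) =
      from (one-odd (trans e (swap (x * x) (+ 3 * (y * y)) (+ 3 * (z * z)))) (c , hz) hx hy)
    where
    from : _ → Result
    from (u , v , ou , ov , h) = u , z , v , ou , (c , hz) , ov , h
  cases (a , inj₂ hx) (b , inj₁ refl) (c , inj₁ refl) = from (odd-square (a , hx))
    where
    from : _ → Result
    from (t , x²) = contradiction (ℤ.*-cancelˡ-≡ (+ 2) (+ 2 * (+ 3 * (b * b + c * c)))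
        (+ 1 + + 2 * (+ 1 + + 2 * (k - t)))
        (trans (lem b c (x * x)) (trans (cong₂ _-_ (trans (sym e) e₇) x²) (lem₂ k t))))
        (even≢odd (+ 3 * (b * b + c * c)) (+ 1 + + 2 * (k - t)))
      where
      lem : ∀ b c q → + 2 * (+ 2 * (+ 3 * (b * b + c * c))) ≡
          q + + 3 * (+ 2 * b * (+ 2 * b)) + + 3 * (+ 2 * c * (+ 2 * c)) - q
      lem = solve-∀
      lem₂ : ∀ k t → + 7 + + 8 * k - (+ 1 + + 8 * t) ≡ + 2 * (+ 1 + + 2 * (+ 1 + + 2 * (k - t)))
      lem₂ = solve-∀
  cases (a , inj₁ refl) (b , inj₁ refl) (c , inj₁ refl) = ⊥-elim (parity-clash (lem a b c))
    where
    lem : ∀ a b c → (+ 2 * a) * (+ 2 * a) + + 3 * ((+ 2 * b) * (+ 2 * b)) + + 3 * ((+ 2 * c) * (+ 2 * c)) ≡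
        + 2 * (+ 2 * (a * a) + + 6 * (b * b) + + 6 * (c * c))
    lem = solve-∀
  cases (a , inj₂ refl) (b , inj₂ refl) (c , inj₁ refl) = ⊥-elim (parity-clash (lem a b c))
    where
    lem : ∀ a b c → (+ 1 + + 2 * a) * (+ 1 + + 2 * a) + + 3 * ((+ 1 + + 2 * b) * (+ 1 + + 2 * b)) + + 3
        * ((+ 2 * c) * (+ 2 * c)) ≡ + 2 * (+ 2 + + 2 * (a + a * a) + + 6 * (b + b * b) + + 6 * (c * c))
    lem = solve-∀
  cases (a , inj₂ refl) (b , inj₁ refl) (c , inj₂ refl) = ⊥-elim (parity-clash (lem a b c))
    where
    lem : ∀ a b c → (+ 1 + + 2 * a) * (+ 1 + + 2 * a) + + 3 * ((+ 2 * b) * (+ 2 * b)) + + 3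
        * ((+ 1 + + 2 * c) * (+ 1 + + 2 * c)) ≡ + 2 * (+ 2 + + 2 * (a + a * a) + + 6 * (b * b) + + 6 * (c + c * c))
    lem = solve-∀
  cases (a , inj₁ refl) (b , inj₂ refl) (c , inj₂ refl) = ⊥-elim (parity-clash (lem a b c))
    where
    lem : ∀ a b c → (+ 2 * a) * (+ 2 * a) + + 3 * ((+ 1 + + 2 * b) * (+ 1 + + 2 * b)) + + 3
        * ((+ 1 + + 2 * c) * (+ 1 + + 2 * c)) ≡ + 2 * (+ 3 + + 2 * (a * a) + + 6 * (b + b * b) + + 6 * (c + c * c))
    lem = solve-∀

-- The pairs (1, 3), (3, 3) and (3, 9)

mod-3 : ∀ {n r} k → n ≡ r + + 3 * k → n ≈ r [ + 3 ]
mod-3 {r = r} k e = step k (trans e (cong (λ t → r + t) (ℤ.*-comm (+ 3) k)))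

square≉2 : ∀ y → ¬ y * y ≈ + 2 [ + 3 ]
square≉2 y e = cases (square-mod-3 y)
  where
  cases : _ → ⊥
  cases (inj₁ (y²≈0 , _)) = 0≉1[3] (≈-trans (≈-*ˡ (+ 2) (≈-trans (≈-sym y²≈0) e)) (step (+ 1) refl))
  cases (inj₂ y²≈1) = 2≉1[3] (≈-trans (≈-sym e) y²≈1)

-- Otherwise y² would be 2 modulo 3.
3∤-of-sum-2 : ∀ {n} x y z → n ≡ x * x + y * y + + 3 * z → n ≈ + 2 [ + 3 ] → 3∤ x
3∤-of-sum-2 x y z e n≈2 x≈0 = square≉2 y
    (≈-trans (≈-sym (≈-trans (mod-3 z e)
    (≈-trans (≈-+ (≈-* x≈0 x≈0) ≈-refl) (≈-reflexive (ℤ.+-identityˡ (y * y)))))) n≈2)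

-- 24n + 5 ≡ 2 (mod 3) makes x and y prime to 3. Only z may fail, and it is repaired against y.
completed-1-3 : ∀ n → Completed (+ 1) (+ 3) (+ n)
completed-1-3 n = from (form-113-2-mod-3 (1 ℕ.+ 8 ℕ.* n))
  where
  N = + 24 * + n + + 5
  N≡ : + (2 ℕ.+ 3 ℕ.* (1 ℕ.+ 8 ℕ.* n)) ≡ N
  N≡ = trans (cong +_ (lem n)) (cong (_+ + 5) (ℤ.pos-* 24 n))
    where
    lem : ∀ n → 2 ℕ.+ 3 ℕ.* (1 ℕ.+ 8 ℕ.* n) ≡ 24 ℕ.* n ℕ.+ 5
    lem = solveℕ
  N≡5 : N ≡ + 5 + + 8 * (+ 3 * + n)
  N≡5 = lem (+ n)
    where
    lem : ∀ n → + 24 * n + + 5 ≡ + 5 + + 8 * (+ 3 * n)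
    lem = solve-∀
  N≈2 : N ≈ + 2 [ + 3 ]
  N≈2 = mod-3 (+ 1 + + 8 * + n) (lem (+ n))
    where
    lem : ∀ n → + 24 * n + + 5 ≡ + 2 + + 3 * (+ 1 + + 8 * n)
    lem = solve-∀
  from : _ → Completed (+ 1) (+ 3) (+ n)
  from (x , y , z , e) = adjust (odd-113 {N} {+ 3 * + n} x y z (trans (sym N≡) e) N≡5)
    where
    adjust : _ → Completed (+ 1) (+ 3) (+ n)
    adjust (x , y , z , ox , oy , oz , e) =
        pack (admissible-pair (oy , 3∤-of-sum-2 y x (z * z) (trans e (lem (x * x) (y * y) (+ 3 * (z * z)))) N≈2) oz)
      where
      lem : ∀ a b c → a + b + c ≡ b + a + c
      lem = solve-∀
      lem₂ : ∀ a b c → a + b + c ≡ a + (b + c)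
      lem₂ = solve-∀
      lem₃ : ∀ a b c → a + (b + c) ≡ a + + 1 * b + c
      lem₃ = solve-∀
      pack : _ → Completed (+ 1) (+ 3) (+ n)
      pack (u , v , au , av , h) = x , u , v , (ox , 3∤-of-sum-2 x y (z * z) e N≈2) , au , av ,
        trans e (trans (lem₂ (x * x) (y * y) (+ 3 * (z * z)))
            (trans (cong (λ t → x * x + t) h) (lem₃ (x * x) (u * u) (+ 3 * (v * v)))))

-- 24n + 7 ≡ 1 (mod 3) makes x prime to 3; then y and z are repaired in turn, each against the
-- current x.
completed-3-3 : ∀ n → Completed (+ 3) (+ 3) (+ n)
completed-3-3 n = from (form-133 n)
  where
  N = + 24 * + n + + 7
  N≡ : + (7 ℕ.+ 24 ℕ.* n) ≡ N
  N≡ = trans (cong +_ (ℕ.+-comm 7 (24 ℕ.* n))) (cong (_+ + 7) (ℤ.pos-* 24 n))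
  N≡7 : N ≡ + 7 + + 8 * (+ 3 * + n)
  N≡7 = lem (+ n)
    where
    lem : ∀ n → + 24 * n + + 7 ≡ + 7 + + 8 * (+ 3 * n)
    lem = solve-∀
  N≈1 : N ≈ + 1 [ + 3 ]
  N≈1 = mod-3 (+ 2 + + 8 * + n) (lem (+ n))
    where
    lem : ∀ n → + 24 * n + + 7 ≡ + 1 + + 3 * (+ 2 + + 8 * n)
    lem = solve-∀
  from : _ → Completed (+ 3) (+ 3) (+ n)
  from (x , y , z , e) = adjust (odd-133 {N} {+ 3 * + n} x y z (trans (sym N≡) e) N≡7)
    where
    adjust : _ → Completed (+ 3) (+ 3) (+ n)
    adjust (x , y , z , ox , oy , oz , e) = first (admissible-pair (ox , nx) oy)
      where
      lem : ∀ a b c → a + + 3 * b + + 3 * c ≡ a + + 3 * (b + c)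
      lem = solve-∀
      nx : 3∤ x
      nx = 3∤-from-□ (≈-trans (≈-sym (mod-3 (y * y + z * z) (trans e (lem (x * x) (y * y) (z * z))))) N≈1)
      lem₂ : ∀ a b c → a + b + c ≡ a + c + b
      lem₂ = solve-∀
      first : _ → Completed (+ 3) (+ 3) (+ n)
      first (u , v , au , av , h) = second (admissible-pair au oz)
        where
        second : _ → Completed (+ 3) (+ 3) (+ n)
        second (w , t , aw , at , h′) = w , v , t , aw , av , at ,
          trans e (trans (cong (_+ + 3 * (z * z)) h)
              (trans (lem₂ (u * u) (+ 3 * (v * v)) (+ 3 * (z * z)))
              (trans (cong (_+ + 3 * (v * v)) h′) (lem₂ (w * w) (+ 3 * (t * t)) (+ 3 * (v * v))))))

-- 24n + 13 = x² + y² + 3z² with x² + y² ≡ 1 (mod 3), so exactly one of x, y is a multiple of 3 and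
-- supplies the term with coefficient 9. Then z is repaired against x, and the ninth-term variable
-- against z by x² + 3(z² + 3y²).
completed-3-9 : ∀ n → Completed (+ 3) (+ 9) (+ n)
completed-3-9 n = from (form-113-13-mod-24 n)
  where
  N = + 24 * + n + + 13
  N≡ : + (13 ℕ.+ 24 ℕ.* n) ≡ N
  N≡ = trans (cong +_ (ℕ.+-comm 13 (24 ℕ.* n))) (cong (_+ + 13) (ℤ.pos-* 24 n))
  N≡5 : N ≡ + 5 + + 8 * (+ 1 + + 3 * + n)
  N≡5 = lem (+ n)
    where
    lem : ∀ n → + 24 * n + + 13 ≡ + 5 + + 8 * (+ 1 + + 3 * n)
    lem = solve-∀
  N≈1 : N ≈ + 1 [ + 3 ]
  N≈1 = mod-3 (+ 4 + + 8 * + n) (lem (+ n))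
    where
    lem : ∀ n → + 24 * n + + 13 ≡ + 1 + + 3 * (+ 4 + + 8 * n)
    lem = solve-∀
  finish : ∀ {x y z} y′ → Odd x → Odd y → Odd z → 3∤ x → y ≡ + 3 * y′ → N ≡ x * x + y * y + + 3 * (z * z) →
      Completed (+ 3) (+ 9) (+ n)
  finish {x} {z = z} y′ ox oy oz nx refl e = first (admissible-pair (ox , nx) oz)
    where
    oy′ : Odd y′
    oy′ = cases (even-or-odd y′)
      where
      lem : ∀ u → + 3 * (+ 2 * u) ≡ + 2 * (+ 3 * u)
      lem = solve-∀
      cases : _ → Odd y′
      cases (u , inj₂ h) = u , h
      cases (u , inj₁ h) = contradiction (trans (sym (trans (cong (+ 3 *_) h) (lem u))) (proj₂ oy))
          (even≢odd (+ 3 * u) (proj₁ oy))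
    lem₁ : ∀ a y c → a + + 3 * y * (+ 3 * y) + c ≡ a + c + + 9 * (y * y)
    lem₁ = solve-∀
    lem₂ : ∀ a b c → a + + 3 * b + + 9 * c ≡ a + + 3 * (b + + 3 * c)
    lem₂ = solve-∀
    first : _ → Completed (+ 3) (+ 9) (+ n)
    first (u , v , au , av , h) = second (admissible-pair av oy′)
      where
      second : _ → Completed (+ 3) (+ 9) (+ n)
      second (w , t , aw , at , h′) = u , w , t , au , aw , at ,
        trans e (trans (lem₁ (x * x) y′ (+ 3 * (z * z)))
            (trans (cong (_+ + 9 * (y′ * y′)) h)
            (trans (lem₂ (u * u) (v * v) (y′ * y′))
            (trans (cong (λ s → u * u + + 3 * s) h′) (sym (lem₂ (u * u) (w * w) (t * t)))))))
  from : _ → Completed (+ 3) (+ 9) (+ n)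
  from (x , y , z , e) = adjust (odd-113 {N} {+ 1 + + 3 * + n} x y z (trans (sym N≡) e) N≡5)
    where
    adjust : _ → Completed (+ 3) (+ 9) (+ n)
    adjust (x , y , z , ox , oy , oz , e) = cases (zero-or-not x) (zero-or-not y)
      where
      x²+y²≈1 : x * x + y * y ≈ + 1 [ + 3 ]
      x²+y²≈1 = ≈-trans (≈-sym (mod-3 (z * z) e)) N≈1
      lem : ∀ a b c → a + b + c ≡ b + a + c
      lem = solve-∀
      cases : _ → _ → Completed (+ 3) (+ 9) (+ n)
      cases (inj₂ nx) (inj₁ (_ , y′ , h)) = finish y′ ox oy oz nx h e
      cases (inj₁ (_ , x′ , h)) (inj₂ ny) = finish x′ oy ox oz ny h (trans e (lem (x * x) (y * y) (+ 3 * (z * z))))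
      cases (inj₁ (x≈0 , _)) (inj₁ (y≈0 , _)) =
          contradiction (≈-trans (≈-sym (≈-+ (≈-* x≈0 x≈0) (≈-* y≈0 y≈0))) x²+y²≈1) 0≉1[3]
      cases (inj₂ nx) (inj₂ ny) = contradiction (≈-trans (≈-sym (≈-+ (3∤-* nx) (3∤-* ny))) x²+y²≈1) 2≉1[3]

-- The modulus is written r + suc e to make r smaller than it; a negative quotient would then push
-- the sum below 0.
nonneg-quotient : ∀ r e {s} d → + 0 ≤ s → s ≡ + r + + (r ℕ.+ suc e) * d → ∃[ k ] d ≡ + k
nonneg-quotient r e (+ k) _ _ = k , refl
nonneg-quotient r e {+ m} -[1+ k ] _ h =
    contradiction (trans (cong (_+ + ((r ℕ.+ suc e) ℕ.* suc k)) h)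
    (trans (cong (λ t → + r + + (r ℕ.+ suc e) * -[1+ k ] + t) (ℤ.pos-* (r ℕ.+ suc e) (suc k)))
    (lem (+ r) (+ (r ℕ.+ suc e)) (+ suc k)))) (positive m)
  where
  lem : ∀ r q k → r + q * - k + q * k ≡ r
  lem = solve-∀
  bound : suc r ℕ.≤ (r ℕ.+ suc e) ℕ.* suc k
  bound = ℕ.≤-trans (ℕ.≤-trans (ℕ.≤-reflexive (ℕ.+-comm 1 r)) (ℕ.+-monoʳ-≤ r (s≤s z≤n)))
      (ℕ.m≤m*n (r ℕ.+ suc e) (suc k))
  positive : ∀ m → + m + + ((r ℕ.+ suc e) ℕ.* suc k) ≢ + r
  positive m h = ℕ.<⇒≢ (ℕ.≤-trans bound (ℕ.m≤n+m _ m)) (sym (ℤ.+-injective h))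

-- Multiplication by 1 + qc maps the residue class of r modulo q to itself, so a number of the
-- class divisible by 1 + qc has its quotient in the class.
module Descent (r e c : ℕ) (1≤r : 1 ℕ.≤ r) (1≤c : 1 ℕ.≤ c) (P : ℤ → Set)
  (dichotomy : ∀ n → P (+ (r ℕ.+ (r ℕ.+ suc e) ℕ.* n)) ⊎ (∃[ m ] + 0 ≤ m × + (r ℕ.+ (r ℕ.+ suc e) ℕ.* n) ≡
      (+ 1 + + (r ℕ.+ suc e) * + c) * m))
  (scale : ∀ {m} → P m → P ((+ 1 + + (r ℕ.+ suc e) * + c) * m)) where

  q : ℕ
  q = r ℕ.+ suc e

  cast : ∀ n → + (r ℕ.+ q ℕ.* n) ≡ + r + + q * + n
  cast n = cong (λ t → + r + t) (ℤ.pos-* q n)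

  smaller : ∀ n m → + 0 ≤ m → + (r ℕ.+ q ℕ.* n) ≡ (+ 1 + + q * + c) * m → ∃[ k ] k ℕ.< n × m ≡ + (r ℕ.+ q ℕ.* k)
  smaller n m 0≤m h = from (nonneg-quotient r e (+ n - + c * m) 0≤m m≡)
    where
    lem : ∀ q c m → m ≡ (+ 1 + q * c) * m - q * (c * m)
    lem = solve-∀
    lem₂ : ∀ r q n x → r + q * n - q * x ≡ r + q * (n - x)
    lem₂ = solve-∀
    m≡ : m ≡ + r + + q * (+ n - + c * m)
    m≡ = trans (lem (+ q) (+ c) m) (trans (cong (_- + q * (+ c * m)) (trans (sym h) (cast n)))
        (lem₂ (+ r) (+ q) (+ n) (+ c * m)))
    from : (∃[ k ] + n - + c * m ≡ + k) → ∃[ k ] k ℕ.< n × m ≡ + (r ℕ.+ q ℕ.* k)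
    from (k , k≡) = k , ℕ.≤-trans (ℕ.m<m+n k (ℕ.*-mono-≤ 1≤c (ℕ.≤-trans 1≤r (ℕ.m≤m+n r (q ℕ.* k)))))
        (ℕ.≤-reflexive (sym n≡)) , mk
      where
      mk : m ≡ + (r ℕ.+ q ℕ.* k)
      mk = trans m≡ (trans (cong (λ t → + r + + q * t) k≡) (sym (cast k)))
      lem₃ : ∀ n x → n ≡ n - x + x
      lem₃ = solve-∀
      -- n exceeds k by cm, where c and m = r + qk are at least 1.
      n≡ : n ≡ k ℕ.+ c ℕ.* (r ℕ.+ q ℕ.* k)
      n≡ = ℤ.+-injective (trans (lem₃ (+ n) (+ c * m))
          (cong₂ _+_ k≡ (trans (cong (+ c *_) mk) (sym (ℤ.pos-* c (r ℕ.+ q ℕ.* k))))))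

  all : ∀ n → P (+ (r ℕ.+ q ℕ.* n))
  all n = go n (<-wellFounded n)
    where
    go : ∀ n → Acc ℕ._<_ n → P (+ (r ℕ.+ q ℕ.* n))
    go n (acc rec) = cases (dichotomy n)
      where
      cases : _ → P (+ (r ℕ.+ q ℕ.* n))
      cases (inj₁ p) = p
      cases (inj₂ (m , 0≤m , h)) = from (smaller n m 0≤m h)
        where
        from : _ → P (+ (r ℕ.+ q ℕ.* n))
        from (k , k<n , m≡) = subst P (sym h) (scale (subst P (sym m≡) (go k (rec k<n))))

-- Representations with an odd variable, and the pair (3, 4)

OddForm113 : ℤ → Set
OddForm113 n = ∃[ x ] ∃[ y ] ∃[ z ] (Odd x ⊎ Odd y ⊎ Odd z) × n ≡ x * x + y * y + + 3 * (z * z)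

-- Multiplication by 1 - √-3 on (y, z) and doubling x works if y - z is odd, and symmetrically for x
-- - z. Otherwise all variables are odd, and x² + 3z² is first rewritten with even variables by
-- `halve`, so that the difference becomes odd.
OddForm113-4* : ∀ {n} → OddForm113 n → OddForm113 (+ 4 * n)
OddForm113-4* {n} (x , y , z , o , e) = cases (even-or-odd (x - z)) (even-or-odd (y - z))
  where
  back : ∀ u v → u ≡ u - v + v
  back = solve-∀
  lift : ∀ {x y z} → Odd (y - z) → n ≡ x * x + y * y + + 3 * (z * z) → OddForm113 (+ 4 * n)
  lift {x} {y} {z} o e = + 2 * x , y + + 3 * z , y - z , inj₂ (inj₂ o) , trans (cong (+ 4 *_) e) (lem x y z)
    where
    lem : ∀ x y z → + 4 * (x * x + y * y + + 3 * (z * z)) ≡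
        + 2 * x * (+ 2 * x) + (y + + 3 * z) * (y + + 3 * z) + + 3 * ((y - z) * (y - z))
    lem = solve-∀
  swap : ∀ a b c → a + b + c ≡ b + a + c
  swap = solve-∀
  cases : _ → _ → OddForm113 (+ 4 * n)
  cases _ (t , inj₂ h) = lift {x} {y} {z} (t , h) e
  cases (t , inj₂ h) _ = lift {y} {x} {z} (t , h) (trans e (swap (x * x) (y * y) (+ 3 * (z * z))))
  cases (t , inj₁ h) (t′ , inj₁ h′) = all-odd (z-odd o)
    where
    x≡ : x ≡ + 2 * t + z
    x≡ = trans (back x z) (cong (_+ z) h)
    y≡ : y ≡ + 2 * t′ + z
    y≡ = trans (back y z) (cong (_+ z) h′)
    transfer : ∀ {w} s → w ≡ + 2 * s + z → Odd w → Odd z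
    transfer {w} s w≡ (u , hu) = u - s , trans (lem₁ s z) (trans (cong (_- + 2 * s) (trans (sym w≡) hu)) (lem₂ u s))
      where
      lem₁ : ∀ s z → z ≡ + 2 * s + z - + 2 * s
      lem₁ = solve-∀
      lem₂ : ∀ u s → + 1 + + 2 * u - + 2 * s ≡ + 1 + + 2 * (u - s)
      lem₂ = solve-∀
    z-odd : _ → Odd z
    z-odd (inj₁ ox) = transfer t x≡ ox
    z-odd (inj₂ (inj₁ oy)) = transfer t′ y≡ oy
    z-odd (inj₂ (inj₂ oz)) = oz
    all-odd : Odd z → OddForm113 (+ 4 * n)
    all-odd oz = from (halve (subst Odd (trans (ℤ.+-comm z (+ 2 * t)) (sym x≡)) (Odd-+even t oz)) oz)
      where
      oy : Odd y
      oy = subst Odd (trans (ℤ.+-comm z (+ 2 * t′)) (sym y≡)) (Odd-+even t′ oz)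
      from : _ → OddForm113 (+ 4 * n)
      from (_ , _ , s , w , _ , _ , _ , h″ , _) =
          lift {+ 2 * s} {y} {+ 2 * w} (subst Odd (lem₂ y w) (Odd-+even (- w) oy))
          (trans e (trans (lem (x * x) (y * y) (+ 3 * (z * z))) (trans (cong (λ t → y * y + t) h″) (lem₃ s y w))))
        where
        lem : ∀ a b c → a + b + c ≡ b + (a + c)
        lem = solve-∀
        lem₂ : ∀ y w → y + + 2 * - w ≡ y - + 2 * w
        lem₂ = solve-∀
        lem₃ : ∀ s y w → y * y + (+ 4 * (s * s) + + 12 * (w * w)) ≡
            + 2 * s * (+ 2 * s) + y * y + + 3 * (+ 2 * w * (+ 2 * w))
        lem₃ = solve-∀

-- Three even variables allow division by 4 = 1 + 3·1, which preserves the class of 2 modulo 3.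
odd-form-113 : ∀ i → OddForm113 (+ (2 ℕ.+ 3 ℕ.* i))
odd-form-113 = Descent.all 2 0 1 (s≤s z≤n) (s≤s z≤n) OddForm113 dichotomy OddForm113-4*
  where
  dichotomy : ∀ i → OddForm113 (+ (2 ℕ.+ 3 ℕ.* i)) ⊎ (∃[ m ] + 0 ≤ m × + (2 ℕ.+ 3 ℕ.* i) ≡ + 4 * m)
  dichotomy i = from (form-113-2-mod-3 i)
    where
    from : _ → OddForm113 (+ (2 ℕ.+ 3 ℕ.* i)) ⊎ (∃[ m ] + 0 ≤ m × + (2 ℕ.+ 3 ℕ.* i) ≡ + 4 * m)
    from (x , y , z , e) = cases (even-or-odd x) (even-or-odd y) (even-or-odd z)
      where
      cases : _ → _ → _ → OddForm113 (+ (2 ℕ.+ 3 ℕ.* i)) ⊎ (∃[ m ] + 0 ≤ m × + (2 ℕ.+ 3 ℕ.* i) ≡ + 4 * m)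
      cases (a , inj₂ o) _ _ = inj₁ (x , y , z , inj₁ (a , o) , e)
      cases _ (b , inj₂ o) _ = inj₁ (x , y , z , inj₂ (inj₁ (b , o)) , e)
      cases _ _ (c , inj₂ o) = inj₁ (x , y , z , inj₂ (inj₂ (c , o)) , e)
      cases (a , inj₁ hx) (b , inj₁ hy) (c , inj₁ hz) =
          inj₂ (a * a + b * b + + 3 * (c * c) , ℤ.+-mono-≤ (ℤ.+-mono-≤ (0≤□ a) (0≤□ b))
          (ℤ.*-monoˡ-≤-nonNeg (+ 3) (0≤□ c)) ,
        trans e (trans (cong₂ _+_ (cong₂ _+_ (cong (λ t → t * t) hx) (cong (λ t → t * t) hy))
            (cong (λ t → + 3 * (t * t)) hz)) (lem a b c)))
        where
        lem : ∀ a b c → + 2 * a * (+ 2 * a) + + 2 * b * (+ 2 * b) + + 3 * (+ 2 * c * (+ 2 * c)) ≡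
            + 4 * (a * a + b * b + + 3 * (c * c))
        lem = solve-∀

-- 24n + 8 = 4(6n + 2). In 6n + 2 = x² + y² + 3z² with x odd, y² + 3z² is odd, and four times it is
-- u² + 3v² with u, v odd. The total is u² + x² modulo 3 and congruent to 2, so u and x are prime to
-- 3.
completed-3-4 : ∀ n → Completed (+ 3) (+ 4) (+ n)
completed-3-4 n = from (odd-form-113 (2 ℕ.* n))
  where
  N = + 2 + + 6 * + n
  N≡ : + (2 ℕ.+ 3 ℕ.* (2 ℕ.* n)) ≡ N
  N≡ = trans (cong +_ (lem n)) (cong (λ t → + 2 + t) (ℤ.pos-* 6 n))
    where
    lem : ∀ n → 2 ℕ.+ 3 ℕ.* (2 ℕ.* n) ≡ 2 ℕ.+ 6 ℕ.* n
    lem = solveℕ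
  finish : ∀ {x y z} → Odd x → N ≡ x * x + y * y + + 3 * (z * z) → Completed (+ 3) (+ 4) (+ n)
  finish {x} {y} {z} (a , refl) e = first (odd-pair y z w rest)
    where
    w = + 3 * + n - + 2 * (a * a) - + 2 * a
    lem₁ : ∀ a y z → y * y + + 3 * (z * z) ≡
        (+ 1 + + 2 * a) * (+ 1 + + 2 * a) + y * y + + 3 * (z * z) - (+ 1 + + 2 * a) * (+ 1 + + 2 * a)
    lem₁ = solve-∀
    lem₂ : ∀ n a → + 2 + + 6 * n - (+ 1 + + 2 * a) * (+ 1 + + 2 * a) ≡
        + 1 + + 2 * (+ 3 * n - + 2 * (a * a) - + 2 * a)
    lem₂ = solve-∀
    rest : y * y + + 3 * (z * z) ≡ + 1 + + 2 * w
    rest = trans (lem₁ a y z) (trans (cong (_- (+ 1 + + 2 * a) * (+ 1 + + 2 * a)) (sym e)) (lem₂ (+ n) a))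
    first : _ → Completed (+ 3) (+ 4) (+ n)
    first (u , v , ou , ov , h) = second (admissible-pair (ou , 3∤-of-sum-2 u x _ sum N₄≈2) ov)
      where
      N₄ = + 24 * + n + + 8
      N₄≡ : N₄ ≡ u * u + + 3 * (v * v) + + 4 * (x * x)
      N₄≡ = trans (lem₃ (+ n)) (trans (cong (+ 4 *_) e)
          (trans (lem₄ (x * x) (y * y) (z * z)) (cong (_+ + 4 * (x * x)) h)))
        where
        lem₃ : ∀ n → + 24 * n + + 8 ≡ + 4 * (+ 2 + + 6 * n)
        lem₃ = solve-∀
        lem₄ : ∀ a b c → + 4 * (a + b + + 3 * c) ≡ + 4 * (b + + 3 * c) + + 4 * a
        lem₄ = solve-∀
      N₄≈2 : N₄ ≈ + 2 [ + 3 ]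
      N₄≈2 = mod-3 (+ 2 + + 8 * + n) (lem (+ n))
        where
        lem : ∀ n → + 24 * n + + 8 ≡ + 2 + + 3 * (+ 2 + + 8 * n)
        lem = solve-∀
      sum : N₄ ≡ u * u + x * x + + 3 * (v * v + x * x)
      sum = trans N₄≡ (lem (u * u) (v * v) (x * x))
        where
        lem : ∀ u v x → u + + 3 * v + + 4 * x ≡ u + x + + 3 * (v + x)
        lem = solve-∀
      sum′ : N₄ ≡ x * x + u * u + + 3 * (v * v + x * x)
      sum′ = trans sum (cong (_+ + 3 * (v * v + x * x)) (ℤ.+-comm (u * u) (x * x)))
      second : _ → Completed (+ 3) (+ 4) (+ n)
      second (s , t , as , at , h′) = s , t , x , as , at , ((a , refl) , 3∤-of-sum-2 x u _ sum′ N₄≈2) , trans N₄≡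
          (cong (_+ + 4 * (x * x)) h′)
  swap : ∀ a b c → a + b + c ≡ b + a + c
  swap = solve-∀
  from : OddForm113 (+ (2 ℕ.+ 3 ℕ.* (2 ℕ.* n))) → Completed (+ 3) (+ 4) (+ n)
  from (x , y , z , o , e) = cases o
    where
    e′ : N ≡ x * x + y * y + + 3 * (z * z)
    e′ = trans (sym N≡) e
    cases : _ → Completed (+ 3) (+ 4) (+ n)
    cases (inj₁ ox) = finish {x} {y} {z} ox e′
    cases (inj₂ (inj₁ oy)) = finish {y} {x} {z} oy (trans e′ (swap (x * x) (y * y) (+ 3 * (z * z))))
    -- 6n + 2 is even, so an odd z forces one of x, y to be odd.
    cases (inj₂ (inj₂ (c , hz))) = parities (even-or-odd x) (even-or-odd y)
      where
      parities : _ → _ → Completed (+ 3) (+ 4) (+ n)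
      parities (a , inj₂ hx) _ = finish {x} {y} {z} (a , hx) e′
      parities _ (b , inj₂ hy) = finish {y} {x} {z} (b , hy) (trans e′ (swap (x * x) (y * y) (+ 3 * (z * z))))
      parities (a , inj₁ hx) (b , inj₁ hy) =
          contradiction (trans (lem (+ n))
          (trans e′ (trans (cong₂ _+_ (cong₂ _+_ (cong (λ t → t * t) hx) (cong (λ t → t * t) hy))
          (cong (λ t → + 3 * (t * t)) hz)) (lem₂ a b c))))
          (even≢odd (+ 1 + + 3 * + n) (+ 2 * (a * a) + + 2 * (b * b) + + 1 + + 6 * (c + c * c)))
        where
        lem : ∀ n → + 2 * (+ 1 + + 3 * n) ≡ + 2 + + 6 * n
        lem = solve-∀
        lem₂ : ∀ a b c → + 2 * a * (+ 2 * a) + + 2 * b * (+ 2 * b) + + 3 * ((+ 1 + + 2 * c) * (+ 1 + + 2 * c)) ≡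
            + 1 + + 2 * (+ 2 * (a * a) + + 2 * (b * b) + + 1 + + 6 * (c + c * c))
        lem₂ = solve-∀

-- Sums of three squares not all divisible by 9

Squares3∤ : ℤ → Set
Squares3∤ n = ∃[ x ] ∃[ y ] ∃[ z ] (3∤ x ⊎ 3∤ y ⊎ 3∤ z) × n ≡ x * x + y * y + z * z

-- The rotation (x + 2y + 2z, 2x + y - 2z, 2x - 2y + z)/3.
Squares3∤-9* : ∀ {n} → Squares3∤ n → Squares3∤ (+ 9 * n)
Squares3∤-9* {n} (x , y , z , nd , e) =
    cases (zero-or-not (x + + 2 * y + + 2 * z)) (zero-or-not (x + + 2 * - y + + 2 * z))
    (zero-or-not (x + + 2 * y + + 2 * - z))
  where
  rotate : ∀ {x y z} → 3∤ (x + + 2 * y + + 2 * z) → n ≡ x * x + y * y + z * z → Squares3∤ (+ 9 * n)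
  rotate {x} {y} {z} nd e = x + + 2 * y + + 2 * z , + 2 * x + y - + 2 * z , + 2 * x - + 2 * y + z , inj₁ nd , trans
      (cong (+ 9 *_) e) (lem x y z)
    where
    lem : ∀ x y z → + 9 * (x * x + y * y + z * z) ≡
        (x + + 2 * y + + 2 * z) * (x + + 2 * y + + 2 * z) + (+ 2 * x + y - + 2 * z) * (+ 2 * x + y - + 2 * z)
        + (+ 2 * x - + 2 * y + z) * (+ 2 * x - + 2 * y + z)
    lem = solve-∀
  neg² : ∀ x → x * x ≡ - x * - x
  neg² = solve-∀
  cases : _ → _ → _ → Squares3∤ (+ 9 * n)
  cases (inj₂ k) _ _ = rotate {x} {y} {z} k e
  cases _ (inj₂ k) _ = rotate {x} { - y} {z} k (trans e (cong (λ t → x * x + t + z * z) (neg² y)))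
  cases _ _ (inj₂ k) = rotate {x} {y} { - z} k (trans e (cong (λ t → x * x + y * y + t) (neg² z)))
  cases (inj₁ (p≈0 , _)) (inj₁ (q≈0 , _)) (inj₁ (r≈0 , _)) = ⊥-elim (impossible nd)
    where
    -- The two sums differ by 4y, which is y modulo 3; z is treated likewise.
    y≈0 : y ≈ + 0 [ + 3 ]
    y≈0 = ≈-trans (step (- y) (lem x y z)) (≈-+ p≈0 (≈-neg q≈0))
      where
      lem : ∀ x y z → y ≡ (x + + 2 * y + + 2 * z) + - (x + + 2 * - y + + 2 * z) + - y * + 3
      lem = solve-∀
    z≈0 : z ≈ + 0 [ + 3 ]
    z≈0 = ≈-trans (step (- z) (lem x y z)) (≈-+ p≈0 (≈-neg r≈0))
      where
      lem : ∀ x y z → z ≡ (x + + 2 * y + + 2 * z) + - (x + + 2 * y + + 2 * - z) + - z * + 3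
      lem = solve-∀
    x≈0 : x ≈ + 0 [ + 3 ]
    x≈0 = ≈-trans (≈-reflexive (lem x y z)) (≈-+ p≈0 (≈-+ (≈-*ˡ (- + 2) y≈0) (≈-*ˡ (- + 2) z≈0)))
      where
      lem : ∀ x y z → x ≡ (x + + 2 * y + + 2 * z) + (- + 2 * y + - + 2 * z)
      lem = solve-∀
    impossible : _ → ⊥
    impossible (inj₁ k) = k x≈0
    impossible (inj₂ (inj₁ k)) = k y≈0
    impossible (inj₂ (inj₂ k)) = k z≈0

squares-dichotomy : ∀ {n} → (∃[ x ] ∃[ y ] ∃[ z ] n ≡ x * x + y * y + z * z) →
    Squares3∤ n ⊎ (∃[ m ] + 0 ≤ m × n ≡ + 9 * m)
squares-dichotomy {n} (x , y , z , e) = cases (zero-or-not x) (zero-or-not y) (zero-or-not z)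
  where
  cases : _ → _ → _ → Squares3∤ n ⊎ (∃[ m ] + 0 ≤ m × n ≡ + 9 * m)
  cases (inj₂ k) _ _ = inj₁ (x , y , z , inj₁ k , e)
  cases _ (inj₂ k) _ = inj₁ (x , y , z , inj₂ (inj₁ k) , e)
  cases _ _ (inj₂ k) = inj₁ (x , y , z , inj₂ (inj₂ k) , e)
  cases (inj₁ (_ , a , hx)) (inj₁ (_ , b , hy)) (inj₁ (_ , c , hz)) =
      inj₂ (a * a + b * b + c * c , ℤ.+-mono-≤ (ℤ.+-mono-≤ (0≤□ a) (0≤□ b)) (0≤□ c) ,
    trans e (trans (cong₂ _+_ (cong₂ _+_ (cong (λ t → t * t) hx) (cong (λ t → t * t) hy)) (cong (λ t → t * t) hz))
        (lem a b c)))
    where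
    lem : ∀ a b c → + 3 * a * (+ 3 * a) + + 3 * b * (+ 3 * b) + + 3 * c * (+ 3 * c) ≡ + 9 * (a * a + b * b + c * c)
    lem = solve-∀

-- The descent through 9 keeps the class, as 9 = 1 + 4·2; for the class of 3 modulo 8 below, 9 = 1 +
-- 8·1.
squares3∤-1-mod-4 : ∀ n → Squares3∤ (+ (1 ℕ.+ 4 ℕ.* n))
squares3∤-1-mod-4 = Descent.all 1 2 2 (s≤s z≤n) (s≤s z≤n) Squares3∤ (λ n →
    squares-dichotomy (three-squares-1-mod-4 n)) Squares3∤-9*

squares3∤-3-mod-8 : ∀ n → Squares3∤ (+ (3 ℕ.+ 8 ℕ.* n))
squares3∤-3-mod-8 = Descent.all 3 4 1 (s≤s z≤n) (s≤s z≤n) Squares3∤ (λ n →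
    squares-dichotomy (three-squares-3-mod-8 n)) Squares3∤-9*

-- Choices modulo 3, and the pairs (2, 3) and (2, 6)

residue₃ : ∀ x → ∃[ a ] x ≈ + toℕ {3} a [ + 3 ]
residue₃ x = fromℕ< (n%ℕd<d x 3) , ≈-trans (step (x /ℕ 3) (a≡a%ℕn+[a/ℕn]*n x 3))
    (≈-reflexive (cong +_ (sym (Fin.toℕ-fromℕ< (n%ℕd<d x 3)))))

± : Fin 2 → ℤ
± 0F = + 1
± 1F = - + 1

±² : ∀ s x → ± s * x * (± s * x) ≡ x * x
±² 0F x = lem x
  where
  lem : ∀ x → + 1 * x * (+ 1 * x) ≡ x * x
  lem = solve-∀
±² 1F x = lem x
  where
  lem : ∀ x → - + 1 * x * (- + 1 * x) ≡ x * x
  lem = solve-∀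

3∤-transfer : ∀ {x y} → x ≈ y [ + 3 ] → ¬ 3 ℕ.∣ ∣ y ∣ → 3∤ x
3∤-transfer {x} {y} x≈y n x≈0 = n (Signed.∣⇒∣ᵤ (conv (≈-trans (≈-sym x≈y) x≈0)))
  where
  conv : y ≈ + 0 [ + 3 ] → + 3 Signed.∣ y
  conv (step k e) = Signed.divides k (trans e (ℤ.+-identityˡ _))

⟨_⟩ : Fin 3 → ℤ
⟨ a ⟩ = + toℕ a

-- These conditions make x - y, x + y + z and x + y - 2z prime to 3, the last two being congruent
-- modulo 3.
Good₂₃ : ℤ → ℤ → ℤ → Set
Good₂₃ x y z = ¬ 3 ℕ.∣ ∣ x + - y ∣ × ¬ 3 ℕ.∣ ∣ x + y + z ∣

-- These conditions make (x + y)/2, x - y + z and (x - y)/2 - z prime to 3; twice the last is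
-- congruent to the second modulo 3.
Good₂₆ : ℤ → ℤ → ℤ → Set
Good₂₆ x y z = ¬ 3 ℕ.∣ ∣ x + y ∣ × ¬ 3 ℕ.∣ ∣ x + - y + z ∣

good₂₃? : ∀ x y z → Dec (Good₂₃ x y z)
good₂₃? x y z = ¬? (3 ℕ.∣? ∣ x + - y ∣) ×-dec ¬? (3 ℕ.∣? ∣ x + y + z ∣)

good₂₆? : ∀ x y z → Dec (Good₂₆ x y z)
good₂₆? x y z = ¬? (3 ℕ.∣? ∣ x + y ∣) ×-dec ¬? (3 ℕ.∣? ∣ x + - y + z ∣)

Zero : Fin 3 → Fin 3 → Fin 3 → Set
Zero a b c = a ≡ 0F × b ≡ 0F × c ≡ 0F

zero? : ∀ a b c → Dec (Zero a b c)
zero? a b c = (a Fin.≟ 0F) ×-dec (b Fin.≟ 0F) ×-dec (c Fin.≟ 0F)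

abstract
  -- The signs of the two even variables and their order are free; 27 residue triples show that this
  -- freedom suffices unless all three vanish.
  choice₂₃ : ∀ a b c → Zero a b c ⊎
      (∃[ s ] ∃[ t ] (Good₂₃ ⟨ a ⟩ (± s * ⟨ b ⟩) (± t * ⟨ c ⟩) ⊎ Good₂₃ ⟨ a ⟩ (± s * ⟨ c ⟩) (± t * ⟨ b ⟩)))
  choice₂₃ = toWitness {a? = Fin.all? λ a → Fin.all? λ b → Fin.all? λ c →
      zero? a b c ⊎-dec (Fin.any? λ s → Fin.any? λ t → good₂₃? ⟨ a ⟩ (± s * ⟨ b ⟩) (± t * ⟨ c ⟩) ⊎-dec good₂₃? ⟨ a ⟩
      (± s * ⟨ c ⟩) (± t * ⟨ b ⟩))} tt

  choice₂₆ : ∀ a b c → Zero a b c ⊎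
      (∃[ s ] (Good₂₆ ⟨ a ⟩ ⟨ b ⟩ (± s * ⟨ c ⟩) ⊎ Good₂₆ ⟨ b ⟩ ⟨ c ⟩ (± s * ⟨ a ⟩) ⊎ Good₂₆ ⟨ a ⟩ ⟨ c ⟩
      (± s * ⟨ b ⟩)))
  choice₂₆ = toWitness {a? = Fin.all? λ a → Fin.all? λ b → Fin.all? λ c →
      zero? a b c ⊎-dec (Fin.any? λ s →
      good₂₆? ⟨ a ⟩ ⟨ b ⟩ (± s * ⟨ c ⟩) ⊎-dec (good₂₆? ⟨ b ⟩ ⟨ c ⟩ (± s * ⟨ a ⟩) ⊎-dec good₂₆? ⟨ a ⟩ ⟨ c ⟩
      (± s * ⟨ b ⟩)))} tt

not-Zero : ∀ {x y z a b c} → x ≈ ⟨ a ⟩ [ + 3 ] → y ≈ ⟨ b ⟩ [ + 3 ] → z ≈ ⟨ c ⟩ [ + 3 ] → 3∤ x ⊎ 3∤ y ⊎ 3∤ z →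
    ¬ Zero a b c
not-Zero xa yb zc (inj₁ n)        (refl , refl , refl) = n xa
not-Zero xa yb zc (inj₂ (inj₁ n)) (refl , refl , refl) = n yb
not-Zero xa yb zc (inj₂ (inj₂ n)) (refl , refl , refl) = n zc

-- 24n + 6 = 6(4n + 1), and 6(x² + y² + z²) = (x + y - 2z)² + 2(x + y + z)² + 3(x - y)². Modulo 4
-- exactly one square is odd; taking it as x² makes all three linear forms odd.
completed-2-3 : ∀ n → Completed (+ 2) (+ 3) (+ n)
completed-2-3 n = from (squares3∤-1-mod-4 n)
  where
  N = + 1 + + 4 * + n
  N≡ : + (1 ℕ.+ 4 ℕ.* n) ≡ N
  N≡ = cong (λ t → + 1 + t) (ℤ.pos-* 4 n)
  assemble : ∀ {x b c} → Odd x → 3∤ (x + - (+ 2 * b)) → 3∤ (x + + 2 * b + + 2 * c) → N ≡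
      x * x + + 2 * b * (+ 2 * b) + + 2 * c * (+ 2 * c) → Completed (+ 2) (+ 3) (+ n)
  assemble {x} {b} {c} ox n₁ n₂ e = x + + 2 * b + + 2 * - (+ 2 * c) , x + + 2 * b + + 2 * c , x + + 2 * - b ,
    (Odd-+even (- (+ 2 * c)) (Odd-+even b ox) , λ h → n₂ (≈-trans (step (+ 2 * c) (lem₁ x b c)) h)) ,
    (Odd-+even c (Odd-+even b ox) , n₂) ,
    (Odd-+even (- b) ox , subst 3∤ (cong (λ t → x + t) (ℤ.neg-distribʳ-* (+ 2) b)) n₁) ,
    trans (lem₂ (+ n)) (trans (cong (+ 6 *_) e) (lem₃ x b c))
    where
    lem₁ : ∀ x b c → x + + 2 * b + + 2 * c ≡ x + + 2 * b + + 2 * - (+ 2 * c) + + 2 * c * + 3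
    lem₁ = solve-∀
    lem₂ : ∀ n → + 24 * n + + 6 ≡ + 6 * (+ 1 + + 4 * n)
    lem₂ = solve-∀
    lem₃ : ∀ x b c → + 6 * (x * x + + 2 * b * (+ 2 * b) + + 2 * c * (+ 2 * c)) ≡
      (x + + 2 * b + + 2 * - (+ 2 * c)) * (x + + 2 * b + + 2 * - (+ 2 * c)) + + 2
          * ((x + + 2 * b + + 2 * c) * (x + + 2 * b + + 2 * c)) + + 3 * ((x + + 2 * - b) * (x + + 2 * - b))
    lem₃ = solve-∀
  ±-even : ∀ s b → ± s * (+ 2 * b) ≡ + 2 * (± s * b)
  ±-even s b = lem (± s) b
    where
    lem : ∀ s b → s * (+ 2 * b) ≡ + 2 * (s * b)
    lem = solve-∀
  place : ∀ {x y z b c a′ b′ c′} s t → Odd x → y ≡ + 2 * b → z ≡ + 2 * c → x ≈ a′ [ + 3 ] → y ≈ b′ [ + 3 ] →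
      z ≈ c′ [ + 3 ] →
          Good₂₃ a′ (± s * b′) (± t * c′) → N ≡ x * x + y * y + z * z → Completed (+ 2) (+ 3) (+ n)
  place {x} {b = b} {c} s t ox refl refl xa yb zc (g₁ , g₂) e = assemble {x} {± s * b} {± t * c} ox
    (subst (λ y → 3∤ (x + - y)) (±-even s b) (3∤-transfer (≈-+ xa (≈-neg (≈-*ˡ (± s) yb))) g₁))
    (subst₂ (λ y z → 3∤ (x + y + z)) (±-even s b) (±-even t c)
        (3∤-transfer (≈-+ (≈-+ xa (≈-*ˡ (± s) yb)) (≈-*ˡ (± t) zc)) g₂))
    (trans e (cong₂ (λ y z → x * x + y + z) (trans (sym (±² s (+ 2 * b))) (cong (λ t → t * t) (±-even s b)))
        (trans (sym (±² t (+ 2 * c))) (cong (λ t → t * t) (±-even t c)))))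
  arrange : ∀ {x y z b c} → Odd x → y ≡ + 2 * b → z ≡ + 2 * c → 3∤ x ⊎ 3∤ y ⊎ 3∤ z → N ≡ x * x + y * y + z * z →
      Completed (+ 2) (+ 3) (+ n)
  arrange {x} {y} {z} ox hy hz nd e = go (residue₃ x) (residue₃ y) (residue₃ z)
    where
    swap : ∀ a b c → a + b + c ≡ a + c + b
    swap = solve-∀
    go : _ → _ → _ → Completed (+ 2) (+ 3) (+ n)
    go (a , xa) (b , yb) (c , zc) = choose (choice₂₃ a b c)
      where
      choose : _ → Completed (+ 2) (+ 3) (+ n)
      choose (inj₁ all0) = contradiction all0 (not-Zero xa yb zc nd)
      choose (inj₂ (s , t , inj₁ g)) = place s t ox hy hz xa yb zc g e
      choose (inj₂ (s , t , inj₂ g)) = place s t ox hz hy xa zc yb g (trans e (swap (x * x) (y * y) (z * z)))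
  from : Squares3∤ (+ (1 ℕ.+ 4 ℕ.* n)) → Completed (+ 2) (+ 3) (+ n)
  from (x , y , z , nd , e) = cases (even-or-odd x) (even-or-odd y) (even-or-odd z)
    where
    e′ : N ≡ x * x + y * y + z * z
    e′ = trans (sym N≡) e
    yxz : ∀ a b c → a + b + c ≡ b + a + c
    yxz = solve-∀
    zxy : ∀ a b c → a + b + c ≡ c + a + b
    zxy = solve-∀
    rot : 3∤ x ⊎ 3∤ y ⊎ 3∤ z → 3∤ y ⊎ 3∤ x ⊎ 3∤ z
    rot (inj₁ k)        = inj₂ (inj₁ k)
    rot (inj₂ (inj₁ k)) = inj₁ k
    rot (inj₂ (inj₂ k)) = inj₂ (inj₂ k)
    rot′ : 3∤ x ⊎ 3∤ y ⊎ 3∤ z → 3∤ z ⊎ 3∤ x ⊎ 3∤ y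
    rot′ (inj₁ k)        = inj₂ (inj₁ k)
    rot′ (inj₂ (inj₁ k)) = inj₂ (inj₂ k)
    rot′ (inj₂ (inj₂ k)) = inj₁ k
    n-odd : ∀ t → x * x + y * y + z * z ≢ + 2 * t
    n-odd t h = even≢odd t (+ 2 * + n) (trans (sym h) (trans (sym e′) (lem (+ n))))
      where
      lem : ∀ n → + 1 + + 4 * n ≡ + 1 + + 2 * (+ 2 * n)
      lem = solve-∀
    cases : _ → _ → _ → Completed (+ 2) (+ 3) (+ n)
    cases (a , inj₂ hx) (b , inj₁ hy) (c , inj₁ hz) = arrange (a , hx) hy hz nd e′
    cases (a , inj₁ hx) (b , inj₂ hy) (c , inj₁ hz) =
        arrange (b , hy) hx hz (rot nd) (trans e′ (yxz (x * x) (y * y) (z * z)))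
    cases (a , inj₁ hx) (b , inj₁ hy) (c , inj₂ hz) =
        arrange (c , hz) hx hy (rot′ nd) (trans e′ (zxy (x * x) (y * y) (z * z)))
    cases (a , inj₂ refl) (b , inj₂ refl) (c , inj₂ refl) =
        contradiction (ℤ.*-cancelˡ-≡ (+ 2) (+ 2 * + n) (+ 1 + + 2 * (a + a * a + (b + b * b) + (c + c * c)))
        (trans (lem (+ n)) (trans (cong (_- + 1) e′) (lem₂ a b c))))
        (even≢odd (+ n) (a + a * a + (b + b * b) + (c + c * c)))
      where
      lem : ∀ n → + 2 * (+ 2 * n) ≡ + 1 + + 4 * n - + 1
      lem = solve-∀
      lem₂ : ∀ a b c → (+ 1 + + 2 * a) * (+ 1 + + 2 * a) + (+ 1 + + 2 * b) * (+ 1 + + 2 * b) + (+ 1 + + 2 * c)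
          * (+ 1 + + 2 * c) - + 1 ≡ + 2 * (+ 1 + + 2 * (a + a * a + (b + b * b) + (c + c * c)))
      lem₂ = solve-∀
    cases (a , inj₁ refl) (b , inj₁ refl) (c , inj₁ refl) =
        contradiction (lem a b c) (n-odd (+ 2 * (a * a) + + 2 * (b * b) + + 2 * (c * c)))
      where
      lem : ∀ a b c → (+ 2 * a) * (+ 2 * a) + (+ 2 * b) * (+ 2 * b) + (+ 2 * c) * (+ 2 * c) ≡
          + 2 * (+ 2 * (a * a) + + 2 * (b * b) + + 2 * (c * c))
      lem = solve-∀
    cases (a , inj₂ refl) (b , inj₂ refl) (c , inj₁ refl) =
        contradiction (lem a b c) (n-odd (+ 1 + + 2 * (a + a * a) + + 2 * (b + b * b) + + 2 * (c * c)))
      where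
      lem : ∀ a b c → (+ 1 + + 2 * a) * (+ 1 + + 2 * a) + (+ 1 + + 2 * b) * (+ 1 + + 2 * b) + (+ 2 * c) * (+ 2 * c)
          ≡ + 2 * (+ 1 + + 2 * (a + a * a) + + 2 * (b + b * b) + + 2 * (c * c))
      lem = solve-∀
    cases (a , inj₂ refl) (b , inj₁ refl) (c , inj₂ refl) =
        contradiction (lem a b c) (n-odd (+ 1 + + 2 * (a + a * a) + + 2 * (b * b) + + 2 * (c + c * c)))
      where
      lem : ∀ a b c → (+ 1 + + 2 * a) * (+ 1 + + 2 * a) + (+ 2 * b) * (+ 2 * b) + (+ 1 + + 2 * c) * (+ 1 + + 2 * c)
          ≡ + 2 * (+ 1 + + 2 * (a + a * a) + + 2 * (b * b) + + 2 * (c + c * c))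
      lem = solve-∀
    cases (a , inj₁ refl) (b , inj₂ refl) (c , inj₂ refl) =
        contradiction (lem a b c) (n-odd (+ 1 + + 2 * (a * a) + + 2 * (b + b * b) + + 2 * (c + c * c)))
      where
      lem : ∀ a b c → (+ 2 * a) * (+ 2 * a) + (+ 1 + + 2 * b) * (+ 1 + + 2 * b) + (+ 1 + + 2 * c) * (+ 1 + + 2 * c)
          ≡ + 2 * (+ 1 + + 2 * (a * a) + + 2 * (b + b * b) + + 2 * (c + c * c))
      lem = solve-∀

-- Signs are normalised so that for two such numbers half the difference is even and half the sum
-- odd, as the identity in `completed-2-6` requires.
1-mod-4 : ∀ {x} → Odd x → ∃[ a ] x * x ≡ (+ 1 + + 4 * a) * (+ 1 + + 4 * a) × (3∤ x → 3∤ (+ 1 + + 4 * a))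
1-mod-4 {x} (u , e) = cases (even-or-odd u)
  where
  cases : _ → ∃[ a ] x * x ≡ (+ 1 + + 4 * a) * (+ 1 + + 4 * a) × (3∤ x → 3∤ (+ 1 + + 4 * a))
  cases (a , inj₁ h) = a , cong (λ t → t * t) x≡ , subst 3∤ x≡
    where
    lem : ∀ a → + 1 + + 2 * (+ 2 * a) ≡ + 1 + + 4 * a
    lem = solve-∀
    x≡ : x ≡ + 1 + + 4 * a
    x≡ = trans e (trans (cong (λ t → + 1 + + 2 * t) h) (lem a))
  cases (a , inj₂ h) = - a - + 1 , trans (cong (λ t → t * t) x≡) (lem₂ (+ 1 + + 4 * (- a - + 1))) , λ n w →
      n (≈-trans (≈-reflexive x≡) (≈-neg w))
    where
    lem : ∀ a → + 1 + + 2 * (+ 1 + + 2 * a) ≡ - (+ 1 + + 4 * (- a - + 1))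
    lem = solve-∀
    lem₂ : ∀ w → - w * - w ≡ w * w
    lem₂ = solve-∀
    x≡ : x ≡ - (+ 1 + + 4 * (- a - + 1))
    x≡ = trans e (trans (cong (λ t → + 1 + + 2 * t) h) (lem a))

-- 24n + 9 = 3(8n + 3), and 3(x² + y² + r²) = (r + x - y)² + 2((x - y)/2 - r)² + 6((x + y)/2)².
-- Modulo 8 all three squares are odd, so x and y may be taken 1 modulo 4, while the sign of r stays
-- free.
completed-2-6 : ∀ n → Completed (+ 2) (+ 6) (+ n)
completed-2-6 n = from (squares3∤-3-mod-8 n)
  where
  N = + 3 + + 8 * + n
  N≡ : + (3 ℕ.+ 8 ℕ.* n) ≡ N
  N≡ = cong (λ t → + 3 + t) (ℤ.pos-* 8 n)
  assemble : ∀ a b {r} → Odd r → 3∤ ((+ 1 + + 4 * a) + (+ 1 + + 4 * b)) →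
      3∤ ((+ 1 + + 4 * a) + - (+ 1 + + 4 * b) + r) →
             N ≡ (+ 1 + + 4 * a) * (+ 1 + + 4 * a) + (+ 1 + + 4 * b) * (+ 1 + + 4 * b) + r * r →
                 Completed (+ 2) (+ 6) (+ n)
  assemble a b {r} or n₁ n₂ e = r + + 2 * (+ 2 * (a - b)) , - r + + 2 * (a - b) , + 1 + + 2 * (a + b) ,
    (Odd-+even (+ 2 * (a - b)) or , subst 3∤ (lem₁ a b r) n₂) ,
    (Odd-+even (a - b) (Odd-neg or) , λ h → n₂ (≈-trans (step r (lem₂ a b r)) (≈-*ˡ (+ 2) h))) ,
    ((a + b , refl) , λ h → n₁ (≈-trans (≈-reflexive (lem₃ a b)) (≈-*ˡ (+ 2) h))) ,
    trans (lem₄ (+ n)) (trans (cong (+ 3 *_) e) (lem₅ a b r))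
    where
    lem₁ : ∀ a b r → (+ 1 + + 4 * a) + - (+ 1 + + 4 * b) + r ≡ r + + 2 * (+ 2 * (a - b))
    lem₁ = solve-∀
    lem₂ : ∀ a b r → (+ 1 + + 4 * a) + - (+ 1 + + 4 * b) + r ≡ + 2 * (- r + + 2 * (a - b)) + r * + 3
    lem₂ = solve-∀
    lem₃ : ∀ a b → (+ 1 + + 4 * a) + (+ 1 + + 4 * b) ≡ + 2 * (+ 1 + + 2 * (a + b))
    lem₃ = solve-∀
    lem₄ : ∀ n → + 24 * n + + 9 ≡ + 3 * (+ 3 + + 8 * n)
    lem₄ = solve-∀
    lem₅ : ∀ a b r → + 3 * ((+ 1 + + 4 * a) * (+ 1 + + 4 * a) + (+ 1 + + 4 * b) * (+ 1 + + 4 * b) + r * r) ≡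
      (r + + 2 * (+ 2 * (a - b))) * (r + + 2 * (+ 2 * (a - b))) + + 2
          * ((- r + + 2 * (a - b)) * (- r + + 2 * (a - b))) + + 6 * ((+ 1 + + 2 * (a + b)) * (+ 1 + + 2 * (a + b)))
    lem₅ = solve-∀
  ±-odd : ∀ s {x} → Odd x → Odd (± s * x)
  ±-odd 0F {x} o = subst Odd (sym (ℤ.*-identityˡ x)) o
  ±-odd 1F {x} o = subst Odd (sym (ℤ.-1*i≡-i x)) (Odd-neg o)
  Odd-1-mod-4 : ∀ a → Odd (+ 1 + + 4 * a)
  Odd-1-mod-4 a = + 2 * a , lem a
    where
    lem : ∀ a → + 1 + + 4 * a ≡ + 1 + + 2 * (+ 2 * a)
    lem = solve-∀
  place : ∀ a b c s {a′ b′ c′} → + 1 + + 4 * a ≈ a′ [ + 3 ] → + 1 + + 4 * b ≈ b′ [ + 3 ] → + 1 + + 4 * c ≈ c′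
      [ + 3 ] → Good₂₆ a′ b′ (± s * c′) →
          N ≡ (+ 1 + + 4 * a) * (+ 1 + + 4 * a) + (+ 1 + + 4 * b) * (+ 1 + + 4 * b) + (+ 1 + + 4 * c)
              * (+ 1 + + 4 * c) → Completed (+ 2) (+ 6) (+ n)
  place a b c s xa yb zc (g₁ , g₂) e = assemble a b (±-odd s (Odd-1-mod-4 c)) (3∤-transfer (≈-+ xa yb) g₁)
      (3∤-transfer (≈-+ (≈-+ xa (≈-neg yb)) (≈-*ˡ (± s) zc)) g₂)
    (trans e (cong (λ t → (+ 1 + + 4 * a) * (+ 1 + + 4 * a) + (+ 1 + + 4 * b) * (+ 1 + + 4 * b) + t)
        (sym (±² s (+ 1 + + 4 * c)))))
  arrange : ∀ a b c → 3∤ (+ 1 + + 4 * a) ⊎ 3∤ (+ 1 + + 4 * b) ⊎ 3∤ (+ 1 + + 4 * c) →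
            N ≡ (+ 1 + + 4 * a) * (+ 1 + + 4 * a) + (+ 1 + + 4 * b) * (+ 1 + + 4 * b) + (+ 1 + + 4 * c)
                * (+ 1 + + 4 * c) → Completed (+ 2) (+ 6) (+ n)
  arrange a b c nd e = go (residue₃ (+ 1 + + 4 * a)) (residue₃ (+ 1 + + 4 * b)) (residue₃ (+ 1 + + 4 * c))
    where
    yzx : ∀ a b c → a + b + c ≡ b + c + a
    yzx = solve-∀
    xzy : ∀ a b c → a + b + c ≡ a + c + b
    xzy = solve-∀
    go : _ → _ → _ → Completed (+ 2) (+ 6) (+ n)
    go (a′ , xa) (b′ , yb) (c′ , zc) = choose (choice₂₆ a′ b′ c′)
      where
      choose : _ → Completed (+ 2) (+ 6) (+ n)
      choose (inj₁ all0) = contradiction all0 (not-Zero xa yb zc nd)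
      choose (inj₂ (s , inj₁ g)) = place a b c s xa yb zc g e
      choose (inj₂ (s , inj₂ (inj₁ g))) =
          place b c a s yb zc xa g (trans e
          (yzx ((+ 1 + + 4 * a) * (+ 1 + + 4 * a)) ((+ 1 + + 4 * b) * (+ 1 + + 4 * b))
          ((+ 1 + + 4 * c) * (+ 1 + + 4 * c))))
      choose (inj₂ (s , inj₂ (inj₂ g))) =
          place a c b s xa zc yb g (trans e
          (xzy ((+ 1 + + 4 * a) * (+ 1 + + 4 * a)) ((+ 1 + + 4 * b) * (+ 1 + + 4 * b))
          ((+ 1 + + 4 * c) * (+ 1 + + 4 * c))))
  from : Squares3∤ (+ (3 ℕ.+ 8 ℕ.* n)) → Completed (+ 2) (+ 6) (+ n)
  from (x , y , z , nd , e) = cases (even-or-odd x) (even-or-odd y) (even-or-odd z)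
    where
    e′ : N ≡ x * x + y * y + z * z
    e′ = trans (sym N≡) e
    n-odd : ∀ t → x * x + y * y + z * z ≢ + 2 * t
    n-odd t h = even≢odd t (+ 1 + + 4 * + n) (trans (sym h) (trans (sym e′) (lem (+ n))))
      where
      lem : ∀ n → + 3 + + 8 * n ≡ + 1 + + 2 * (+ 1 + + 4 * n)
      lem = solve-∀
    one-odd : ∀ {x b c} → Odd x → N ≢ x * x + + 4 * (b * b + c * c)
    one-odd {x} {b} {c} ox h = go (odd-square ox)
      where
      go : _ → ⊥
      go (t , x²) = even≢odd (b * b + c * c) (+ 2 * (+ n - t))
          (ℤ.*-cancelˡ-≡ (+ 2) _ _ (trans (lem (x * x) (b * b + c * c))
          (trans (cong₂ _-_ (sym h) x²) (lem₂ (+ n) t))))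
        where
        lem : ∀ q s → + 2 * (+ 2 * s) ≡ q + + 4 * s - q
        lem = solve-∀
        lem₂ : ∀ n t → + 3 + + 8 * n - (+ 1 + + 8 * t) ≡ + 2 * (+ 1 + + 2 * (+ 2 * (n - t)))
        lem₂ = solve-∀
    cases : _ → _ → _ → Completed (+ 2) (+ 6) (+ n)
    cases (a , inj₂ hx) (b , inj₂ hy) (c , inj₂ hz) = go (1-mod-4 (a , hx)) (1-mod-4 (b , hy)) (1-mod-4 (c , hz))
      where
      go : _ → _ → _ → Completed (+ 2) (+ 6) (+ n)
      go (a , x² , nx) (b , y² , ny) (c , z² , nz) =
          arrange a b c (⊎.map nx (⊎.map ny nz) nd) (trans e′ (cong₂ _+_ (cong₂ _+_ x² y²) z²))
    cases (a , inj₂ hx) (b , inj₁ refl) (c , inj₁ refl) =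
        contradiction (trans e′ (lem (x * x) b c)) (one-odd {b = b} {c} (a , hx))
      where
      lem : ∀ q b c → q + + 2 * b * (+ 2 * b) + + 2 * c * (+ 2 * c) ≡ q + + 4 * (b * b + c * c)
      lem = solve-∀
    cases (a , inj₁ refl) (b , inj₂ hy) (c , inj₁ refl) =
        contradiction (trans e′ (lem (y * y) a c)) (one-odd {b = a} {c} (b , hy))
      where
      lem : ∀ q b c → + 2 * b * (+ 2 * b) + q + + 2 * c * (+ 2 * c) ≡ q + + 4 * (b * b + c * c)
      lem = solve-∀
    cases (a , inj₁ refl) (b , inj₁ refl) (c , inj₂ hz) =
        contradiction (trans e′ (lem (z * z) a b)) (one-odd {b = a} {b} (c , hz))
      where
      lem : ∀ q b c → + 2 * b * (+ 2 * b) + + 2 * c * (+ 2 * c) + q ≡ q + + 4 * (b * b + c * c)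
      lem = solve-∀
    cases (a , inj₁ refl) (b , inj₁ refl) (c , inj₁ refl) =
        contradiction (lem a b c) (n-odd (+ 2 * (a * a) + + 2 * (b * b) + + 2 * (c * c)))
      where
      lem : ∀ a b c → (+ 2 * a) * (+ 2 * a) + (+ 2 * b) * (+ 2 * b) + (+ 2 * c) * (+ 2 * c) ≡
          + 2 * (+ 2 * (a * a) + + 2 * (b * b) + + 2 * (c * c))
      lem = solve-∀
    cases (a , inj₂ refl) (b , inj₂ refl) (c , inj₁ refl) =
        contradiction (lem a b c) (n-odd (+ 1 + + 2 * (a + a * a) + + 2 * (b + b * b) + + 2 * (c * c)))
      where
      lem : ∀ a b c → (+ 1 + + 2 * a) * (+ 1 + + 2 * a) + (+ 1 + + 2 * b) * (+ 1 + + 2 * b) + (+ 2 * c) * (+ 2 * c)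
          ≡ + 2 * (+ 1 + + 2 * (a + a * a) + + 2 * (b + b * b) + + 2 * (c * c))
      lem = solve-∀
    cases (a , inj₂ refl) (b , inj₁ refl) (c , inj₂ refl) =
        contradiction (lem a b c) (n-odd (+ 1 + + 2 * (a + a * a) + + 2 * (b * b) + + 2 * (c + c * c)))
      where
      lem : ∀ a b c → (+ 1 + + 2 * a) * (+ 1 + + 2 * a) + (+ 2 * b) * (+ 2 * b) + (+ 1 + + 2 * c) * (+ 1 + + 2 * c)
          ≡ + 2 * (+ 1 + + 2 * (a + a * a) + + 2 * (b * b) + + 2 * (c + c * c))
      lem = solve-∀
    cases (a , inj₁ refl) (b , inj₂ refl) (c , inj₂ refl) =
        contradiction (lem a b c) (n-odd (+ 1 + + 2 * (a * a) + + 2 * (b + b * b) + + 2 * (c + c * c)))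
      where
      lem : ∀ a b c → (+ 2 * a) * (+ 2 * a) + (+ 1 + + 2 * b) * (+ 1 + + 2 * b) + (+ 1 + + 2 * c) * (+ 1 + + 2 * c)
          ≡ + 2 * (+ 1 + + 2 * (a * a) + + 2 * (b + b * b) + + 2 * (c + c * c))
      lem = solve-∀

theorem1p1 : (b c : ℕ) →
    ((b ≡ 1 × c ≡ 3) ⊎ (b ≡ 2 × c ≡ 3) ⊎ (b ≡ 2 × c ≡ 6) ⊎ (b ≡ 3 × c ≡ 3) ⊎ (b ≡ 3 × c ≡ 4) ⊎ (b ≡ 3 × c ≡ 9)) →
    (n : ℕ) → ∃[ x ] ∃[ y ] ∃[ z ] (+ n ≡ p₅ x + (+ b) * p₅ y + (+ c) * p₅ z)
theorem1p1 _ _ (inj₁ (refl , refl)) n = uncomplete {+ 1} {+ 3} (completed-1-3 n)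
theorem1p1 _ _ (inj₂ (inj₁ (refl , refl))) n = uncomplete {+ 2} {+ 3} (completed-2-3 n)
theorem1p1 _ _ (inj₂ (inj₂ (inj₁ (refl , refl)))) n = uncomplete {+ 2} {+ 6} (completed-2-6 n)
theorem1p1 _ _ (inj₂ (inj₂ (inj₂ (inj₁ (refl , refl))))) n = uncomplete {+ 3} {+ 3} (completed-3-3 n)
theorem1p1 _ _ (inj₂ (inj₂ (inj₂ (inj₂ (inj₁ (refl , refl)))))) n = uncomplete {+ 3} {+ 4} (completed-3-4 n)
theorem1p1 _ _ (inj₂ (inj₂ (inj₂ (inj₂ (inj₂ (refl , refl)))))) n = uncomplete {+ 3} {+ 9} (completed-3-9 n)
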